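{- Let $\Phi$ be of type $A_{n-1}$ and $m=1$. Then, as maps $\mathcal{PF}_n\to\mathcal{D}_n$, $$\zeta_{HL}=\epsilon\circ\zeta\circ\chi^{ -1}=\delta\circ\mathcal{A}_{GMV}^{ -1}.$$
   Context: Type $A_{n-1}$: $V=\{x\in\mathbb{R}^n:\sum x_i=0\}$, $\Phi^+=\{e_i-e_j:i<j\}$, simple roots $e_i-e_{i+1}$, $\theta=e_1-e_n$, $h=n$, $W=S_n$ permuting coordinates, $Q^\vee=\{x\in\mathbb{Z}^n:\sum x_i=0\}$, $C=\{x_1>\dots>x_n\}$, $A_\circ=\{x\in C:x_1-x_n<1\}$. $\widetilde{W}=S_n\ltimes Q^\vee$ is identified with affine permutations $\widetilde{S}_n$ (bijections of $\mathbb{Z}$ with $\widetilde{\sigma}(i+n)=\widetilde{\sigma}(i)+n$, $\sum_{i=1}^n\widetilde{\sigma}(i)=\binom{n+1}2$) by sending the reflection in $\{x_i=x_{i+1}\}$ to $\widetilde{s}_i$ and in $\{x_1-x_n=1\}$ to $\widetilde{s}_0$ ($\widetilde{s}_j(i)=i\pm1$ for $i\equiv j$, resp. $j+1$ mod $n$, else $i$); action on $V$ written $\cdot$. $\widetilde{S}_n^{n+1}=\{\widetilde{w}:\widetilde{w}(i+n+1)>\widetilde{w}(i)\ \forall i\}$. $\widetilde{w}_{n+1}$ is the unique element of $\widetilde{W}$ mapping $\{x:\langle x,\alpha\rangle>-1\ \forall\text{ simple }\alpha,\ \langle x,\theta\rangle<2\}$ onto $(n+1)A_\circ$. Shi arrangement: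 hyperplanes $\langle x,\alpha\rangle=k$, $\alpha\in\Phi^+$, $k\in\{0,1\}$. For a dominant Shi region $R$ (one in $C$), $\phi(R)=\{\alpha\in\Phi^+:\langle x,\alpha\rangle>1\ \forall x\in R\}$, a bijection onto order filters of the root poset ($\alpha\le\beta$ iff $\beta-\alpha$ is a sum of positive roots). Each Shi region $R$ has a unique minimal alcove $\widetilde{w}_RA_\circ$ ($|k(\widetilde{w}_R,\alpha)|\le|k(\widetilde{w},\alpha)|$ for all $\alpha\in\Phi^+$ and alcoves $\widetilde{w}A_\circ\subseteq R$, $k(\widetilde{w},\alpha)$ the integer $k$ with $k<\langle x,\alpha\rangle<k+1$ on $\widetilde{w}A_\circ$). For an order filter $J$, $\mathrm{ind}(J)$ = minimal elements, $W_J=\langle s_\alpha:\alpha\in\mathrm{ind}(J)\rangle$; $\mathsf{Park}_\Phi$ = classes $[w,J]$, $(w_1,J_1)\sim(w_2,J_2)$ iff $J_1=J_2$, $w_1W_{J_1}=w_2W_{J_1}$. $\Gamma([w,J])=w\widetilde{w}_{\phi^{ -1}(J)}\widetilde{w}_{n+1}^{ -1}\cdot0+(n+1)Q^\vee$ is a bijection $\mathsf{Park}_\Phi\to Q^\vee/(n+1)Q^\vee$, and $\zeta=\Gamma^{ -1}$. $\mathcal{PF}_n$: tuples $f\in\mathbb{Z}_{\ge0}^n$ with $\#\{i:f_i<l\}\ge nl/(n+1)$ for all $l\in[n+1]$. $\chi:Q^\vee/(n+1)Q^\vee\to\mathcal{PF}_n$ sends a class to the unique $f\in\mathcal{PF}_n$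 whose reduction mod $n+1$ lies in the same coset of $\langle(1,\dots,1)\rangle$ in $\mathbb{Z}_{n+1}^n$ as the reduction of the class. $\mathcal{A}_{GMV}:\widetilde{S}_n^{n+1}\to\mathcal{PF}_n$: with $p=n+1$, $\Delta_{\widetilde{w}}=\{i:\widetilde{w}(i)>0\}$, $M=\min\Delta_{\widetilde{w}}$, $\widetilde{\Delta}=\Delta_{\widetilde{w}}-M$, $l(x,y)=-n-nx+py$, $P_i=\#\{0\le x<p: l(x,i-1)\in\widetilde{\Delta}\}$, $\sigma(i)=\widetilde{w}(l(P_i-1,i-1)+M)$; set $\mathcal{A}_{GMV}(\widetilde{w})=f$ with $f_{\sigma(i)}=P_i$. (It is a bijection.) Dyck paths of length $n$: N/E lattice paths $(0,0)\to(n,n)$ weakly above $y=x$; valley $(i,j)$: $i$-th East step immediately followed by $j$-th North step. $\mathcal{D}_n$ = pairs $(w,D)$, $w\in S_n$, $w(i)<w(j)$ for all valleys $(i,j)$. $D(J)$: the Dyck path such that for $i<j$ the unit box with top-right corner $(i,j)$ is above $D(J)$ iff $e_i-e_j\in J$. $\epsilon([w,J])=(w',D(J))$ with $w'$ the unique element of $wW_J$ with $w'(\mathrm{ind}(J))\subseteq\Phi^+$. $\delta(\widetilde{w})=(w,D(\phi(R_{\mathrm{dom}})))$ where $\widetilde{w}A_\circ\subseteq wC$ and $R_{\mathrm{dom}}$ is the dominant Shi region containing $w^{ -1}\widetilde{w}A_\circ$. Zeta map of Haglund–Loehr: for $f\in\mathcal{PF}_n$, let $P=(P_1\le\dots\le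 P_n)$ be its increasing rearrangement and $\sigma\in S_n$ the permutation with $f_{\sigma(i)}=P_i$ and $\sigma(i)<\sigma(i+1)$ whenever $P_i=P_{i+1}$. Area vector $a_i=i-1-P_i$. Diagonal reading word $\mathsf{drw}(P,\sigma)\in S_n$: list $\sigma(i)$ for all $i$ with $a_i=0$ in increasing $i$, then those with $a_i=1$, etc.; $\mathsf{drw}(j)$ is the $j$-th listed label. $\zeta_H(P)$: for $t=0,1,\dots,n$ in turn, scan $i=1,\dots,n$ and write a North step when $a_i=t$ and an East step when $a_i=t-1$; the concatenation is a Dyck path. $\zeta_{HL}(f)=(\mathsf{drw}(P,\sigma),\zeta_H(P))$. -}

module Defs where

open import Data.Nat as ℕ using (ℕ; zero; suc; _≤_; _<_; _∸_; _*_)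
open import Data.Integer as ℤ using (ℤ; +_)
open import Data.Integer.Divisibility as ℤD using ()
open import Data.Integer.DivMod using (n%ℕd<d)
open import Data.Rational as ℚ using (ℚ; 0ℚ; 1ℚ)
open import Data.Fin as Fin using (Fin; toℕ; fromℕ; fromℕ<; inject₁)
open import Data.Fin.Permutation using (Permutation′; _⟨$⟩ʳ_; _⟨$⟩ˡ_)
open import Data.Vec using (Vec; lookup)
open import Data.List as List using (List; []; _∷_; length; filter; upTo; allFin; concatMap; tabulate; take)
open import Data.List.Relation.Unary.All using (All)
open import Data.Product using (Σ; _×_; _,_; Σ-syntax)
open import Data.Bool using (Bool; true; false; if_then_else_)
open import Relation.Binary.PropositionalEquality using (_≡_)
open import Relation.Nullary using (does)

data Step : Set where
  N E : Step

-- the three possible positions of ⟨x,α⟩ w.r.t. the two Shi hyperplanes k = 0, 1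
data Three : Set where
  neg mid pos : Three

-- Everything is for type A_{n-1} with n = suc m (so n ≥ 1).
-- Coordinates are indexed 0-based by Fin n (index a ↔ coordinate a+1 of the paper).
module _ (m : ℕ) where

  private
    n : ℕ
    n = suc m

  sumℤ : (Fin n → ℤ) → ℤ
  sumℤ v = List.foldr ℤ._+_ (+ 0) (tabulate v)

  sumℚ : (Fin n → ℚ) → ℚ
  sumℚ v = List.foldr ℚ._+_ 0ℚ (tabulate v)

  toQ : ℤ → ℚ
  toQ z = z ℚ./ 1

  InQ : (Fin n → ℤ) → Set
  InQ c = sumℤ c ≡ + 0

  InV : (Fin n → ℚ) → Set
  InV x = sumℚ x ≡ 0ℚ

  first last : Fin n
  first = Fin.zero
  last = fromℕ m

  InC : (Fin n → ℚ) → Set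
  InC x = InV x × (∀ i j → i Fin.< j → x j ℚ.< x i)

  InA : (Fin n → ℚ) → Set
  InA x = InC x × (x first ℚ.- x last ℚ.< 1ℚ)

  InDilA : (Fin n → ℚ) → Set
  InDilA x = InC x × (x first ℚ.- x last ℚ.< toQ (+ suc n))

  InB : (Fin n → ℚ) → Set
  InB x = InV x × (∀ (i : Fin m) → ℚ.- 1ℚ ℚ.< x (inject₁ i) ℚ.- x (Fin.suc i))
                × (x first ℚ.- x last ℚ.< toQ (+ 2))

  -- affine Weyl group W~ = S_n ⋉ Q^∨, element (w, λ) acting by x ↦ w·x + λ,
  -- where (w·x)_{w(i)} = x_i (i.e. w e_i = e_{w(i)}).
  record Aff : Set where
    field
      perm  : Permutation′ n
      tr    : Fin n → ℤ
      trSum : InQ tr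
  open Aff public

  actQ : Aff → (Fin n → ℚ) → Fin n → ℚ
  actQ w x a = x (perm w ⟨$⟩ˡ a) ℚ.+ toQ (tr w a)

  actZ : Aff → (Fin n → ℤ) → Fin n → ℤ
  actZ w x a = x (perm w ⟨$⟩ˡ a) ℤ.+ tr w a

  actInvZ : Aff → (Fin n → ℤ) → Fin n → ℤ
  actInvZ w y i = y (perm w ⟨$⟩ʳ i) ℤ.- tr w (perm w ⟨$⟩ʳ i)

  permZ : Permutation′ n → (Fin n → ℤ) → Fin n → ℤ
  permZ w x a = x (w ⟨$⟩ˡ a)

  permInvQ : Permutation′ n → (Fin n → ℚ) → Fin n → ℚ
  permInvQ w z i = z (w ⟨$⟩ʳ i)

  -- associated affine permutation ℤ → ℤ (1-based):
  -- w~(i) = w(i) + n λ_{w(i)} for i ∈ [1,n], and w~(i+n) = w~(i)+n.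
  aff : Aff → ℤ → ℤ
  aff w z = + suc (toℕ v) ℤ.+ (+ n) ℤ.* (tr w v ℤ.+ q)
    where
      z′ = z ℤ.- + 1
      r : Fin n
      r = fromℕ< (n%ℕd<d z′ n)
      q = z′ ℤ./ℕ n
      v = perm w ⟨$⟩ʳ r

  InSn1 : Aff → Set
  InSn1 w = ∀ z → aff w z ℤ.< aff w (z ℤ.+ + suc n)

  record PosRoot : Set where
    constructor root
    field
      ri rj : Fin n
      .lt : ri Fin.< rj
  open PosRoot public

  pairQ : (Fin n → ℚ) → PosRoot → ℚ
  pairQ y α = y (ri α) ℚ.- y (rj α)

  K : Aff → PosRoot → ℤ → Set
  K w α k = ∀ x → InA x →
    (toQ k ℚ.< pairQ (actQ w x) α) × (pairQ (actQ w x) α ℚ.< toQ (k ℤ.+ + 1))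

  -- Shi regions, given by the position of each ⟨x,α⟩ relative to 0 and 1
  Sat : Three → ℚ → Set
  Sat neg v = v ℚ.< 0ℚ
  Sat mid v = (0ℚ ℚ.< v) × (v ℚ.< 1ℚ)
  Sat pos v = 1ℚ ℚ.< v

  InRegion : (PosRoot → Three) → (Fin n → ℚ) → Set
  InRegion s z = InV z × (∀ α → Sat (s α) (pairQ z α))

  IsDomShi : (PosRoot → Three) → Set
  IsDomShi s = (Σ (Fin n → ℚ) (InRegion s)) × (∀ z → InRegion s z → InC z)

  φ : (PosRoot → Three) → PosRoot → Set
  φ s α = ∀ z → InRegion s z → 1ℚ ℚ.< pairQ z α

  AlcIn : Aff → (PosRoot → Three) → Set
  AlcIn w s = ∀ x → InA x → InRegion s (actQ w x)

  IsMinAlc : (PosRoot → Three) → Aff → Set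
  IsMinAlc s wR = AlcIn wR s ×
    (∀ w → AlcIn w s → ∀ α k₁ k₂ → K wR α k₁ → K w α k₂ → ℤ.∣ k₁ ∣ ≤ ℤ.∣ k₂ ∣)

  IsWn1 : Aff → Set
  IsWn1 w = ∀ x → InV x → (InB x → InDilA (actQ w x)) × (InDilA (actQ w x) → InB x)

  ind01 : Bool → ℤ
  ind01 true = + 1
  ind01 false = + 0

  rootVec : PosRoot → Fin n → ℤ
  rootVec α k = ind01 (does (k Fin.≟ ri α)) ℤ.- ind01 (does (k Fin.≟ rj α))

  rootSum : List PosRoot → Fin n → ℤ
  rootSum [] k = + 0
  rootSum (α ∷ L) k = rootVec α k ℤ.+ rootSum L k

  RootLe : PosRoot → PosRoot → Set
  RootLe α β = Σ[ L ∈ List PosRoot ] (∀ k → rootSum L k ≡ rootVec β k ℤ.- rootVec α k)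

  IsFilter : (PosRoot → Bool) → Set
  IsFilter J = ∀ α β → J α ≡ true → RootLe α β → J β ≡ true

  IsInd : (PosRoot → Bool) → PosRoot → Set
  IsInd J α = (J α ≡ true) ×
    (∀ β → J β ≡ true → RootLe β α → (ri β ≡ ri α) × (rj β ≡ rj α))

  swap : PosRoot → Fin n → Fin n
  swap α k = if does (k Fin.≟ ri α) then rj α else (if does (k Fin.≟ rj α) then ri α else k)

  applyRefls : List PosRoot → Fin n → Fin n
  applyRefls [] k = k
  applyRefls (α ∷ L) k = swap α (applyRefls L k)

  countN countE : List Step → ℕ
  countN [] = 0
  countN (N ∷ s) = suc (countN s)
  countN (E ∷ s) = countN s
  countE [] = 0
  countE (N ∷ s) = countE s
  countE (E ∷ s) = suc (countE s)

  IsDyck : List Step → Set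
  IsDyck D = (countN D ≡ n) × (countE D ≡ n) × (∀ k → countE (take k D) ≤ countN (take k D))

  hbe : List Step → ℕ → ℕ
  hbe [] k = 0
  hbe (N ∷ s) k = suc (hbe s k)
  hbe (E ∷ s) zero = 0
  hbe (E ∷ s) (suc k) = hbe s k

  -- D is D(P): box with top-right corner (a+1,b+1) (a<b) is above D iff e_{a+1}-e_{b+1} ∈ P
  IsDJ : (PosRoot → Set) → List Step → Set
  IsDJ P D = IsDyck D × (∀ a b (lt : a Fin.< b) →
    ((hbe D (toℕ a) ≤ toℕ b → P (root a b lt)) × (P (root a b lt) → hbe D (toℕ a) ≤ toℕ b)))

  -- elements of 𝒟_n are compared as (one-line notation of w, path)
  Out : Set
  Out = List (Fin n) × List Step

  permList : Permutation′ n → List (Fin n)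
  permList w = tabulate (w ⟨$⟩ʳ_)

  cnt< : Vec ℕ n → ℕ → ℕ
  cnt< f l = length (filter (λ i → lookup f i ℕ.<? l) (allFin n))

  IsPF : Vec ℕ n → Set
  IsPF f = ∀ l → 1 ≤ l → l ≤ suc n → n * l ≤ suc n * cnt< f l

  ChiRel : (Fin n → ℤ) → Vec ℕ n → Set
  ChiRel c f = InQ c × IsPF f ×
    Σ[ k ∈ ℤ ] (∀ i → (+ suc n) ℤD.∣ ((+ lookup f i) ℤ.- (c i ℤ.+ k)))

  GammaRel : Permutation′ n → (PosRoot → Bool) → (Fin n → ℤ) → Set
  GammaRel w J c =
    Σ[ s ∈ (PosRoot → Three) ] IsDomShi s ×
      (∀ α → (J α ≡ true → φ s α) × (φ s α → J α ≡ true)) ×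
    Σ[ wR ∈ Aff ] IsMinAlc s wR ×
    Σ[ wN ∈ Aff ] IsWn1 wN ×
      (∀ a → (+ suc n) ℤD.∣ (permZ w (actZ wR (actInvZ wN (λ _ → + 0))) a ℤ.- c a))

  Eps : Permutation′ n → (PosRoot → Bool) → Out → Set
  Eps w J X =
    Σ[ w′ ∈ Permutation′ n ]
      (Σ[ L ∈ List PosRoot ] All (IsInd J) L × (∀ k → w′ ⟨$⟩ʳ k ≡ w ⟨$⟩ʳ applyRefls L k)) ×
      (∀ α → IsInd J α → (w′ ⟨$⟩ʳ ri α) Fin.< (w′ ⟨$⟩ʳ rj α)) ×
    Σ[ D ∈ List Step ] IsDJ (λ α → J α ≡ true) D × (X ≡ (permList w′ , D))

  Delta : Aff → Out → Set
  Delta w X =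
    Σ[ u ∈ Permutation′ n ] (∀ x → InA x → InC (permInvQ u (actQ w x))) ×
    Σ[ s ∈ (PosRoot → Three) ] IsDomShi s × (∀ x → InA x → InRegion s (permInvQ u (actQ w x))) ×
    Σ[ D ∈ List Step ] IsDJ (φ s) D × (X ≡ (permList u , D))

  IsMinΔ : Aff → ℤ → Set
  IsMinΔ w M = (+ 0 ℤ.< aff w M) × (∀ z → + 0 ℤ.< aff w z → M ℤ.≤ z)

  lfun : ℤ → ℤ → ℤ
  lfun x y = ℤ.- (+ n) ℤ.- (+ n) ℤ.* x ℤ.+ (+ suc n) ℤ.* y

  Pg : Aff → ℤ → Fin n → ℕ
  Pg w M i = length (filter (λ x → + 0 ℤ.<? aff w (lfun (+ x) (+ toℕ i) ℤ.+ M)) (upTo (suc n)))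

  σg : Aff → ℤ → Fin n → ℤ
  σg w M i = aff w (lfun (+ Pg w M i ℤ.- + 1) (+ toℕ i) ℤ.+ M)

  AGMV : Aff → Vec ℕ n → Set
  AGMV w f = Σ[ M ∈ ℤ ] IsMinΔ w M ×
    (∀ i → Σ[ j ∈ Fin n ] (σg w M i ≡ + suc (toℕ j)) × (lookup f j ≡ Pg w M i))

  Pv : Vec ℕ n → Permutation′ n → Fin n → ℕ
  Pv f σ k = lookup f (σ ⟨$⟩ʳ k)

  area : Vec ℕ n → Permutation′ n → Fin n → ℕ
  area f σ k = toℕ k ∸ Pv f σ k

  drw : Vec ℕ n → Permutation′ n → List (Fin n)
  drw f σ = concatMap (λ t → List.map (σ ⟨$⟩ʳ_) (filter (λ k → area f σ k ℕ.≟ t) (allFin n))) (upTo n)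

  stepAt : ℕ → ℕ → List Step
  stepAt a t = if does (a ℕ.≟ t) then N ∷ [] else (if does (suc a ℕ.≟ t) then E ∷ [] else [])

  zetaH : Vec ℕ n → Permutation′ n → List Step
  zetaH f σ = concatMap (λ t → concatMap (λ k → stepAt (area f σ k) t) (allFin n)) (upTo (suc n))

  ZHL : Vec ℕ n → Out → Set
  ZHL f X = Σ[ σ ∈ Permutation′ n ]
    (∀ k k′ → k Fin.< k′ → Pv f σ k ≤ Pv f σ k′) ×
    (∀ k k′ → k Fin.< k′ → Pv f σ k ≡ Pv f σ k′ → (σ ⟨$⟩ʳ k) Fin.< (σ ⟨$⟩ʳ k′)) ×
    (X ≡ (drw f σ , zetaH f σ))

{-# OPTIONS --safe #-}

-- An alcove wA is encoded by its places p(a), the values of the inverse affine permutation: on wA coordinate a is about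
-- -p(a)/n, so that ⟨x, e_a - e_b⟩ > k there as soon as p(b) - p(a) > kn. If w is (n+1)-stable, the places, listed by residue,
-- are M + nA_i + i with A_0 = 0 and A_{i+1} ≤ A_i + 1, so A is the area vector of a Dyck path, and stability also says
-- that the labels increase whenever A_{i+1} = A_i + 1. Counting cells shows that P_i = i - A_i are the values of A_GMV(w).
-- The order of the places is lexicographic in (A_i, i), which is the diagonal reading order, and comparing p(a) + n with
-- p(b) is comparing an East step of ζ_H with a North step; this gives δ ∘ A_GMV⁻¹ = ζ_HL.
-- Minimal alcoves are stable, because exchanging two offending residues crosses a single hyperplane, not in the Shi
-- arrangement, towards the origin. Since -n ≡ 1 modulo n + 1, the coordinates of w_R w_{n+1}⁻¹ · 0 are the places up to
-- a constant, and M + nA_i + i ≡ M + P_i. Hence Γ([w, J]) determines the sorted values P_i of the parking function, and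
-- the freedom left in w, reordering labels with equal P_i, is W_J: ind(J) consists of the pairs with p(b) = p(a) + n + 1.

module Submission where

open import Defs
open import Data.Nat as ℕ using (ℕ; zero; suc; z≤n; s≤s)
import Data.Nat.Properties as ℕₚ
open import Data.Integer as ℤ using (ℤ; +_; -[1+_])
import Data.Integer.Properties as ℤₚ
import Data.Integer.Divisibility as ℤD
import Data.Integer.Divisibility.Signed as Signed
open import Data.Integer.DivMod using (n%ℕd<d; a≡a%ℕn+[a/ℕn]*n)
open import Data.Integer.Tactic.RingSolver using (solve-∀)
open import Data.Rational as ℚ using (ℚ; 0ℚ; 1ℚ)
import Data.Rational.Properties as ℚₚ
import Data.Rational.Unnormalised as ℚᵘ
import Data.Rational.Unnormalised.Properties as ℚᵘₚ
import Tactic.RingSolver as RingSolver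
open import Tactic.RingSolver.Core.AlmostCommutativeRing using (AlmostCommutativeRing; fromCommutativeRing)
import Algebra.Properties.Group
import Algebra.Properties.CommutativeMonoid.Sum
import Algebra.Properties.Semiring.Sum
open import Data.Fin as Fin using (Fin; toℕ; fromℕ<; inject₁; punchOut)
import Data.Fin.Properties as Finₚ
import Data.Fin.Subset as Subset
import Data.Fin.Subset.Properties as Subsetₚ
open import Data.Fin.Permutation as Perm using (Permutation′; _⟨$⟩ʳ_; _⟨$⟩ˡ_; inverseˡ; inverseʳ)
import Data.Fin.Permutation.Components as PermC
open import Data.Vec as Vec using (Vec; lookup)
import Data.Vec.Properties as Vecₚ
open import Data.List as List using (List; []; _∷_; _++_; length; filter; tabulate; upTo; allFin; take; concatMap)
import Data.List.Properties as Listₚ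
open import Data.List.Relation.Unary.All as All using (All; []; _∷_)
import Data.List.Relation.Unary.All.Properties as Allₚ
open import Data.List.Relation.Unary.AllPairs using (AllPairs; []; _∷_)
import Data.List.Relation.Unary.AllPairs.Properties as AllPairsₚ
open import Data.List.Relation.Unary.Any using (here; there)
open import Data.List.Membership.Propositional using (_∈_; find; lose)
import Data.List.Membership.Propositional.Properties as ∈ₚ
open import Data.Bool using (Bool; true; false)
open import Data.Product using (Σ; ∃; Σ-syntax; _×_; _,_; proj₁; proj₂)
open import Data.Sum using (_⊎_; inj₁; inj₂)
open import Data.Empty using (⊥; ⊥-elim)
open import Function using (_∘_; Injective)
open import Level using (0ℓ)
open import Relation.Nullary using (¬_; Dec; yes; no; does; contradiction)
open import Relation.Nullary.Decidable using (dec-true; dec-false; dec⇒maybe; recompute)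
open import Relation.Unary using (Pred; Decidable)
open import Relation.Binary using (Tri; tri<; tri≈; tri>)
open import Relation.Binary.PropositionalEquality hiding (J)

-- Inverse maps enter the theorem as relations, so each equality has two halves: some preimage
-- exists, and every preimage yields the same pair. The first half builds an element from the area
-- vector; the second recovers the area vector from an element of which only the defining properties
-- are known. This is why facts come in converse pairs, with different proofs. To show that given
-- places belong to a minimal alcove, all competitors have to be bounded: a gap of k n between keys
-- splits into k gaps that each force a Shi inequality, so no alcove of the region can have a
-- smaller k. To use minimality, an inequality of absolute values, a single well-chosen competitor
-- has to be constructed. Likewise w_{n+1} is known only through the image of an open simplex. Its
-- existence is checked wall by wall, but its translation part has to be extracted from points near
-- the walls, integrality closing the remaining gap.

module Preliminaries where
  open import Data.Nat using (_≤_; _<_)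

  -- Integers among the rationals; permutations of finite sets; sorted lists.

  ι : ℤ → ℚ
  ι z = z ℚ./ 1

  ι-toℚᵘ : ∀ z → ℚ.toℚᵘ (ι z) ℚᵘ.≃ ℚᵘ.mkℚᵘ z 0
  ι-toℚᵘ z = ℚₚ.toℚᵘ-fromℚᵘ (ℚᵘ.mkℚᵘ z 0)

  ι-+ : ∀ a b → ι (a ℤ.+ b) ≡ ι a ℚ.+ ι b
  ι-+ a b = ℚₚ.toℚᵘ-injective (begin
    ℚ.toℚᵘ (ι (a ℤ.+ b)) ≈⟨ ι-toℚᵘ (a ℤ.+ b) ⟩
    ℚᵘ.mkℚᵘ (a ℤ.+ b) 0 ≈⟨ ℚᵘ.*≡* (cong (ℤ._* + 1) (cong₂ ℤ._+_ (sym (ℤₚ.*-identityʳ a)) (sym (ℤₚ.*-identityʳ b)))) ⟩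
    ℚᵘ.mkℚᵘ a 0 ℚᵘ.+ ℚᵘ.mkℚᵘ b 0 ≈⟨ ℚᵘₚ.+-cong (ι-toℚᵘ a) (ι-toℚᵘ b) ⟨
    ℚ.toℚᵘ (ι a) ℚᵘ.+ ℚ.toℚᵘ (ι b) ≈⟨ ℚₚ.toℚᵘ-homo-+ (ι a) (ι b) ⟨
    ℚ.toℚᵘ (ι a ℚ.+ ι b)                      ∎)
    where open ℚᵘₚ.≃-Reasoning

  ι-neg : ∀ a → ι (ℤ.- a) ≡ ℚ.- ι a
  ι-neg a = ℚGroup.inverseˡ-unique (ι (ℤ.- a)) (ι a) (trans (sym (ι-+ (ℤ.- a) a)) (cong ι (ℤₚ.+-inverseˡ a)))
    where module ℚGroup = Algebra.Properties.Group ℚₚ.+-0-group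

  ι-<-mono : ∀ {a b} → a ℤ.< b → ι a ℚ.< ι b
  ι-<-mono {a} {b} a<b = ℚₚ.toℚᵘ-cancel-< (ℚᵘₚ.<-respˡ-≃ (ℚᵘₚ.≃-sym (ι-toℚᵘ a)) (ℚᵘₚ.<-respʳ-≃ (ℚᵘₚ.≃-sym (ι-toℚᵘ b))
    (ℚᵘ.*<* (subst₂ ℤ._<_ (sym (ℤₚ.*-identityʳ a)) (sym (ℤₚ.*-identityʳ b)) a<b))))

  ι-≤-mono : ∀ {a b} → a ℤ.≤ b → ι a ℚ.≤ ι b
  ι-≤-mono {a} {b} a≤b = ℚₚ.toℚᵘ-cancel-≤ (ℚᵘₚ.≤-respˡ-≃ (ℚᵘₚ.≃-sym (ι-toℚᵘ a)) (ℚᵘₚ.≤-respʳ-≃ (ℚᵘₚ.≃-sym (ι-toℚᵘ b))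
    (ℚᵘ.*≤* (subst₂ ℤ._≤_ (sym (ℤₚ.*-identityʳ a)) (sym (ℤₚ.*-identityʳ b)) a≤b))))

  ι-<-cancel : ∀ {a b} → ι a ℚ.< ι b → a ℤ.< b
  ι-<-cancel {a} {b} p = ℤₚ.≰⇒> λ b≤a → ℚₚ.<-irrefl refl (ℚₚ.<-≤-trans p (ι-≤-mono b≤a))

  does⁻ : ∀ {a} {A : Set a} (A? : Dec A) → does A? ≡ true → A
  does⁻ (yes a) _ = a

  -- A missed value could be punched out of the codomain, leaving an injection into a smaller set.
  injective⇒surjective : ∀ {n} (f : Fin n → Fin n) → Injective _≡_ _≡_ f → ∀ y → ∃ λ x → f x ≡ y
  injective⇒surjective {suc n} f inj y with Finₚ.any? (λ x → f x Finₚ.≟ y)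
  ... | yes hit = hit
  ... | no miss = contradiction (Finₚ.injective⇒≤ g-injective) ℕₚ.1+n≰n
    where
    avoids : ∀ x → y ≢ f x
    avoids x eq = miss (x , sym eq)
    g : Fin (suc n) → Fin n
    g x = punchOut (avoids x)
    g-injective : Injective _≡_ _≡_ g
    g-injective {a} {b} eq = inj (Finₚ.punchOut-injective (avoids a) (avoids b) eq)

  injective⇒permutation : ∀ {n} (f : Fin n → Fin n) → Injective _≡_ _≡_ f →
                          Σ[ π ∈ Permutation′ n ] ∀ x → π ⟨$⟩ʳ x ≡ f x
  injective⇒permutation f inj = Perm.permutation f g f-g (λ x → inj (f-g (f x))) , λ _ → refl
    where
    g = λ y → proj₁ (injective⇒surjective f inj y)
    f-g = λ y → proj₂ (injective⇒surjective f inj y)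

  ⟨$⟩ʳ-injective : ∀ {n} (π : Permutation′ n) {i j} → π ⟨$⟩ʳ i ≡ π ⟨$⟩ʳ j → i ≡ j
  ⟨$⟩ʳ-injective π eq = trans (sym (inverseˡ π)) (trans (cong (π ⟨$⟩ˡ_) eq) (inverseˡ π))

  ⟨$⟩ˡ-injective : ∀ {n} (π : Permutation′ n) {i j} → π ⟨$⟩ˡ i ≡ π ⟨$⟩ˡ j → i ≡ j
  ⟨$⟩ˡ-injective π eq = trans (sym (inverseʳ π)) (trans (cong (π ⟨$⟩ʳ_) eq) (inverseʳ π))

  module _ {n : ℕ} (key : Fin n → ℕ) (key-inj : ∀ {i j} → key i ≡ key j → i ≡ j) where
    private
      below : Fin n → Subset.Subset n
      below i = Vec.tabulate λ j → does (key j ℕ.<? key i)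

      ∈below : ∀ {i j} → key j < key i → j Subset.∈ below i
      ∈below {i} {j} lt = Vecₚ.lookup⇒[]= j (below i)
          (trans (Vecₚ.lookup∘tabulate _ j) (dec-true (key j ℕ.<? key i) lt))

      below⁻ : ∀ {i j} → j Subset.∈ below i → key j < key i
      below⁻ {i} {j} j∈ = does⁻ (key j ℕ.<? key i)
          (trans (sym (Vecₚ.lookup∘tabulate (λ j → does (key j ℕ.<? key i)) j)) (Vecₚ.[]=⇒lookup j∈))

      #below : Fin n → ℕ
      #below i = Subset.∣ below i ∣

      #below-mono : ∀ {i j} → key i < key j → #below i < #below j
      #below-mono {i} {j} lt = Subsetₚ.p⊂q⇒∣p∣<∣q∣ ((λ k∈ → ∈below (ℕₚ.<-trans (below⁻ k∈) lt)) , i , ∈below lt ,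
          λ i∈ → ℕₚ.<-irrefl refl (below⁻ i∈))

      #below<n : ∀ i → #below i < n
      #below<n i = subst (#below i <_) (Subsetₚ.∣⊤∣≡n n)
          (Subsetₚ.p⊂q⇒∣p∣<∣q∣ ((λ _ → Subsetₚ.∈⊤) , i , Subsetₚ.∈⊤ , λ i∈ → ℕₚ.<-irrefl refl (below⁻ i∈)))

      rank : Fin n → Fin n
      rank i = Fin.fromℕ< (#below<n i)

      toℕ-rank : ∀ i → toℕ (rank i) ≡ #below i
      toℕ-rank i = Finₚ.toℕ-fromℕ< (#below<n i)

      rank-injective : Injective _≡_ _≡_ rank
      rank-injective {i} {j} eq with ℕₚ.<-cmp (key i) (key j)
      ... | tri< lt _ _ = ⊥-elim (ℕₚ.<-irrefl (trans (sym (toℕ-rank i)) (trans (cong toℕ eq) (toℕ-rank j)))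
          (#below-mono lt))
      ... | tri≈ _ e _ = key-inj e
      ... | tri> _ _ gt = ⊥-elim (ℕₚ.<-irrefl (trans (sym (toℕ-rank j)) (trans (cong toℕ (sym eq)) (toℕ-rank i)))
          (#below-mono gt))

    -- The number of elements with a smaller key is an injective rank. It sends elements to
    -- positions, whereas the sorting permutation sends positions to elements; hence the `flip`.
    sortingPermutation : Σ[ ρ ∈ Permutation′ n ] ∀ a b → a Fin.< b → key (ρ ⟨$⟩ʳ a) < key (ρ ⟨$⟩ʳ b)
    sortingPermutation with injective⇒permutation rank rank-injective
    ... | π , π≡ = Perm.flip π , sorted
      where
      rank-ρ : ∀ a → toℕ a ≡ #below (π ⟨$⟩ˡ a)
      rank-ρ a = trans (cong toℕ (trans (sym (inverseʳ π)) (π≡ (π ⟨$⟩ˡ a)))) (toℕ-rank _)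
      sorted : ∀ a b → a Fin.< b → key (π ⟨$⟩ˡ a) < key (π ⟨$⟩ˡ b)
      sorted a b a<b with ℕₚ.<-cmp (key (π ⟨$⟩ˡ a)) (key (π ⟨$⟩ˡ b))
      ... | tri< lt _ _ = lt
      ... | tri≈ _ e _ = ⊥-elim (ℕₚ.<-irrefl (cong toℕ (⟨$⟩ˡ-injective π (key-inj e))) a<b)
      ... | tri> _ _ gt = ⊥-elim (ℕₚ.<-asym a<b (subst₂ _<_ (sym (rank-ρ b)) (sym (rank-ρ a)) (#below-mono gt)))

  StrictlyIncreasing : ∀ {n} → (Fin n → Fin n) → Set
  StrictlyIncreasing g = ∀ i j → i Fin.< j → g i Fin.< g j

  module _ {n : ℕ} (g : Fin n → Fin n) (mono : StrictlyIncreasing g) where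
    increasing⇒inflationary : ∀ k (i : Fin n) → toℕ i ≡ k → k ≤ toℕ (g i)
    increasing⇒inflationary zero i _ = z≤n
    increasing⇒inflationary (suc k) i eq = ℕₚ.≤-<-trans (increasing⇒inflationary k j (Finₚ.toℕ-fromℕ< k<n))
        (mono j i (subst₂ _<_ (sym (Finₚ.toℕ-fromℕ< k<n)) (sym eq) ℕₚ.≤-refl))
      where
      k<n : k < n
      k<n = ℕₚ.<-trans ℕₚ.≤-refl (subst (_< n) eq (Finₚ.toℕ<n i))
      j = Fin.fromℕ< k<n

  -- Such a map never lowers an index. If it raised one, iterating from there would climb at every
  -- step and leave `Fin n`.
  increasing⇒id : ∀ {n} (g : Fin n → Fin n) → StrictlyIncreasing g → ∀ i → g i ≡ i
  increasing⇒id {n} g mono i with ℕₚ.m≤n⇒m<n∨m≡n (increasing⇒inflationary g mono (toℕ i) i refl)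
  ... | inj₂ eq = Finₚ.toℕ-injective (sym eq)
  ... | inj₁ i<gi = ⊥-elim (ℕₚ.<-irrefl refl (ℕₚ.≤-<-trans (proj₁ (proj₂ (iterate-< n)))
      (Finₚ.toℕ<n (proj₁ (iterate-< n)))))
    where
    iterate-< : ∀ k → Σ[ j ∈ Fin n ] (k ≤ toℕ j × toℕ j < toℕ (g j))
    iterate-< zero = i , z≤n , i<gi
    iterate-< (suc k) with iterate-< k
    ... | j , k≤j , j<gj = g j , ℕₚ.≤-<-trans k≤j j<gj , mono j (g j) j<gj

  module _ {A : Set} {_≺_ : A → A → Set} (≺-asym : ∀ {x y} → x ≺ y → ¬ (y ≺ x)) where
    -- The tool for identifying reading words and step times: asymmetry rules out repetitions, so a
    -- sorted list is determined by its members.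
    sorted-unique : ∀ {xs ys} → AllPairs _≺_ xs → AllPairs _≺_ ys →
                    (∀ {z} → z ∈ xs → z ∈ ys) → (∀ {z} → z ∈ ys → z ∈ xs) → xs ≡ ys
    sorted-unique {[]} {[]} _ _ _ _ = refl
    sorted-unique {[]} {y ∷ ys} _ _ _ ⊇ with ⊇ (here refl)
    ... | ()
    sorted-unique {x ∷ xs} {[]} _ _ ⊆ _ with ⊆ (here refl)
    ... | ()
    sorted-unique {x ∷ xs} {y ∷ ys} (x≺ ∷ pxs) (y≺ ∷ pys) ⊆ ⊇ = cong₂ _∷_ x≡y (sorted-unique pxs pys ⊆′ ⊇′)
      where
      x≡y : x ≡ y
      x≡y with ⊆ (here refl) | ⊇ (here refl)
      ... | here eq | _ = eq
      ... | there _ | here eq = sym eq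
      ... | there x∈ys | there y∈xs = ⊥-elim (≺-asym (All.lookup x≺ y∈xs) (All.lookup y≺ x∈ys))
      ⊆′ : ∀ {z} → z ∈ xs → z ∈ ys
      ⊆′ z∈ with ⊆ (there z∈)
      ... | there z∈ys = z∈ys
      ... | here refl = ⊥-elim (≺-irrefl′ (All.lookup x≺ z∈))
        where ≺-irrefl′ = λ (p : x ≺ y) → ≺-asym (subst (_≺ y) x≡y p) (subst (_≺ y) x≡y p)
      ⊇′ : ∀ {z} → z ∈ ys → z ∈ xs
      ⊇′ z∈ with ⊇ (there z∈)
      ... | there z∈xs = z∈xs
      ... | here refl = ⊥-elim (≺-irrefl′ (All.lookup y≺ z∈))
        where ≺-irrefl′ = λ (p : y ≺ x) → ≺-asym (subst (y ≺_) x≡y p) (subst (y ≺_) x≡y p)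

  -- Evaluates the cell counts `Pg`, whose predicate holds exactly on an initial segment of each
  -- row.
  length-filter-upTo : ∀ {p} {P : Pred ℕ p} (P? : Decidable P) {k} b → k ≤ b →
                       (∀ x → x < b → P x → x < k) → (∀ x → x < k → P x) → length (filter P? (upTo b)) ≡ k
  length-filter-upTo P? zero z≤n _ _ = refl
  length-filter-upTo P? {zero} (suc b) _ below⇐ _ = cong length
      (Listₚ.filter-none P? (All.tabulate λ {x} x∈ px → contradiction (below⇐ x (∈ₚ.∈-upTo⁻ x∈) px) λ ()))
  length-filter-upTo {P = P} P? {suc k} (suc b) (s≤s k≤b) below⇐ below⇒ =
    trans (cong length (Listₚ.filter-accept P? {xs = List.applyUpTo suc b} (below⇒ 0 (s≤s z≤n))))
      (cong suc (trans (cong (length ∘ filter P?) (sym (Listₚ.map-applyUpTo (λ x → x) suc b)))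
        (trans (trans (cong length (filter-map′ (upTo b))) (Listₚ.length-map suc (filter (P? ∘ suc) (upTo b))))
          (length-filter-upTo (P? ∘ suc) b k≤b (λ x x<b px → ℕₚ.≤-pred (below⇐ (suc x) (s≤s x<b) px))
              (λ x x<k → below⇒ (suc x) (s≤s x<k))))))
    where
    filter-map′ : ∀ xs → filter P? (List.map suc xs) ≡ List.map suc (filter (P? ∘ suc) xs)
    filter-map′ [] = refl
    filter-map′ (x ∷ xs) with does (P? (suc x))
    ... | true = cong (suc x ∷_) (filter-map′ xs)
    ... | false = filter-map′ xs

open Preliminaries

-- Positions in lists.

module Lists where
  open import Data.Nat using (_+_; _*_; _≤_; _<_)

  -- Positions are plain natural numbers, so that they survive the replacement of a list by an equal
  -- one and can be shifted by an offset.
  data At {A : Set} : List A → ℕ → A → Set where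
    here  : ∀ {x xs} → At (x ∷ xs) 0 x
    there : ∀ {x xs i y} → At xs i y → At (x ∷ xs) (suc i) y

  At-tabulate : ∀ {A : Set} {n} (q : Fin n → A) i → At (tabulate q) (toℕ i) (q i)
  At-tabulate q Fin.zero = here
  At-tabulate q (Fin.suc i) = there (At-tabulate (q ∘ Fin.suc) i)

  At-tabulate⁻ : ∀ {A : Set} {n} (q : Fin n → A) {j x} → At (tabulate q) j x → ∃ λ i → toℕ i ≡ j × q i ≡ x
  At-tabulate⁻ {n = suc n} q here = Fin.zero , refl , refl
  At-tabulate⁻ {n = suc n} q (there at) with At-tabulate⁻ (q ∘ Fin.suc) at
  ... | i , eq , eq′ = Fin.suc i , cong suc eq , eq′

  At⇒∈ : ∀ {A : Set} {xs : List A} {i x} → At xs i x → x ∈ xs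
  At⇒∈ here = here refl
  At⇒∈ (there at) = there (At⇒∈ at)

  AllPairs-map∈ : ∀ {A : Set} {R S : A → A → Set} {xs} → (∀ {x y} → x ∈ xs → y ∈ xs → R x y → S x y) → AllPairs R xs →
      AllPairs S xs
  AllPairs-map∈ f [] = []
  AllPairs-map∈ f (px ∷ pxs) = All.tabulate (λ y∈ → f (here refl) (there y∈) (All.lookup px y∈)) ∷ AllPairs-map∈
      (λ x∈ y∈ → f (there x∈) (there y∈)) pxs

open Lists

-- Lattice paths as timed events; the paths and words of the zeta map.

module Paths (m : ℕ) where
  open import Data.Nat using (_+_; _*_; _≤_; _<_)

  private
    n = suc m
    -- With a time attached to every step, the shape of a path is decided by comparing the time of
    -- its East step number a with that of its North step number b.
    Timed = Step × ℕ

  timesN timesE : List Timed → List ℕ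
  timesN [] = []
  timesN ((N , t) ∷ es) = t ∷ timesN es
  timesN ((E , t) ∷ es) = timesN es
  timesE [] = []
  timesE ((N , t) ∷ es) = timesE es
  timesE ((E , t) ∷ es) = t ∷ timesE es

  steps : List Timed → List Step
  steps = List.map proj₁

  Chronological : List Timed → Set
  Chronological = AllPairs (λ e e′ → proj₂ e < proj₂ e′)

  ∈timesN : ∀ {es t} → (N , t) ∈ es → t ∈ timesN es
  ∈timesN (here refl) = here refl
  ∈timesN {(N , _) ∷ es} (there e∈) = there (∈timesN e∈)
  ∈timesN {(E , _) ∷ es} (there e∈) = ∈timesN e∈

  ∈timesE : ∀ {es t} → (E , t) ∈ es → t ∈ timesE es
  ∈timesE (here refl) = here refl
  ∈timesE {(N , _) ∷ es} (there e∈) = ∈timesE e∈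
  ∈timesE {(E , _) ∷ es} (there e∈) = there (∈timesE e∈)

  timesN⁻ : ∀ {es t} → t ∈ timesN es → (N , t) ∈ es
  timesN⁻ {(N , _) ∷ es} (here refl) = here refl
  timesN⁻ {(N , _) ∷ es} (there t∈) = there (timesN⁻ t∈)
  timesN⁻ {(E , _) ∷ es} t∈ = there (timesN⁻ t∈)

  timesE⁻ : ∀ {es t} → t ∈ timesE es → (E , t) ∈ es
  timesE⁻ {(E , _) ∷ es} (here refl) = here refl
  timesE⁻ {(E , _) ∷ es} (there t∈) = there (timesE⁻ t∈)
  timesE⁻ {(N , _) ∷ es} t∈ = there (timesE⁻ t∈)

  timesN-sorted : ∀ {es} → Chronological es → AllPairs _<_ (timesN es)
  timesN-sorted [] = []
  timesN-sorted {(N , _) ∷ es} (t< ∷ ch) = All.tabulate (λ x∈ → All.lookup t< (timesN⁻ x∈)) ∷ timesN-sorted ch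
  timesN-sorted {(E , _) ∷ es} (t< ∷ ch) = timesN-sorted ch

  timesE-sorted : ∀ {es} → Chronological es → AllPairs _<_ (timesE es)
  timesE-sorted [] = []
  timesE-sorted {(E , _) ∷ es} (t< ∷ ch) = All.tabulate (λ x∈ → All.lookup t< (timesE⁻ x∈)) ∷ timesE-sorted ch
  timesE-sorted {(N , _) ∷ es} (t< ∷ ch) = timesE-sorted ch

  countN-steps : ∀ es → countN m (steps es) ≡ length (timesN es)
  countN-steps [] = refl
  countN-steps ((N , _) ∷ es) = cong suc (countN-steps es)
  countN-steps ((E , _) ∷ es) = countN-steps es

  countE-steps : ∀ es → countE m (steps es) ≡ length (timesE es)
  countE-steps [] = refl
  countE-steps ((E , _) ∷ es) = cong suc (countE-steps es)
  countE-steps ((N , _) ∷ es) = countE-steps es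

  -- `hbe` counts the North steps before East step number a, so it is at most b exactly if North
  -- step number b comes later.
  hbe-steps⇒ : ∀ {es a b x y} → Chronological es → At (timesE es) a x → At (timesN es) b y → hbe m (steps es) a ≤ b →
      x < y
  hbe-steps⇒ {(N , t) ∷ es} {b = suc b} (t< ∷ ch) atE (there atN) (s≤s le) = hbe-steps⇒ ch atE atN le
  hbe-steps⇒ {(E , t) ∷ es} {a = zero} (t< ∷ ch) here atN le = All.lookup t< (timesN⁻ (At⇒∈ atN))
  hbe-steps⇒ {(E , t) ∷ es} {a = suc a} (t< ∷ ch) (there atE) atN le = hbe-steps⇒ ch atE atN le

  hbe-steps⇐ : ∀ {es a b x y} → Chronological es → At (timesE es) a x → At (timesN es) b y → x < y →
      hbe m (steps es) a ≤ b
  hbe-steps⇐ {(N , t) ∷ es} (t< ∷ ch) atE here x<y = ⊥-elim (ℕₚ.<-asym x<y (All.lookup t< (timesE⁻ (At⇒∈ atE))))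
  hbe-steps⇐ {(N , t) ∷ es} (t< ∷ ch) atE (there atN) x<y = s≤s (hbe-steps⇐ ch atE atN x<y)
  hbe-steps⇐ {(E , t) ∷ es} {a = zero} (t< ∷ ch) here atN x<y = z≤n
  hbe-steps⇐ {(E , t) ∷ es} {a = suc a} (t< ∷ ch) (there atE) atN x<y = hbe-steps⇐ ch atE atN x<y

  -- The offset d is the excess of North over East steps before the list begins.
  ballot : ∀ d {es} → Chronological es → length (timesE es) ≤ length (timesN es) + d →
           (∀ {j x y} → At (timesN es) j x → At (timesE es) (j + d) y → x < y) →
           ∀ k → countE m (take k (steps es)) ≤ countN m (take k (steps es)) + d
  ballot d ch len before zero = z≤n
  ballot d {[]} ch len before (suc k) = z≤n
  ballot d {(N , t) ∷ es} (t< ∷ ch) len before (suc k) =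
    ℕₚ.≤-trans (ballot (suc d) ch (ℕₚ.≤-trans len (ℕₚ.≤-reflexive (sym (ℕₚ.+-suc _ d))))
        (λ {j} {x} {y} atN atE → before (there atN) (subst (λ i → At (timesE es) i y) (ℕₚ.+-suc j d) atE)) k)
      (ℕₚ.≤-reflexive (ℕₚ.+-suc _ d))
  ballot zero {(E , t) ∷ es} (t< ∷ ch) len before (suc k) with timesN es | before | (λ {x} → timesN⁻ {es} {x})
  ballot zero {(E , t) ∷ es} (t< ∷ ch) () before (suc k) | [] | _ | _
  ... | x ∷ xs | before′ | ∈⁻ = ⊥-elim (ℕₚ.<-asym (before′ here here) (All.lookup t< (∈⁻ (here refl))))
  ballot (suc d) {(E , t) ∷ es} (t< ∷ ch) len before (suc k) =
    ℕₚ.≤-trans (s≤s (ballot d ch (ℕₚ.≤-pred (ℕₚ.≤-trans len (ℕₚ.≤-reflexive (ℕₚ.+-suc _ d))))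
        (λ {j} {x} {y} atN atE → before atN (subst (λ i → At (t ∷ timesE es) i y) (sym (ℕₚ.+-suc j d)) (there atE)))
            k))
      (ℕₚ.≤-reflexive (sym (ℕₚ.+-suc _ d)))

  -- The diagonal reading word with positions instead of labels; like the path `dyck`, it depends on
  -- the area vector alone.
  word : (Fin n → ℕ) → List (Fin n)
  word A = concatMap (λ t → filter (λ k → A k ℕ.≟ t) (allFin n)) (upTo n)

  dyck : (Fin n → ℕ) → List Step
  dyck A = concatMap (λ t → concatMap (λ k → stepAt m (A k) t) (allFin n)) (upTo (suc n))

  -- Encodes the lexicographic order on (A i, i) in one number. Adding n raises the level by 1, and
  -- up to a constant the keys will be places.
  key : (Fin n → ℕ) → Fin n → ℕ
  key A i = A i * n + toℕ i

  key-< : ∀ {t t′} (i j : Fin n) → t < t′ → t * n + toℕ i < t′ * n + toℕ j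
  key-< {t} {t′} i j t<t′ = begin-strict
    t * n + toℕ i <⟨ ℕₚ.+-monoʳ-< (t * n) (Finₚ.toℕ<n i) ⟩
    t * n + n ≡⟨ ℕₚ.+-comm (t * n) n ⟩
    suc t * n ≤⟨ ℕₚ.*-monoˡ-≤ n t<t′ ⟩
    t′ * n ≤⟨ ℕₚ.m≤m+n (t′ * n) (toℕ j) ⟩
    t′ * n + toℕ j  ∎
    where open ℕₚ.≤-Reasoning

  module _ (A : Fin n → ℕ) where

    word-sorted : AllPairs (λ i j → key A i < key A j) (word A)
    word-sorted = AllPairsₚ.concat⁺
      (Allₚ.map⁺ (All.tabulate λ {t} _ → within t))
      (AllPairsₚ.map⁺ (AllPairsₚ.applyUpTo⁺₁ (λ t → t) n λ {t} {t′} t<t′ _ → All.tabulate λ i∈ → All.tabulate λ j∈ →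
        subst₂ _<_ (block t i∈) (block t′ j∈) (key-< _ _ t<t′)))
      where
      block : ∀ t {i} → i ∈ filter (λ k → A k ℕ.≟ t) (allFin n) → t * n + toℕ i ≡ key A i
      block t {i} i∈ = cong (λ a → a * n + toℕ i) (sym (proj₂ (∈ₚ.∈-filter⁻ (λ k → A k ℕ.≟ t) {xs = allFin n} i∈)))
      within : ∀ t → AllPairs (λ i j → key A i < key A j) (filter (λ k → A k ℕ.≟ t) (allFin n))
      within t = AllPairs-map∈ (λ {i} {j} i∈ j∈ i<j → subst₂ _<_ (block t i∈) (block t j∈) (ℕₚ.+-monoʳ-< (t * n) i<j))
        (AllPairsₚ.filter⁺ (λ k → A k ℕ.≟ t) (AllPairsₚ.tabulate⁺-< (λ i<j → i<j)))

    ∈-word : (∀ i → A i < n) → ∀ i → i ∈ word A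
    ∈-word A<n i = ∈ₚ.∈-concatMap⁺ (λ t → filter (λ k → A k ℕ.≟ t) (allFin n))
        (lose (∈ₚ.∈-upTo⁺ (A<n i)) (∈ₚ.∈-filter⁺ (λ k → A k ℕ.≟ A i) (∈ₚ.∈-allFin i) refl))

    private
      -- The scan for level t meets position k at time t n + k. Thus the North step of k happens at
      -- time `key A k`, and its East step, one level later, exactly n units after it.
      eventAt : ℕ → Fin n → List Timed
      eventAt t k = List.map (_, t * n + toℕ k) (stepAt m (A k) t)

      events : List Timed
      events = concatMap (λ t → concatMap (eventAt t) (allFin n)) (upTo (suc n))

      steps-events : steps events ≡ dyck A
      steps-events = trans (Listₚ.map-concatMap proj₁ (λ t → concatMap (eventAt t) (allFin n)) (upTo (suc n)))
          (Listₚ.concatMap-cong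
        (λ t → trans (Listₚ.map-concatMap proj₁ (eventAt t) (allFin n)) (Listₚ.concatMap-cong (λ k →
          trans (sym (Listₚ.map-∘ (stepAt m (A k) t))) (Listₚ.map-id _)) (allFin n))) (upTo (suc n)))

      eventAt-time : ∀ {t k e} → e ∈ eventAt t k → proj₂ e ≡ t * n + toℕ k
      eventAt-time e∈ with ∈ₚ.∈-map⁻ _ e∈
      ... | _ , _ , refl = refl

      block-time : ∀ {t e} → e ∈ concatMap (eventAt t) (allFin n) → Σ[ k ∈ Fin n ] proj₂ e ≡ t * n + toℕ k
      block-time {t} e∈ with find (∈ₚ.∈-concatMap⁻ (eventAt t) {xs = allFin n} e∈)
      ... | k , _ , e∈′ = k , eventAt-time {t} {k} e∈′

      events-chronological : Chronological events
      events-chronological = AllPairsₚ.concat⁺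
        (Allₚ.map⁺ (All.tabulate λ {t} _ → AllPairsₚ.concat⁺
          (Allₚ.map⁺ (All.tabulate λ {k} _ → single t k))
          (AllPairsₚ.map⁺ (AllPairsₚ.tabulate⁺-< λ {i} {j} i<j → All.tabulate λ e∈ → All.tabulate λ e′∈ →
            subst₂ _<_ (sym (eventAt-time {t} {i} e∈)) (sym (eventAt-time {t} {j} e′∈)) (ℕₚ.+-monoʳ-< (t * n) i<j)))))
        (AllPairsₚ.map⁺ (AllPairsₚ.applyUpTo⁺₁ (λ t → t) (suc n) λ t<t′ _ → All.tabulate λ e∈ → All.tabulate λ e′∈ →
          subst₂ _<_ (sym (proj₂ (block-time e∈))) (sym (proj₂ (block-time e′∈))) (key-< _ _ t<t′)))
        where
        single : ∀ t k → Chronological (eventAt t k)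
        single t k with does (A k ℕ.≟ t) | does (suc (A k) ℕ.≟ t)
        ... | true | _ = [] ∷ []
        ... | false | true = [] ∷ []
        ... | false | false = []

      N∈eventAt : ∀ t k → A k ≡ t → (N , key A k) ∈ eventAt t k
      N∈eventAt t k refl rewrite dec-true (A k ℕ.≟ A k) refl = here refl

      E∈eventAt : ∀ t k → suc (A k) ≡ t → (E , suc (A k) * n + toℕ k) ∈ eventAt t k
      E∈eventAt t k refl rewrite dec-false (A k ℕ.≟ suc (A k)) (ℕₚ.<⇒≢ ℕₚ.≤-refl) | dec-true (suc (A k) ℕ.≟ suc (A k))
          refl = here refl

      eventAt⁻N : ∀ t k {s} → (N , s) ∈ eventAt t k → s ≡ key A k
      eventAt⁻N t k e∈ with A k ℕ.≡ᵇ t in eq | suc (A k) ℕ.≡ᵇ t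
      eventAt⁻N t k (here refl) | true | _ = cong (λ a → a * n + toℕ k) (sym (does⁻ (A k ℕ.≟ t) eq))
      eventAt⁻N t k (here ()) | false | true
      eventAt⁻N t k () | false | false

      eventAt⁻E : ∀ t k {s} → (E , s) ∈ eventAt t k → s ≡ suc (A k) * n + toℕ k
      eventAt⁻E t k e∈ with A k ℕ.≡ᵇ t | suc (A k) ℕ.≡ᵇ t in eq
      eventAt⁻E t k (here ()) | true | _
      eventAt⁻E t k (here refl) | false | true = cong (λ a → a * n + toℕ k) (sym (does⁻ (suc (A k) ℕ.≟ t) eq))
      eventAt⁻E t k () | false | false

    module _ (A<n : ∀ i → A i < n) (τ : Permutation′ n)
             (τ-sorts : ∀ a b → a Fin.< b → key A (τ ⟨$⟩ʳ a) < key A (τ ⟨$⟩ʳ b)) where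

      word≡tabulate : word A ≡ tabulate (τ ⟨$⟩ʳ_)
      word≡tabulate = sorted-unique (λ {x} {y} → ℕₚ.<-asym {key A x} {key A y}) word-sorted
          (AllPairsₚ.tabulate⁺-< (τ-sorts _ _))
        (λ {z} _ → subst (_∈ tabulate (τ ⟨$⟩ʳ_)) (inverseʳ τ) (∈ₚ.∈-tabulate⁺ {f = τ ⟨$⟩ʳ_} (τ ⟨$⟩ˡ z)))
            (λ {z} _ → ∈-word A<n z)

      private
        qN qE : Fin n → ℕ
        qN a = key A (τ ⟨$⟩ʳ a)
        qE a = suc (A (τ ⟨$⟩ʳ a)) * n + toℕ (τ ⟨$⟩ʳ a)

        qE≡ : ∀ a → qE a ≡ n + qN a
        qE≡ a = ℕₚ.+-assoc n (A (τ ⟨$⟩ʳ a) * n) (toℕ (τ ⟨$⟩ʳ a))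

        events⁺ : ∀ t k {e} → t < suc n → e ∈ eventAt t k → e ∈ events
        events⁺ t k t≤ e∈ = ∈ₚ.∈-concatMap⁺ (λ t → concatMap (eventAt t) (allFin n))
            (lose (∈ₚ.∈-upTo⁺ t≤) (∈ₚ.∈-concatMap⁺ (eventAt t) (lose (∈ₚ.∈-allFin k) e∈)))

        events⁻ : ∀ {e} → e ∈ events → Σ[ t ∈ ℕ ] Σ[ k ∈ Fin n ] e ∈ eventAt t k
        events⁻ e∈ with find (∈ₚ.∈-concatMap⁻ (λ t → concatMap (eventAt t) (allFin n)) {xs = upTo (suc n)} e∈)
        ... | t , _ , e∈′ with find (∈ₚ.∈-concatMap⁻ (eventAt t) {xs = allFin n} e∈′)
        ... | k , _ , e∈″ = t , k , e∈″

        timesN≡ : timesN events ≡ tabulate qN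
        timesN≡ = sorted-unique ℕₚ.<-asym (timesN-sorted events-chronological) (AllPairsₚ.tabulate⁺-< (τ-sorts _ _))
            to from
          where
          to : ∀ {z} → z ∈ timesN events → z ∈ tabulate qN
          to z∈ with events⁻ (timesN⁻ z∈)
          ... | t , k , e∈ = subst (_∈ tabulate qN) (trans (cong (key A) (inverseʳ τ)) (sym (eventAt⁻N t k e∈)))
              (∈ₚ.∈-tabulate⁺ {f = qN} (τ ⟨$⟩ˡ k))
          from : ∀ {z} → z ∈ tabulate qN → z ∈ timesN events
          from z∈ with ∈ₚ.∈-tabulate⁻ {f = qN} z∈
          ... | a , refl = ∈timesN (events⁺ _ _ (ℕₚ.m≤n⇒m≤1+n (A<n _)) (N∈eventAt _ _ refl))

        timesE≡ : timesE events ≡ tabulate qE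
        timesE≡ = sorted-unique ℕₚ.<-asym (timesE-sorted events-chronological)
            (AllPairsₚ.tabulate⁺-< λ {a} {b} a<b → subst₂ _<_ (sym (qE≡ a)) (sym (qE≡ b))
                (ℕₚ.+-monoʳ-< n (τ-sorts a b a<b))) to from
          where
          to : ∀ {z} → z ∈ timesE events → z ∈ tabulate qE
          to z∈ with events⁻ (timesE⁻ z∈)
          ... | t , k , e∈ = subst (_∈ tabulate qE) (trans (cong (λ k → suc (A k) * n + toℕ k) (inverseʳ τ))
              (sym (eventAt⁻E t k e∈))) (∈ₚ.∈-tabulate⁺ {f = qE} (τ ⟨$⟩ˡ k))
          from : ∀ {z} → z ∈ tabulate qE → z ∈ timesE events
          from z∈ with ∈ₚ.∈-tabulate⁻ {f = qE} z∈
          ... | a , refl = ∈timesE (events⁺ _ _ (s≤s (A<n _)) (E∈eventAt _ _ refl))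

      -- In order of time, East step number a comes n units after North step number a, which is the
      -- hypothesis of `ballot`.
      dyck-isDyck : IsDyck m (dyck A)
      dyck-isDyck =
          trans (cong (countN m) (sym steps-events))
              (trans (countN-steps events) (trans (cong length timesN≡) (Listₚ.length-tabulate qN)))
        , trans (cong (countE m) (sym steps-events))
            (trans (countE-steps events) (trans (cong length timesE≡) (Listₚ.length-tabulate qE)))
        , λ k → subst₂ _≤_ (cong (countE m ∘ take k) steps-events)
            (trans (ℕₚ.+-identityʳ _) (cong (countN m ∘ take k) steps-events))
            (ballot 0 events-chronological
                (ℕₚ.≤-reflexive (trans (trans (cong length timesE≡) (Listₚ.length-tabulate qE))
              (sym (trans (ℕₚ.+-identityʳ _) (trans (cong length timesN≡) (Listₚ.length-tabulate qN)))))) before k)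
        where
        before : ∀ {j x y} → At (timesN events) j x → At (timesE events) (j + 0) y → x < y
        before {j} {x} {y} atN atE with At-tabulate⁻ qN (subst (λ l → At l j x) timesN≡ atN)
                                      | At-tabulate⁻ qE (subst₂ (λ l i → At l i y) timesE≡ (ℕₚ.+-identityʳ j) atE)
        ... | a , refl , refl | b , eq , refl = subst (λ b → qN a < qE b) (Finₚ.toℕ-injective (sym eq))
            (subst (qN a <_) (sym (qE≡ a)) (ℕₚ.m<n+m (qN a) {n} (s≤s z≤n)))

      dyck-hbe : ∀ a b → (hbe m (dyck A) (toℕ a) ≤ toℕ b → n + qN a < qN b) ×
          (n + qN a < qN b → hbe m (dyck A) (toℕ a) ≤ toℕ b)
      dyck-hbe a b = (λ le → subst (_< qN b) (qE≡ a) (hbe-steps⇒ events-chronological atE atN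
          (subst (λ D → hbe m D (toℕ a) ≤ toℕ b) (sym steps-events) le)))
                   , λ lt → subst (λ D → hbe m D (toℕ a) ≤ toℕ b) steps-events
                       (hbe-steps⇐ events-chronological atE atN (subst (_< qN b) (sym (qE≡ a)) lt))
        where
        atE : At (timesE events) (toℕ a) (qE a)
        atE = subst (λ l → At l (toℕ a) (qE a)) (sym timesE≡) (At-tabulate qE a)
        atN : At (timesN events) (toℕ b) (qN b)
        atN = subst (λ l → At l (toℕ b) (qN b)) (sym timesN≡) (At-tabulate qN b)

-- Finite sums.

module Sums where
  open import Data.Integer using (_+_; _*_; -_; _-_; _<_; _≤_)

  module ℤΣ = Algebra.Properties.Semiring.Sum ℤₚ.+-*-semiring
  module ℚΣ = Algebra.Properties.CommutativeMonoid.Sum ℚₚ.+-0-commutativeMonoid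

  foldr-tabulateℤ : ∀ {n} (v : Fin n → ℤ) → List.foldr _+_ (+ 0) (tabulate v) ≡ ℤΣ.sum v
  foldr-tabulateℤ {zero} v = refl
  foldr-tabulateℤ {suc n} v = cong (λ ∙ → v Fin.zero + ∙) (foldr-tabulateℤ (v ∘ Fin.suc))

  foldr-tabulateℚ : ∀ {n} (v : Fin n → ℚ) → List.foldr ℚ._+_ 0ℚ (tabulate v) ≡ ℚΣ.sum v
  foldr-tabulateℚ {zero} v = refl
  foldr-tabulateℚ {suc n} v = cong (v Fin.zero ℚ.+_) (foldr-tabulateℚ (v ∘ Fin.suc))

  foldr-ι : ∀ {n} (v : Fin n → ℤ) → ℚΣ.sum (ι ∘ v) ≡ ι (ℤΣ.sum v)
  foldr-ι {zero} v = refl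
  foldr-ι {suc n} v = trans (cong (ι (v Fin.zero) ℚ.+_) (foldr-ι (v ∘ Fin.suc))) (sym (ι-+ (v Fin.zero) _))

  sum-const : ∀ n c → ℤΣ.sum {n} (λ _ → c) ≡ + n * c
  sum-const zero c = refl
  sum-const (suc n) c = trans (cong (λ ∙ → c + ∙) (sum-const n c)) (sym (ℤₚ.suc-* (+ n) c))

  sum-constℚ : ∀ n c → ℚΣ.sum {n} (λ _ → c) ≡ ι (+ n) ℚ.* c
  sum-constℚ zero c = sym (ℚₚ.*-zeroˡ c)
  sum-constℚ (suc n) c = trans (cong₂ ℚ._+_ (sym (ℚₚ.*-identityˡ c)) (sum-constℚ n c))
    (trans (sym (ℚₚ.*-distribʳ-+ c 1ℚ (ι (+ n)))) (cong (ℚ._* c) (sym (ι-+ (+ 1) (+ n)))))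

  sum-δ : ∀ {n} (a : Fin n) (v : Fin n → ℤ) → (∀ c → c ≢ a → v c ≡ + 0) → ℤΣ.sum v ≡ v a
  sum-δ {suc n} Fin.zero v v≡0 =
      trans (cong (λ ∙ → v Fin.zero + ∙) (trans (ℤΣ.sum-cong-≗ (λ c → v≡0 (Fin.suc c) λ ()))
      (ℤΣ.sum-replicate-zero n))) (ℤₚ.+-identityʳ _)
  sum-δ {suc n} (Fin.suc a) v v≡0 =
      trans (cong₂ _+_ (v≡0 Fin.zero λ ())
      (sum-δ a (v ∘ Fin.suc) (λ c c≢a → v≡0 (Fin.suc c) (c≢a ∘ Finₚ.suc-injective)))) (ℤₚ.+-identityˡ _)

open Sums

-- Affine permutations and their places.

module AffinePermutations (m : ℕ) where
  open import Data.Integer using (_+_; _*_; -_; _-_; _<_; _≤_)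

  private
    n = suc m

  sumℤ-cong : ∀ {v v′ : Fin n → ℤ} → (∀ i → v i ≡ v′ i) → sumℤ m v ≡ sumℤ m v′
  sumℤ-cong {v} {v′} eq = trans (foldr-tabulateℤ v) (trans (ℤΣ.sum-cong-≗ eq) (sym (foldr-tabulateℤ v′)))

  sumℤ-permute : ∀ (π : Permutation′ n) v → sumℤ m (λ i → v (π ⟨$⟩ʳ i)) ≡ sumℤ m v
  sumℤ-permute π v = trans (foldr-tabulateℤ (λ i → v (π ⟨$⟩ʳ i)))
      (trans (sym (ℤΣ.sum-permute v π)) (sym (foldr-tabulateℤ v)))

  sumℤ-+ : ∀ v v′ → sumℤ m (λ i → v i + v′ i) ≡ sumℤ m v + sumℤ m v′
  sumℤ-+ v v′ = trans (foldr-tabulateℤ (λ i → v i + v′ i))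
      (trans (ℤΣ.∑-distrib-+ v v′) (cong₂ _+_ (sym (foldr-tabulateℤ v)) (sym (foldr-tabulateℤ v′))))

  sumℤ-* : ∀ c v → sumℤ m (λ i → c * v i) ≡ c * sumℤ m v
  sumℤ-* c v = trans (foldr-tabulateℤ (λ i → c * v i)) (trans (sym (ℤΣ.*-distribˡ-sum c v))
      (cong (c *_) (sym (foldr-tabulateℤ v))))

  sumℤ-const : ∀ c → sumℤ m (λ _ → c) ≡ + n * c
  sumℤ-const c = trans (foldr-tabulateℤ {n} (λ _ → c)) (sum-const n c)

  sumℤ-neg : ∀ v → sumℤ m (λ i → - v i) ≡ - sumℤ m v
  sumℤ-neg v = trans (sumℤ-cong (λ i → sym (ℤₚ.-1*i≡-i (v i)))) (trans (sumℤ-* (- (+ 1)) v) (ℤₚ.-1*i≡-i (sumℤ m v)))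

  ind : Fin n → Fin n → ℤ
  ind a c = ind01 m (does (c Fin.≟ a))

  ind-≡ : ∀ a → ind a a ≡ + 1
  ind-≡ a = cong (ind01 m) (dec-true (a Fin.≟ a) refl)

  ind-≢ : ∀ {a c} → c ≢ a → ind a c ≡ + 0
  ind-≢ {a} {c} c≢a = cong (ind01 m) (dec-false (c Fin.≟ a) c≢a)

  sumℤ-ind : ∀ a (v : Fin n → ℤ) → sumℤ m (λ c → v c * ind a c) ≡ v a
  sumℤ-ind a v = trans (foldr-tabulateℤ (λ c → v c * ind a c))
    (trans (sum-δ a (λ c → v c * ind a c) λ c c≢a → trans (cong (λ ∙ → v c * ∙) (ind-≢ c≢a)) (ℤₚ.*-zeroʳ (v c)))
      (trans (cong (λ ∙ → v a * ∙) (ind-≡ a)) (ℤₚ.*-identityʳ (v a))))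

  sumℚ-permute : ∀ (π : Permutation′ n) x → sumℚ m (λ i → x (π ⟨$⟩ʳ i)) ≡ sumℚ m x
  sumℚ-permute π x = trans (foldr-tabulateℚ (λ i → x (π ⟨$⟩ʳ i)))
      (trans (sym (ℚΣ.sum-permute x π)) (sym (foldr-tabulateℚ x)))

  sumℚ-+ : ∀ x y → sumℚ m (λ i → x i ℚ.+ y i) ≡ sumℚ m x ℚ.+ sumℚ m y
  sumℚ-+ x y = trans (foldr-tabulateℚ (λ i → x i ℚ.+ y i))
      (trans (ℚΣ.∑-distrib-+ x y) (cong₂ ℚ._+_ (sym (foldr-tabulateℚ x)) (sym (foldr-tabulateℚ y))))

  InV-permute : ∀ (π : Permutation′ n) {x} → InV m x → InV m (λ i → x (π ⟨$⟩ʳ i))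
  InV-permute π {x} x∈V = trans (sumℚ-permute π x) x∈V

  InV-actQ : ∀ w {x} → InV m x → InV m (actQ m w x)
  InV-actQ w {x} x∈V = begin
    sumℚ m (actQ m w x) ≡⟨ sumℚ-+ (λ a → x (perm w ⟨$⟩ˡ a)) (λ a → ι (tr w a)) ⟩
    sumℚ m (λ a → x (perm w ⟨$⟩ˡ a)) ℚ.+ sumℚ m (λ a → ι (tr w a))
        ≡⟨ cong₂ ℚ._+_ (InV-permute (Perm.flip (perm w)) {x} x∈V)
                                                                             (trans (foldr-tabulateℚ (ι ∘ tr w))
                                                                                 (trans (foldr-ι (tr w)) (cong ι
                                                                                 (sym (foldr-tabulateℤ (tr w))))))
                                                                                 ⟩
    0ℚ ℚ.+ ι (sumℤ m (tr w)) ≡⟨ cong (λ s → 0ℚ ℚ.+ ι s) (trSum w) ⟩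
    0ℚ                                                                   ∎
    where open ≡-Reasoning

  -- All other conditions on test points concern differences of coordinates, so a point can be
  -- written down freely and then moved into V by subtracting its mean.
  centre : ∀ x → Σ[ c ∈ ℚ ] InV m (λ i → x i ℚ.+ c)
  centre x = c , (begin
    sumℚ m (λ i → x i ℚ.+ c) ≡⟨ sumℚ-+ x (λ _ → c) ⟩
    sumℚ m x ℚ.+ sumℚ m (λ _ → c) ≡⟨ cong (sumℚ m x ℚ.+_) (trans (foldr-tabulateℚ {n} (λ _ → c)) (sum-constℚ n c)) ⟩
    sumℚ m x ℚ.+ ν ℚ.* (ν⁻¹ ℚ.* ℚ.- sumℚ m x)
        ≡⟨ cong (sumℚ m x ℚ.+_) (trans (sym (ℚₚ.*-assoc ν ν⁻¹ _))
        (trans (cong (ℚ._* (ℚ.- sumℚ m x)) (ℚₚ.*-inverseʳ ν)) (ℚₚ.*-identityˡ _))) ⟩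
    sumℚ m x ℚ.+ ℚ.- sumℚ m x ≡⟨ ℚₚ.+-inverseʳ (sumℚ m x) ⟩
    0ℚ                                             ∎)
    where
    open ≡-Reasoning
    ν : ℚ
    ν = ι (+ n)
    instance
      ν-nonZero : ℚ.NonZero ν
      ν-nonZero = ℚₚ.pos⇒nonZero ν {{ℚ.positive (ι-<-mono {+ 0} {+ n} (ℤ.+<+ (s≤s z≤n)))}}
    ν⁻¹ : ℚ
    ν⁻¹ = ℚ.1/ ν
    c : ℚ
    c = ν⁻¹ ℚ.* ℚ.- sumℚ m x

  abstract
    -- Division with remainder read backwards: every integer has this form once, and the order is
    -- lexicographic in (T, i). It is abstract so that the products inside stay folded.
    pk : Fin n → ℤ → ℤ
    pk i T = + toℕ i + + n * T

    pk-def : ∀ i T → pk i T ≡ + toℕ i + + n * T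
    pk-def i T = refl

    pk-< : ∀ i j {T S} → T < S → pk i T < pk j S
    pk-< i j {T} {S} T<S = begin-strict
      + toℕ i + + n * T <⟨ ℤₚ.+-monoˡ-< (+ n * T) (ℤ.+<+ (Finₚ.toℕ<n i)) ⟩
      + n + + n * T ≡⟨ lemma (+ n) T ⟩
      + n * ℤ.suc T ≤⟨ ℤₚ.*-monoˡ-≤-nonNeg (+ n) (ℤₚ.i<j⇒suc[i]≤j T<S) ⟩
      + n * S ≤⟨ ℤₚ.i≤j+i (+ n * S) (+ toℕ j) ⟩
      + toℕ j + + n * S        ∎
      where
      open ℤₚ.≤-Reasoning
      lemma : ∀ n T → n + n * T ≡ n * (+ 1 + T)
      lemma = solve-∀

    pk-<ˡ : ∀ {i j} T → i Fin.< j → pk i T < pk j T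
    pk-<ˡ T i<j = ℤₚ.+-monoˡ-< (+ n * T) (ℤ.+<+ i<j)

    pk-<⁻ : ∀ {i j T S} → pk i T < pk j S → T < S ⊎ (T ≡ S × i Fin.< j)
    pk-<⁻ {i} {j} {T} {S} lt with ℤₚ.<-cmp T S
    ... | tri< T<S _ _ = inj₁ T<S
    ... | tri> _ _ S<T = ⊥-elim (ℤₚ.<-asym lt (pk-< j i S<T))
    ... | tri≈ _ refl _ = inj₂ (refl , ℤₚ.drop‿+<+ (ℤₚ.≰⇒> λ le → ℤₚ.<⇒≱ lt (ℤₚ.+-monoˡ-≤ (+ n * T) le)))

    pk-inj : ∀ {i j T S} → pk i T ≡ pk j S → i ≡ j × T ≡ S
    pk-inj {i} {j} {T} {S} eq with ℤₚ.<-cmp T S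
    ... | tri< T<S _ _ = ⊥-elim (ℤₚ.<⇒≢ (pk-< i j T<S) eq)
    ... | tri> _ _ S<T = ⊥-elim (ℤₚ.<⇒≢ (pk-< j i S<T) (sym eq))
    ... | tri≈ _ refl _ = Finₚ.toℕ-injective (ℤₚ.+-injective (+-cancelʳ (+ n * T) eq)) , refl
      where
      +-cancelʳ : ∀ c {a b} → a + c ≡ b + c → a ≡ b
      +-cancelʳ c {a} {b} eq = trans (lemma a c) (trans (cong (_- c) eq) (sym (lemma b c)))
        where
        lemma : ∀ a c → a ≡ a + c - c
        lemma = solve-∀

    pk-≤⁻ : ∀ {i j T S} → pk i T ≤ pk j S → T ≤ S
    pk-≤⁻ {i} {j} le = ℤₚ.≮⇒≥ λ S<T → ℤₚ.<⇒≱ (pk-< j i S<T) le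

    pk-+ : ∀ i T k → pk i T + + n * k ≡ pk i (T + k)
    pk-+ i = lemma (+ toℕ i) (+ n)
      where
      lemma : ∀ i n T k → i + n * T + n * k ≡ i + n * (T + k)
      lemma = solve-∀

    divMod : ∀ z → z ≡ pk (fromℕ< (n%ℕd<d z n)) (z ℤ./ℕ n)
    divMod z = trans (a≡a%ℕn+[a/ℕn]*n z n) (cong₂ _+_ (cong +_ (sym (Finₚ.toℕ-fromℕ< (n%ℕd<d z n))))
        (ℤₚ.*-comm (z ℤ./ℕ n) (+ n)))

  aff-pk : ∀ w i T → aff m w (+ 1 + pk i T) ≡ + suc (toℕ (perm w ⟨$⟩ʳ i)) + + n * (tr w (perm w ⟨$⟩ʳ i) + T)
  aff-pk w i T with pk-inj {T = z′ ℤ./ℕ n} (trans (sym (divMod z′)) (lemma (pk i T)))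
    where
    z′ = (+ 1 + pk i T) - + 1
    lemma : ∀ a → + 1 + a - + 1 ≡ a
    lemma = solve-∀
  ... | r≡i , q≡T = cong₂ (λ r q → + suc (toℕ (perm w ⟨$⟩ʳ r)) + + n * (tr w (perm w ⟨$⟩ʳ r) + q)) r≡i q≡T

  -- The 0-based inverse of the affine permutation of w: it sends 1 + place w a to 1 + a. On the alcove of w, coordinate a is
  -- approximately - place w a / n, up to a common constant.
  place : Aff m → Fin n → ℤ
  place w a = pk (perm w ⟨$⟩ˡ a) (- tr w a)

  aff-place : ∀ w a k → aff m w (+ 1 + (place w a + + n * k)) ≡ + suc (toℕ a) + + n * k
  aff-place w a k = begin
    aff m w (+ 1 + (place w a + + n * k)) ≡⟨ cong (λ z → aff m w (+ 1 + z)) (pk-+ _ _ k) ⟩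
    aff m w (+ 1 + pk (perm w ⟨$⟩ˡ a) (- tr w a + k)) ≡⟨ aff-pk w _ _ ⟩
    _ ≡⟨ cong (λ b → + suc (toℕ b) + + n * (tr w b + (- tr w a + k))) (inverseʳ (perm w)) ⟩
    + suc (toℕ a) + + n * (tr w a + (- tr w a + k)) ≡⟨ cong (λ k → + suc (toℕ a) + + n * k) (lemma (tr w a) k) ⟩
    + suc (toℕ a) + + n * k                                 ∎
    where
    open ≡-Reasoning
    lemma : ∀ t k → t + (- t + k) ≡ k
    lemma = solve-∀

  place-surjective : ∀ w z → Σ[ a ∈ Fin n ] Σ[ k ∈ ℤ ] z ≡ place w a + + n * k
  place-surjective w z = a , (z ℤ./ℕ n) + tr w a , (begin
    z ≡⟨ divMod z ⟩
    pk r (z ℤ./ℕ n) ≡⟨ cong₂ pk (sym (inverseˡ (perm w))) (lemma (tr w a) (z ℤ./ℕ n)) ⟩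
    pk (perm w ⟨$⟩ˡ a) (- tr w a + (z ℤ./ℕ n + tr w a)) ≡⟨ pk-+ _ _ _ ⟨
    place w a + + n * (z ℤ./ℕ n + tr w a)                         ∎)
    where
    open ≡-Reasoning
    r = fromℕ< (n%ℕd<d z n)
    a = perm w ⟨$⟩ʳ r
    lemma : ∀ t q → q ≡ - t + (q + t)
    lemma = solve-∀

  place-injective : ∀ w {a b k l} → place w a + + n * k ≡ place w b + + n * l → a ≡ b × k ≡ l
  place-injective w {a} {b} {k} {l} eq with pk-inj {perm w ⟨$⟩ˡ a} {perm w ⟨$⟩ˡ b}
      (trans (sym (pk-+ _ _ k)) (trans eq (pk-+ _ _ l)))
  ... | a≡b′ , k≡l′ with ⟨$⟩ˡ-injective (perm w) a≡b′
  ... | refl = refl , trans (lemma (tr w a) k) (trans (cong (λ ∙ → tr w a + ∙) k≡l′) (sym (lemma (tr w a) l)))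
    where
    lemma : ∀ t k → k ≡ t + (- t + k)
    lemma = solve-∀

  -- The residues of the places run once through 0, ..., m, and the translation part has sum 0.
  sumℤ-place : ∀ w → sumℤ m (place w) ≡ sumℤ m (λ i → + toℕ i)
  sumℤ-place w = begin
    sumℤ m (place w) ≡⟨ sumℤ-cong (λ a → pk-def (perm w ⟨$⟩ˡ a) (- tr w a)) ⟩
    sumℤ m (λ a → + toℕ (perm w ⟨$⟩ˡ a) + + n * - tr w a)
        ≡⟨ sumℤ-+ (λ a → + toℕ (perm w ⟨$⟩ˡ a)) (λ a → + n * - tr w a) ⟩
    sumℤ m (λ a → + toℕ (perm w ⟨$⟩ˡ a)) + sumℤ m (λ a → + n * - tr w a)
        ≡⟨ cong₂ _+_ (sumℤ-permute (Perm.flip (perm w)) (λ i → + toℕ i))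
                                                                                            (trans (sumℤ-* (+ n) (λ a
                                                                                                → - tr w a))
                                                                                                (cong (+ n *_)
                                                                                                (trans (sumℤ-neg (tr w)) (cong -_ (trSum w))))) ⟩
    sumℤ m (λ i → + toℕ i) + + n * - + 0 ≡⟨ cong (λ ∙ → sumℤ m (λ i → + toℕ i) + ∙) (ℤₚ.*-zeroʳ (+ n)) ⟩
    sumℤ m (λ i → + toℕ i) + + 0 ≡⟨ ℤₚ.+-identityʳ _ ⟩
    sumℤ m (λ i → + toℕ i)                                                              ∎
    where open ≡-Reasoning

  -- The values are distinct modulo n, so their remainders form a permutation; the condition on the
  -- sum says that the quotients add up to 0, as a translation in the coroot lattice requires.
  -- `flip` and the sign occur because a place uses the inverse permutation and the negated
  -- translation.
  fromPlaces : (p : Fin n → ℤ) → (∀ {a b k} → p a ≡ p b + + n * k → a ≡ b) → sumℤ m p ≡ sumℤ m (λ i → + toℕ i) →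
            Σ[ w ∈ Aff m ] ∀ a → place w a ≡ p a
  fromPlaces p p-inj Σp = record { perm = Perm.flip π ; tr = λ a → - q a ; trSum = Σtr } , λ a → begin
      pk (π ⟨$⟩ʳ a) (- - q a) ≡⟨ cong₂ pk (π≡r a) (ℤₚ.neg-involutive (q a)) ⟩
      pk (r a) (q a) ≡⟨ divMod (p a) ⟨
      p a                         ∎
    where
    open ≡-Reasoning
    r : Fin n → Fin n
    r a = fromℕ< (n%ℕd<d (p a) n)
    q : Fin n → ℤ
    q a = p a ℤ./ℕ n
    r-inj : ∀ {a b} → r a ≡ r b → a ≡ b
    r-inj {a} {b} eq = p-inj {k = q a - q b} (begin
      p a ≡⟨ divMod (p a) ⟩
      pk (r a) (q a) ≡⟨ cong₂ pk eq (lemma (q a) (q b)) ⟩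
      pk (r b) (q b + (q a - q b)) ≡⟨ pk-+ _ _ _ ⟨
      pk (r b) (q b) + + n * (q a - q b) ≡⟨ cong (_+ + n * (q a - q b)) (divMod (p b)) ⟨
      p b + + n * (q a - q b)          ∎)
      where
      lemma : ∀ a b → a ≡ b + (a - b)
      lemma = solve-∀
    π = proj₁ (injective⇒permutation r r-inj)
    π≡r = proj₂ (injective⇒permutation r r-inj)
    Σq : + n * sumℤ m q ≡ + 0
    Σq = begin
      + n * sumℤ m q ≡⟨ lemma (sumℤ m (λ i → + toℕ i)) (+ n * sumℤ m q) ⟩
      (sumℤ m (λ i → + toℕ i) + + n * sumℤ m q) - sumℤ m (λ i → + toℕ i) ≡⟨ cong (_- sumℤ m (λ i → + toℕ i)) (begin
        sumℤ m (λ i → + toℕ i) + + n * sumℤ m q ≡⟨ cong₂ _+_ (sumℤ-permute π (λ i → + toℕ i)) (sumℤ-* (+ n) q) ⟨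
        sumℤ m (λ a → + toℕ (π ⟨$⟩ʳ a)) + sumℤ m (λ a → + n * q a)
            ≡⟨ sumℤ-+ (λ a → + toℕ (π ⟨$⟩ʳ a)) (λ a → + n * q a) ⟨
        sumℤ m (λ a → + toℕ (π ⟨$⟩ʳ a) + + n * q a) ≡⟨ sumℤ-cong (λ a → pk-def (π ⟨$⟩ʳ a) (q a)) ⟨
        sumℤ m (λ a → pk (π ⟨$⟩ʳ a) (q a))
            ≡⟨ sumℤ-cong (λ a → trans (cong (λ i → pk i (q a)) (π≡r a)) (sym (divMod (p a)))) ⟩
        sumℤ m p ≡⟨ Σp ⟩
        sumℤ m (λ i → + toℕ i) ∎) ⟩
      sumℤ m (λ i → + toℕ i) - sumℤ m (λ i → + toℕ i) ≡⟨ ℤₚ.+-inverseʳ (sumℤ m (λ i → + toℕ i)) ⟩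
      + 0                                                                     ∎
      where
      lemma : ∀ a b → b ≡ (a + b) - a
      lemma = solve-∀
    Σtr : InQ m (λ a → - q a)
    Σtr = trans (sumℤ-neg q) (cong -_ (ℤₚ.*-cancelˡ-≡ (+ n) _ _ (trans Σq (sym (ℤₚ.*-zeroʳ (+ n))))))

-- Inequalities reduced to ring identities.

module Inequalities where
  open import Data.Integer using (_+_; _*_; -_; _-_; _<_; _≤_)

  ℚ-ring : AlmostCommutativeRing 0ℓ 0ℓ
  ℚ-ring = fromCommutativeRing ℚₚ.+-*-commutativeRing λ p → dec⇒maybe (0ℚ ℚ.≟ p)

  -- Two inequalities with the same difference of sides are equivalent, and equality of differences
  -- is left to the ring solver.
  ℤ-<-via : ∀ {a b c d} → a < b → d ≡ c + (b - a) → c < d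
  ℤ-<-via {a} {b} {c} a<b refl = subst (_< c + (b - a)) (trans (cong (λ ∙ → c + ∙) (ℤₚ.+-inverseʳ a))
      (ℤₚ.+-identityʳ c)) (ℤₚ.+-monoʳ-< c (ℤₚ.+-monoˡ-< (- a) a<b))

  ℤ-≤-via : ∀ {a b c d} → a ≤ b → d ≡ c + (b - a) → c ≤ d
  ℤ-≤-via {a} {b} {c} a≤b refl = subst (_≤ c + (b - a)) (trans (cong (λ ∙ → c + ∙) (ℤₚ.+-inverseʳ a))
      (ℤₚ.+-identityʳ c)) (ℤₚ.+-monoʳ-≤ c (ℤₚ.+-monoˡ-≤ (- a) a≤b))

  ℤ-suc-≤-via : ∀ {a b c d} → a < b → d ≡ c + (b - (+ 1 + a)) → c ≤ d
  ℤ-suc-≤-via a<b = ℤ-≤-via (ℤₚ.i<j⇒suc[i]≤j a<b)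

  ℚ-<-via : ∀ {a b c d} → a ℚ.< b → d ≡ c ℚ.+ (b ℚ.- a) → c ℚ.< d
  ℚ-<-via {a} {b} {c} a<b refl = subst (ℚ._< c ℚ.+ (b ℚ.- a)) (trans (cong (c ℚ.+_) (ℚₚ.+-inverseʳ a))
      (ℚₚ.+-identityʳ c)) (ℚₚ.+-monoʳ-< c (ℚₚ.+-monoˡ-< (ℚ.- a) a<b))

  ℚ-≤-via : ∀ {a b c d} → a ℚ.≤ b → d ≡ c ℚ.+ (b ℚ.- a) → c ℚ.≤ d
  ℚ-≤-via {a} {b} {c} a≤b refl = subst (ℚ._≤ c ℚ.+ (b ℚ.- a)) (trans (cong (c ℚ.+_) (ℚₚ.+-inverseʳ a))
      (ℚₚ.+-identityʳ c)) (ℚₚ.+-monoʳ-≤ c (ℚₚ.+-monoˡ-≤ (ℚ.- a) a≤b))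

  -<⇒<+ : ∀ {a b c} → a ℚ.- b ℚ.< c → a ℚ.< b ℚ.+ c
  -<⇒<+ {a} {b} {c} lt = ℚ-<-via lt (lemma a b c)
    where
    lemma : ∀ a b c → b ℚ.+ c ≡ a ℚ.+ (c ℚ.- (a ℚ.- b))
    lemma = RingSolver.solve-∀ ℚ-ring

  <+⇒-< : ∀ {a b c} → a ℚ.< b ℚ.+ c → a ℚ.- b ℚ.< c
  <+⇒-< {a} {b} {c} lt = ℚ-<-via lt (lemma a b c)
    where
    lemma : ∀ a b c → c ≡ (a ℚ.- b) ℚ.+ (b ℚ.+ c ℚ.- a)
    lemma = RingSolver.solve-∀ ℚ-ring

  +<⇒<- : ∀ {a b c} → b ℚ.+ c ℚ.< a → c ℚ.< a ℚ.- b
  +<⇒<- {a} {b} {c} lt = ℚ-<-via lt (lemma a b c)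
    where
    lemma : ∀ a b c → a ℚ.- b ≡ c ℚ.+ (a ℚ.- (b ℚ.+ c))
    lemma = RingSolver.solve-∀ ℚ-ring

  <-⇒+< : ∀ {a b c} → c ℚ.< a ℚ.- b → b ℚ.+ c ℚ.< a
  <-⇒+< {a} {b} {c} lt = ℚ-<-via lt (lemma a b c)
    where
    lemma : ∀ a b c → a ≡ (b ℚ.+ c) ℚ.+ (a ℚ.- b ℚ.- c)
    lemma = RingSolver.solve-∀ ℚ-ring

  -- Two coordinates of an alcove point differ by less than 1, so comparing their integer shifts
  -- loses at most 1.
  ι-<-cancel-shift : ∀ {p q} a b → p ℚ.+ ι a ℚ.< q ℚ.+ ι b → q ℚ.< p ℚ.+ 1ℚ → a < + 1 + b
  ι-<-cancel-shift {p} {q} a b lt q<p+1 = ι-<-cancel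
      (ℚ-<-via (ℚₚ.+-mono-< lt q<p+1) (trans (ι-+ (+ 1) b) (lemma p q (ι a) (ι b) 1ℚ)))
    where
    lemma : ∀ p q a b u → u ℚ.+ b ≡ a ℚ.+ ((q ℚ.+ b ℚ.+ (p ℚ.+ u)) ℚ.- (p ℚ.+ a ℚ.+ q))
    lemma = RingSolver.solve-∀ ℚ-ring

  ι-<-cancel-drop : ∀ {p q} a b → p ℚ.+ ι a ℚ.< q ℚ.+ ι b → q ℚ.< p → a < b
  ι-<-cancel-drop {p} {q} a b lt q<p = ι-<-cancel (ℚ-<-via (ℚₚ.+-mono-< lt q<p) (lemma p q (ι a) (ι b)))
    where
    lemma : ∀ p q a b → b ≡ a ℚ.+ ((q ℚ.+ b ℚ.+ p) ℚ.- (p ℚ.+ a ℚ.+ q))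
    lemma = RingSolver.solve-∀ ℚ-ring

open Inequalities

-- Alcoves, and the simplex that is mapped to the dilated fundamental alcove.

module Alcoves (m : ℕ) where
  open import Data.Integer using (_+_; _*_; -_; _-_; _<_; _≤_)
  open AffinePermutations m

  private
    n = suc m

  module _ {x : Fin n → ℚ} where

    consecutive⇒decreasing : (∀ i j → toℕ j ≡ suc (toℕ i) → x j ℚ.< x i) → ∀ i j → i Fin.< j → x j ℚ.< x i
    consecutive⇒decreasing step i j i<j = go (toℕ j) i j refl i<j
      where
      go : ∀ k i j → toℕ j ≡ k → i Fin.< j → x j ℚ.< x i
      go (suc k) i j eq i<j with ℕₚ.m≤n⇒m<n∨m≡n i<j
      ... | inj₂ eq′ = step i j (sym eq′)
      ... | inj₁ lt = ℚₚ.<-trans (step j′ j (trans eq (cong suc (sym j′≡))))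
          (go k i j′ j′≡ (subst (toℕ i ℕ.<_) (sym j′≡) (ℕₚ.≤-pred (subst (suc (toℕ i) ℕ.<_) eq lt))))
        where
        k<n : k ℕ.< n
        k<n = ℕₚ.<-trans ℕₚ.≤-refl (subst (ℕ._< n) eq (Finₚ.toℕ<n j))
        j′ = fromℕ< k<n
        j′≡ = Finₚ.toℕ-fromℕ< k<n
      go zero i j eq i<j with subst (toℕ i ℕ.<_) eq i<j
      ... | ()

    C-first : InC m x → ∀ i → x i ℚ.≤ x Fin.zero
    C-first (_ , dec) Fin.zero = ℚₚ.≤-refl
    C-first (_ , dec) (Fin.suc i) = ℚₚ.<⇒≤ (dec Fin.zero (Fin.suc i) (s≤s z≤n))

    C-last : InC m x → ∀ i → x (last m) ℚ.≤ x i
    C-last (_ , dec) i with i Fin.≟ last m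
    ... | yes refl = ℚₚ.≤-refl
    ... | no i≢ = ℚₚ.<⇒≤ (dec i (last m) (Finₚ.≤∧≢⇒< (Finₚ.≤fromℕ i) i≢))

    C-spread : InC m x → ∀ {c} → x Fin.zero ℚ.- x (last m) ℚ.< c → ∀ i j → x i ℚ.< x j ℚ.+ c
    C-spread x∈C {c} lt i j = ℚₚ.≤-<-trans (C-first x∈C i) (ℚₚ.<-≤-trans (-<⇒<+ lt) (ℚₚ.+-monoˡ-≤ c (C-last x∈C j)))

    A-spread : InA m x → ∀ i j → x i ℚ.< x j ℚ.+ 1ℚ
    A-spread (x∈C , lt) = C-spread x∈C lt

  -- The places compare lexicographically. A strict inequality of quotients is worth a whole unit,
  -- more than the spread of a point of the fundamental alcove; for equal quotients the residues
  -- decide, because the coordinates of that point decrease.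
  alcove-gap : ∀ w {x} → InA m x → ∀ a b k → place w a + + n * k < place w b → actQ m w x b ℚ.+ ι k ℚ.< actQ m w x a
  alcove-gap w {x} x∈A a b k lt with pk-<⁻ (subst (_< place w b) (pk-+ _ _ k) lt)
  ... | inj₁ T<S = ℚₚ.<-≤-trans
      (ℚ-<-via (A-spread x∈A (perm w ⟨$⟩ˡ b) (perm w ⟨$⟩ˡ a))
          (trans (cong (x (perm w ⟨$⟩ˡ a) ℚ.+_) (trans (ι-+ (+ 1) (tr w b + k)) (cong (1ℚ ℚ.+_) (ι-+ (tr w b) k))))
        (lemma (x (perm w ⟨$⟩ˡ a)) (x (perm w ⟨$⟩ˡ b)) (ι (tr w b)) (ι k) 1ℚ)))
      (ℚₚ.+-monoʳ-≤ (x (perm w ⟨$⟩ˡ a))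
          (ι-≤-mono {+ 1 + (tr w b + k)} (ℤ-suc-≤-via T<S (lemmaℤ (tr w a) (tr w b) k))))
    where
    lemma : ∀ xa xb l k u → xa ℚ.+ (u ℚ.+ (l ℚ.+ k)) ≡ (xb ℚ.+ l ℚ.+ k) ℚ.+ (xa ℚ.+ u ℚ.- xb)
    lemma = RingSolver.solve-∀ ℚ-ring
    lemmaℤ : ∀ a b k → a ≡ + 1 + (b + k) + (- b - (+ 1 + (- a + k)))
    lemmaℤ = solve-∀
  ... | inj₂ (T≡S , va<vb) = ℚ-<-via (proj₂ (proj₁ x∈A) _ _ va<vb)
      (trans (cong (λ t → x (perm w ⟨$⟩ˡ a) ℚ.+ ι t) (trans (lemmaℤ (tr w a) (tr w b) k)
          (trans (cong (λ ∙ → tr w b + k - ∙ + - tr w b) T≡S) (lemmaℤ′ (tr w b) k))))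
      (trans (cong (x (perm w ⟨$⟩ˡ a) ℚ.+_) (ι-+ (tr w b) k)) (lemma (x (perm w ⟨$⟩ˡ a)) (x (perm w ⟨$⟩ˡ b))
          (ι (tr w b)) (ι k))))
    where
    lemma : ∀ xa xb l k → xa ℚ.+ (l ℚ.+ k) ≡ (xb ℚ.+ l ℚ.+ k) ℚ.+ (xa ℚ.- xb)
    lemma = RingSolver.solve-∀ ℚ-ring
    lemmaℤ : ∀ a b k → a ≡ b + k - (- a + k) + - b
    lemmaℤ = solve-∀
    lemmaℤ′ : ∀ b k → b + k - (- b) + - b ≡ b + k
    lemmaℤ′ = solve-∀

  private
    instance
      n-positive : ℚ.Positive (ι (+ n))
      n-positive = ℚ.positive (ι-<-mono {+ 0} {+ n} (ℤ.+<+ (s≤s z≤n)))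

      n-nonZero : ℚ.NonZero (ι (+ n))
      n-nonZero = ℚₚ.pos⇒nonZero (ι (+ n))

    ε : ℚ
    ε = ℚ.1/ ι (+ n)

    ε>0 : 0ℚ ℚ.< ε
    ε>0 = ℚₚ.positive⁻¹ ε {{ℚₚ.1/pos⇒pos (ι (+ n))}}

    nε≡1 : ι (+ n) ℚ.* ε ≡ 1ℚ
    nε≡1 = ℚₚ.*-inverseʳ (ι (+ n))

  abstract
    -- Before centring the coordinates are - i / n, with total spread m / n < 1.
    alcovePoint : Σ[ x ∈ (Fin n → ℚ) ] InA m x
    alcovePoint = x , (proj₂ c,V , consecutive⇒decreasing {x} step) , <+⇒-< spread
      where
      s : Fin n → ℚ
      s i = ℚ.- (ι (+ toℕ i) ℚ.* ε)
      c,V : Σ[ c ∈ ℚ ] InV m (λ i → s i ℚ.+ c)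
      c,V = centre s
      c : ℚ
      c = proj₁ c,V
      x : Fin n → ℚ
      x i = s i ℚ.+ c
      step : ∀ i j → toℕ j ≡ suc (toℕ i) → x j ℚ.< x i
      step i j eq = ℚ-<-via ε>0
          (sym (trans (cong (λ t → (ℚ.- (t ℚ.* ε) ℚ.+ c) ℚ.+ (ε ℚ.- 0ℚ))
          (trans (cong (ι ∘ +_) eq) (ι-+ (+ 1) (+ toℕ i)))) (lemma (ι (+ toℕ i)) ε c)))
        where
        lemma : ∀ t ε c → (ℚ.- ((1ℚ ℚ.+ t) ℚ.* ε) ℚ.+ c) ℚ.+ (ε ℚ.- 0ℚ) ≡ ℚ.- (t ℚ.* ε) ℚ.+ c
        lemma = RingSolver.solve-∀ ℚ-ring
      spread : x Fin.zero ℚ.< x (last m) ℚ.+ 1ℚ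
      spread = ℚ-<-via ε>0 (trans (cong₂ (λ t u → ℚ.- (t ℚ.* ε) ℚ.+ c ℚ.+ u) (cong (ι ∘ +_) (Finₚ.toℕ-fromℕ m))
          (trans (sym nε≡1) (cong (ℚ._* ε) (ι-+ (+ 1) (+ m))))) (lemma (ι (+ m)) ε c))
        where
        lemma : ∀ t ε c → ℚ.- (t ℚ.* ε) ℚ.+ c ℚ.+ (1ℚ ℚ.+ t) ℚ.* ε ≡ (ℚ.- (0ℚ ℚ.* ε) ℚ.+ c) ℚ.+ (ε ℚ.- 0ℚ)
        lemma = RingSolver.solve-∀ ℚ-ring

  successor? : (i : Fin n) → (Σ[ j ∈ Fin n ] toℕ j ≡ suc (toℕ i)) ⊎ i ≡ last m
  successor? i with suc (toℕ i) ℕ.<? n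
  ... | yes lt = inj₁ (fromℕ< lt , Finₚ.toℕ-fromℕ< lt)
  ... | no ≮ = inj₂ (Finₚ.toℕ-injective (trans (ℕₚ.≤-antisym (ℕₚ.≤-pred (Finₚ.toℕ<n i)) (ℕₚ.≤-pred (ℕₚ.≮⇒≥ ≮)))
      (sym (Finₚ.toℕ-fromℕ m))))

  -- Neighbouring coordinates of x decrease, so a rise of d by at most 1 keeps their difference
  -- above - 1; around the end, at most 1 is added to a spread below 1.
  B-point : ∀ {x} → InA m x → (d : Fin n → ℤ) → (∀ i j → toℕ j ≡ suc (toℕ i) → d j ≤ d i + + 1) → d Fin.zero ≤ d
      (last m) + + 1 →
            Σ[ c ∈ ℚ ] InB m (λ i → (x i ℚ.+ ι (d i)) ℚ.+ c)
  B-point {x} x∈A d dstep dwrap = c , proj₂ c,V ,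
      (λ i → +<⇒<- (step (inject₁ i) (Fin.suc i) (cong suc (sym (Finₚ.toℕ-inject₁ i))))) , <+⇒-< wrap
    where
    c,V = centre (λ i → x i ℚ.+ ι (d i))
    c = proj₁ c,V
    step : ∀ i j → toℕ j ≡ suc (toℕ i) → (x j ℚ.+ ι (d j)) ℚ.+ c ℚ.+ ℚ.- 1ℚ ℚ.< (x i ℚ.+ ι (d i)) ℚ.+ c
    step i j eq = ℚ-<-via (ℚₚ.+-mono-<-≤ (proj₂ (proj₁ x∈A) i j (ℕₚ.≤-reflexive (sym eq)))
        (ℚₚ.≤-trans (ι-≤-mono (dstep i j eq)) (ℚₚ.≤-reflexive (ι-+ (d i) (+ 1)))))
      (lemma (x i) (x j) (ι (d i)) (ι (d j)) c 1ℚ)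
      where
      lemma : ∀ xi xj di dj c u → (xi ℚ.+ di) ℚ.+ c ≡ (xj ℚ.+ dj) ℚ.+ c ℚ.+ ℚ.- u ℚ.+
          ((xi ℚ.+ (di ℚ.+ u)) ℚ.- (xj ℚ.+ dj))
      lemma = RingSolver.solve-∀ ℚ-ring
    wrap : (x Fin.zero ℚ.+ ι (d Fin.zero)) ℚ.+ c ℚ.< (x (last m) ℚ.+ ι (d (last m))) ℚ.+ c ℚ.+ ι (+ 2)
    wrap = ℚ-<-via (ℚₚ.+-mono-<-≤ (A-spread x∈A Fin.zero (last m))
        (ℚₚ.≤-trans (ι-≤-mono dwrap) (ℚₚ.≤-reflexive (ι-+ (d (last m)) (+ 1)))))
      (lemma (x Fin.zero) (x (last m)) (ι (d Fin.zero)) (ι (d (last m))) c)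
      where
      lemma : ∀ x0 xm d0 dm c → (xm ℚ.+ dm) ℚ.+ c ℚ.+ ι (+ 2) ≡ (x0 ℚ.+ d0) ℚ.+ c ℚ.+
          ((xm ℚ.+ 1ℚ ℚ.+ (dm ℚ.+ 1ℚ)) ℚ.- (x0 ℚ.+ d0))
      lemma = RingSolver.solve-∀ ℚ-ring

  -- For adjacent i, j the infimum and supremum of x_i - x_j on B are -1 and n. Two test points of B, within 1 of these bounds,
  -- determine the differences of the translation part of w.
  module _ (w : Aff m) (w∈ : IsWn1 m w) where

    private
      x = proj₁ alcovePoint
      x∈A = proj₂ alcovePoint

      y : Fin n → ℤ
      y = actInvZ m w (λ _ → + 0)

      t : Fin n → ℤ
      t i = tr w (perm w ⟨$⟩ʳ i)

      image : ∀ d → (∀ i j → toℕ j ≡ suc (toℕ i) → d j ≤ d i + + 1) → d Fin.zero ≤ d (last m) + + 1 →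
              ∀ i j → perm w ⟨$⟩ʳ i Fin.< perm w ⟨$⟩ʳ j →
              (x j ℚ.+ ι (d j + t j) ℚ.< x i ℚ.+ ι (d i + t i)) ×
                  (x i ℚ.+ ι (d i + t i) ℚ.< x j ℚ.+ ι (d j + t j + + suc n))
      image d dstep dwrap i j ui<uj =
          ℚ-<-via (proj₂ (proj₁ z∈) _ _ ui<uj) (trans (cong (x i ℚ.+_) (ι-+ (d i) (t i)))
              (trans (lemma₁ (x i) (ι (d i)) (ι (t i)) c (x j) (ι (d j)) (ι (t j)))
            (cong₂ (λ p q → x j ℚ.+ p ℚ.+ q) (sym (ι-+ (d j) (t j))) (cong₂ ℚ._-_ (sym (z≡ i)) (sym (z≡ j))))))
        , ℚ-<-via (C-spread (proj₁ z∈) (proj₂ z∈) (perm w ⟨$⟩ʳ i) (perm w ⟨$⟩ʳ j))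
            (trans (cong (x j ℚ.+_) (trans (ι-+ (d j + t j) (+ suc n)) (cong (ℚ._+ ι (+ suc n)) (ι-+ (d j) (t j)))))
            (trans (lemma₂ (x i) (ι (d i)) (ι (t i)) c (x j) (ι (d j)) (ι (t j)) (ι (+ suc n)))
            (cong₂ (λ p q → x i ℚ.+ p ℚ.+ q) (sym (ι-+ (d i) (t i))) (cong₂ (λ p q → p ℚ.+ ι (+ suc n) ℚ.- q)
                (sym (z≡ j)) (sym (z≡ i))))))
        where
        c,B = B-point x∈A d dstep dwrap
        c = proj₁ c,B
        p : Fin n → ℚ
        p i = (x i ℚ.+ ι (d i)) ℚ.+ c
        z∈ : InDilA m (actQ m w p)
        z∈ = proj₁ (w∈ p (proj₁ (proj₂ c,B))) (proj₂ c,B)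
        z≡ : ∀ i → actQ m w p (perm w ⟨$⟩ʳ i) ≡ p i ℚ.+ ι (t i)
        z≡ i = cong (λ k → p k ℚ.+ ι (t i)) (inverseˡ (perm w))
        lemma₁ : ∀ xi di ti c xj dj tj → xi ℚ.+ (di ℚ.+ ti) ≡ xj ℚ.+ (dj ℚ.+ tj) ℚ.+
            (((xi ℚ.+ di) ℚ.+ c ℚ.+ ti) ℚ.- ((xj ℚ.+ dj) ℚ.+ c ℚ.+ tj))
        lemma₁ = RingSolver.solve-∀ ℚ-ring
        lemma₂ : ∀ xi di ti c xj dj tj N → xj ℚ.+ ((dj ℚ.+ tj) ℚ.+ N) ≡ xi ℚ.+ (di ℚ.+ ti) ℚ.+
            (((xj ℚ.+ dj) ℚ.+ c ℚ.+ tj) ℚ.+ N ℚ.- ((xi ℚ.+ di) ℚ.+ c ℚ.+ ti))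
        lemma₂ = RingSolver.solve-∀ ℚ-ring

      d⁻ : Fin n → ℤ
      d⁻ i = + toℕ i

      d⁻-step : ∀ i j → toℕ j ≡ suc (toℕ i) → d⁻ j ≤ d⁻ i + + 1
      d⁻-step i j eq = ℤₚ.≤-reflexive (trans (cong +_ eq) (ℤₚ.+-comm (+ 1) (+ toℕ i)))

      jump : Fin n → Fin n → ℤ
      jump i k with k Fin.≤? i
      ... | yes _ = + n
      ... | no _ = + 0

      jump-≤ : ∀ i {k} → k Fin.≤ i → jump i k ≡ + n
      jump-≤ i {k} le with k Fin.≤? i
      ... | yes _ = refl
      ... | no ≰ = ⊥-elim (≰ le)

      jump-> : ∀ i {k} → i Fin.< k → jump i k ≡ + 0
      jump-> i {k} lt with k Fin.≤? i
      ... | yes le = ⊥-elim (ℕₚ.<⇒≱ lt le)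
      ... | no _ = refl

      -- Every condition of `B-point` holds with equality except the one between i and its
      -- successor. This pushes x_i - x_{i+1} to within 1 of n, while `d⁻` does the same for the
      -- lower bound - 1.
      d⁺ : Fin n → Fin n → ℤ
      d⁺ i k = + toℕ k + jump i k

      jump-mono : ∀ i {k k′} → k Fin.≤ k′ → jump i k′ ≤ jump i k
      jump-mono i {k} {k′} k≤k′ with k Fin.≤? i | k′ Fin.≤? i
      ... | yes _ | yes _ = ℤₚ.≤-refl
      ... | yes _ | no _ = ℤ.+≤+ z≤n
      ... | no k≰ | yes k′≤ = ⊥-elim (k≰ (ℕₚ.≤-trans k≤k′ k′≤))
      ... | no _ | no _ = ℤₚ.≤-refl

      d⁺-step : ∀ i k l → toℕ l ≡ suc (toℕ k) → d⁺ i l ≤ d⁺ i k + + 1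
      d⁺-step i k l eq = ℤ-≤-via (jump-mono i {k} {l} (subst (toℕ k ℕ.≤_) (sym eq) (ℕₚ.n≤1+n _)))
        (trans (lemma (+ toℕ k) (jump i k) (jump i l)) (cong (λ z → z + jump i l + (jump i k - jump i l))
            (cong +_ (sym eq))))
        where
        lemma : ∀ k a b → k + a + + 1 ≡ + 1 + k + b + (a - b)
        lemma = solve-∀

      d⁺-wrap : ∀ i → i Fin.< last m → d⁺ i Fin.zero ≤ d⁺ i (last m) + + 1
      d⁺-wrap i i<last = ℤₚ.≤-reflexive (trans (cong (λ z → + 0 + z) (jump-≤ i {Fin.zero} z≤n))
        (trans (lemma (+ m)) (sym (cong₂ (λ a b → a + b + + 1) (cong +_ (Finₚ.toℕ-fromℕ m)) (jump-> i i<last)))))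
        where
        lemma : ∀ m → + 0 + (+ 1 + m) ≡ m + + 0 + + 1
        lemma = solve-∀

      -- The interval (-1, n) of values of x_i - x_j is translated by t i - t j into (0, n + 1) if
      -- the order of the two coordinates is kept, and into (- n - 1, 0) if it is reversed. All
      -- these intervals have length n + 1, so the translation is determined.
      adjacent : ∀ i j → toℕ j ≡ suc (toℕ i) → (t i ≡ t j + + 1) ⊎ (t i ≡ t j - + n)
      adjacent i j eq = by-cases (Finₚ.<-cmp (perm w ⟨$⟩ʳ i) (perm w ⟨$⟩ʳ j))
        where
        i<j : i Fin.< j
        i<j = ℕₚ.≤-reflexive (sym eq)
        i<last : i Fin.< last m
        i<last = ℕₚ.<-≤-trans i<j (Finₚ.≤fromℕ j)
        xj<xi = proj₂ (proj₁ x∈A) i j i<j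
        d⁻-wrap : + 0 ≤ + toℕ (last m) + + 1
        d⁻-wrap = ℤ.+≤+ z≤n
        d⁺i≡ : d⁺ i i ≡ + toℕ i + + n
        d⁺i≡ = cong (λ z → + toℕ i + z) (jump-≤ i ℕₚ.≤-refl)
        d⁺j≡ : d⁺ i j ≡ + 1 + + toℕ i + + 0
        d⁺j≡ = cong₂ _+_ (cong +_ eq) (jump-> i i<j)
        lemma₁ : ∀ i m ti tj → tj + + 1 ≡ ti + ((+ 1 + i + + 0) + tj + (+ 1 + (+ 1 + m)) -
            (+ 1 + ((i + (+ 1 + m)) + ti)))
        lemma₁ = solve-∀
        lemma₂ : ∀ i ti tj → ti ≡ tj + + 1 + (+ 1 + (i + ti) - (+ 1 + ((+ 1 + i) + tj)))
        lemma₂ = solve-∀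
        lemma₃ : ∀ i m ti tj → tj - (+ 1 + m) ≡ ti + ((+ 1 + i + + 0) + tj - (+ 1 + ((i + (+ 1 + m)) + ti)))
        lemma₃ = solve-∀
        lemma₄ : ∀ i m ti tj → ti ≡ tj - (+ 1 + m) + (+ 1 + (i + ti + (+ 1 + (+ 1 + m))) - (+ 1 + ((+ 1 + i) + tj)))
        lemma₄ = solve-∀
        by-cases : Tri (perm w ⟨$⟩ʳ i Fin.< perm w ⟨$⟩ʳ j) (perm w ⟨$⟩ʳ i ≡ perm w ⟨$⟩ʳ j)
            (perm w ⟨$⟩ʳ j Fin.< perm w ⟨$⟩ʳ i) → (t i ≡ t j + + 1) ⊎ (t i ≡ t j - + n)
        by-cases (tri≈ _ ui≡uj _) = ⊥-elim (ℕₚ.<⇒≢ i<j (cong toℕ (⟨$⟩ʳ-injective (perm w) ui≡uj)))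
        by-cases (tri< ui<uj _ _) = inj₁ (ℤₚ.≤-antisym
          (ℤ-suc-≤-via (ι-<-cancel-drop (d⁺ i i + t i) (d⁺ i j + t j + + suc n)
              (proj₂ (image (d⁺ i) (d⁺-step i) (d⁺-wrap i i<last) i j ui<uj)) xj<xi)
            (trans (lemma₁ (+ toℕ i) (+ m) (t i) (t j))
                (sym (cong₂ (λ a b → t i + (a + t j + + suc n - (+ 1 + (b + t i)))) d⁺j≡ d⁺i≡))))
          (ℤ-suc-≤-via (ι-<-cancel-shift {x j} {x i} (d⁻ j + t j) (d⁻ i + t i)
              (proj₁ (image d⁻ d⁻-step d⁻-wrap i j ui<uj)) (A-spread x∈A i j))
            (trans (lemma₂ (+ toℕ i) (t i) (t j))
                (cong (λ a → t j + + 1 + (+ 1 + (+ toℕ i + t i) - (+ 1 + (a + t j)))) (cong +_ (sym eq))))))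
        by-cases (tri> _ _ uj<ui) = inj₂ (ℤₚ.≤-antisym
          (ℤ-suc-≤-via (ι-<-cancel-drop (d⁺ i i + t i) (d⁺ i j + t j)
              (proj₁ (image (d⁺ i) (d⁺-step i) (d⁺-wrap i i<last) j i uj<ui)) xj<xi)
            (trans (lemma₃ (+ toℕ i) (+ m) (t i) (t j))
                (sym (cong₂ (λ a b → t i + (a + t j - (+ 1 + (b + t i)))) d⁺j≡ d⁺i≡))))
          (ℤ-suc-≤-via (ι-<-cancel-shift {x j} {x i} (d⁻ j + t j) (d⁻ i + t i + + suc n)
              (proj₂ (image d⁻ d⁻-step d⁻-wrap j i uj<ui)) (A-spread x∈A i j))
            (trans (lemma₄ (+ toℕ i) (+ m) (t i) (t j))
                (cong (λ a → t j - + n + (+ 1 + (+ toℕ i + t i + + suc n) - (+ 1 + (a + t j)))) (cong +_ (sym eq))))))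

    -- In both cases of `adjacent` the coordinate of y grows by 1 modulo n + 1, as - n is congruent
    -- to 1.
    IsWn1⇒actInvZ : ∀ i → Σ[ k ∈ ℤ ] y i ≡ y Fin.zero + + toℕ i + + suc n * k
    IsWn1⇒actInvZ i = go (toℕ i) i refl
      where
      step : ∀ i j → toℕ j ≡ suc (toℕ i) → Σ[ k ∈ ℤ ] y i ≡ y Fin.zero + + toℕ i + + suc n * k →
          Σ[ k ∈ ℤ ] y j ≡ y Fin.zero + + toℕ j + + suc n * k
      step i j eq (l , yi≡) with adjacent i j eq
      ... | inj₁ ti≡ = l , trans (lemma₁ (t j)) (trans (cong (λ a → + 0 - a + + 1) (sym ti≡))
          (trans (cong (_+ + 1) yi≡)
            (trans (lemma₂ (y Fin.zero) (+ toℕ i) (+ suc n * l)) (cong (λ c → y Fin.zero + + c + + suc n * l)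
                (sym eq)))))
        where
        lemma₁ : ∀ t → + 0 - t ≡ + 0 - (t + + 1) + + 1
        lemma₁ = solve-∀
        lemma₂ : ∀ y k l → y + k + l + + 1 ≡ y + (+ 1 + k) + l
        lemma₂ = solve-∀
      ... | inj₂ ti≡ = l - + 1 , trans (lemma₁ (t j) (+ m)) (trans (cong (λ a → + 0 - a - + n) (sym ti≡))
          (trans (cong (_- + n) yi≡)
            (trans (lemma₂ (y Fin.zero) (+ toℕ i) (+ m) l) (cong (λ c → y Fin.zero + + c + + suc n * (l - + 1))
                (sym eq)))))
        where
        lemma₁ : ∀ t m → + 0 - t ≡ + 0 - (t - (+ 1 + m)) - (+ 1 + m)
        lemma₁ = solve-∀
        lemma₂ : ∀ y k m l → y + k + (+ 1 + (+ 1 + m)) * l - (+ 1 + m) ≡ y + (+ 1 + k) + (+ 1 + (+ 1 + m)) * (l - + 1)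
        lemma₂ = solve-∀
      go : ∀ k i → toℕ i ≡ k → Σ[ k ∈ ℤ ] y i ≡ y Fin.zero + + toℕ i + + suc n * k
      go zero Fin.zero refl = + 0 , lemma (y Fin.zero) (+ suc n)
        where
        lemma : ∀ y N → y ≡ y + + 0 + N * + 0
        lemma = solve-∀
      go (suc k) j eq = step (fromℕ< k<n) j (trans eq (cong suc (sym (Finₚ.toℕ-fromℕ< k<n))))
          (go k (fromℕ< k<n) (Finₚ.toℕ-fromℕ< k<n))
        where
        k<n : k ℕ.< n
        k<n = ℕₚ.<-trans ℕₚ.≤-refl (subst (ℕ._< n) eq (Finₚ.toℕ<n j))

  module _ (w : Aff m) (κ : ℤ) (place≡ : ∀ a → place w a ≡ κ + + suc n * + toℕ a) where

    private
      v : Fin n → Fin n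
      v a = perm w ⟨$⟩ˡ a

      -- Adding n + 1 to a place raises residue and quotient by 1 each, with one more carry after
      -- the last residue. The resulting constants 1 and 2 are the bounds that define `InB`.
      link : ∀ a b k → place w b + + n * k ≡ place w a + + suc n →
             (Σ[ j ∈ Fin n ] toℕ j ≡ suc (toℕ (v a)) × v b ≡ j × k + tr w a ≡ + 1 + tr w b) ⊎
                 (v a ≡ last m × v b ≡ Fin.zero × k + tr w a ≡ + 2 + tr w b)
      link a b k eq with successor? (v a)
      ... | inj₁ (j , j≡) with pk-inj {v b} {j} {k - tr w b} {+ 1 - tr w a}
              (trans (cong (pk (v b)) (ℤₚ.+-comm k (- tr w b))) (trans (sym (pk-+ (v b) (- tr w b) k)) (trans eq
                (trans (cong (_+ + suc n) (pk-def (v a) (- tr w a))) (trans (lemma (+ toℕ (v a)) (+ n) (tr w a))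
                    (trans (cong (λ c → + c + + n * (+ 1 - tr w a)) (sym j≡)) (sym (pk-def j _))))))))
              where
              lemma : ∀ v n t → v + n * - t + (+ 1 + n) ≡ (+ 1 + v) + n * (+ 1 - t)
              lemma = solve-∀
      ...   | vb≡j , eq′ = inj₁ (j , j≡ , vb≡j , trans (lemma (tr w a) (tr w b) k)
          (trans (cong (λ ∙ → ∙ + tr w a + tr w b) eq′) (lemma′ (tr w a) (tr w b))))
              where
              lemma : ∀ a b k → k + a ≡ k - b + a + b
              lemma = solve-∀
              lemma′ : ∀ a b → + 1 - a + a + b ≡ + 1 + b
              lemma′ = solve-∀
      link a b k eq | inj₂ va≡ with pk-inj {v b} {Fin.zero} {k - tr w b} {+ 2 - tr w a}
              (trans (cong (pk (v b)) (ℤₚ.+-comm k (- tr w b))) (trans (sym (pk-+ (v b) (- tr w b) k)) (trans eq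
                (trans (cong (_+ + suc n) (pk-def (v a) (- tr w a)))
                    (trans (cong (λ c → + c + + n * (- tr w a) + + suc n) (trans (cong toℕ va≡) (Finₚ.toℕ-fromℕ m)))
                  (trans (lemma (+ m) (tr w a)) (sym (pk-def Fin.zero _))))))))
              where
              lemma : ∀ m t → m + (+ 1 + m) * (- t) + (+ 1 + (+ 1 + m)) ≡ + 0 + (+ 1 + m) * (+ 2 - t)
              lemma = solve-∀
      ...   | vb≡0 , eq′ = inj₂ (va≡ , vb≡0 , trans (lemma (tr w a) (tr w b) k)
          (trans (cong (λ ∙ → ∙ + tr w a + tr w b) eq′) (lemma′ (tr w a) (tr w b))))
              where
              lemma : ∀ a b k → k + a ≡ k - b + a + b
              lemma = solve-∀
              lemma′ : ∀ a b → + 2 - a + a + b ≡ + 2 + b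
              lemma′ = solve-∀

      next : ∀ a b → toℕ b ≡ suc (toℕ a) → place w b + + n * + 0 ≡ place w a + + suc n
      next a b eq = trans (cong (_+ + n * + 0) (trans (place≡ b) (cong (λ c → κ + + suc n * + c) eq)))
          (trans (lemma κ (+ n) (+ toℕ a)) (cong (_+ + suc n) (sym (place≡ a))))
        where
        lemma : ∀ κ n a → κ + (+ 1 + n) * (+ 1 + a) + n * + 0 ≡ κ + (+ 1 + n) * a + (+ 1 + n)
        lemma = solve-∀

      wrap : place w Fin.zero + + n * + suc n ≡ place w (last m) + + suc n
      wrap = trans (cong (_+ + n * + suc n) (place≡ Fin.zero))
          (trans (lemma κ (+ m)) (cong (_+ + suc n)
          (sym (trans (place≡ (last m)) (cong (λ c → κ + + suc n * + c) (Finₚ.toℕ-fromℕ m))))))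
        where
        lemma : ∀ κ m → κ + (+ 1 + (+ 1 + m)) * + 0 + (+ 1 + m) * (+ 1 + (+ 1 + m)) ≡ κ + (+ 1 + (+ 1 + m)) * m +
            (+ 1 + (+ 1 + m))
        lemma = solve-∀

      transfer : ∀ {x} a b k c → k + tr w a ≡ c + tr w b → actQ m w x a ℚ.+ ι k ℚ.- actQ m w x b ≡ x (v a) ℚ.+ ι c ℚ.-
          x (v b)
      transfer {x} a b k c eq = trans (l₁ (x (v a)) (ι (tr w a)) (ι k) (x (v b)) (ι (tr w b)))
          (trans (cong (λ ∙ → x (v a) ℚ.+ ∙ ℚ.- (x (v b) ℚ.+ ι (tr w b)))
              (trans (sym (ι-+ k (tr w a))) (trans (cong ι eq) (ι-+ c (tr w b)))))
          (l₂ (x (v a)) (x (v b)) (ι c) (ι (tr w b))))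
        where
        l₁ : ∀ x t k y u → (x ℚ.+ t) ℚ.+ k ℚ.- (y ℚ.+ u) ≡ x ℚ.+ (k ℚ.+ t) ℚ.- (y ℚ.+ u)
        l₁ = RingSolver.solve-∀ ℚ-ring
        l₂ : ∀ xa xb c t → xa ℚ.+ (c ℚ.+ t) ℚ.- (xb ℚ.+ t) ≡ xa ℚ.+ c ℚ.- xb
        l₂ = RingSolver.solve-∀ ℚ-ring

      gap-transport : ∀ {a b c d} → b ℚ.- a ≡ d ℚ.- c → a ℚ.< b → c ℚ.< d
      gap-transport {a} {b} {c} {d} eq a<b = ℚ-<-via a<b (trans (lemma c d) (cong (c ℚ.+_) (sym eq)))
        where
        lemma : ∀ c d → d ≡ c ℚ.+ (d ℚ.- c)
        lemma = RingSolver.solve-∀ ℚ-ring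

      B⇒ : ∀ {x} → InB m x → ∀ a b k → place w b + + n * k ≡ place w a + + suc n → actQ m w x b ℚ.< actQ m w x a ℚ.+ ι
          k
      B⇒ {x} (x∈V , bstep , bwrap) a b k eq with link a b k eq
      ... | inj₂ (va≡ , vb≡ , k+≡) = gap-transport (sym (transfer {x} a b k (+ 2) k+≡))
          (subst₂ (λ p q → x p ℚ.< x q ℚ.+ ι (+ 2)) (sym vb≡) (sym va≡) (-<⇒<+ bwrap))
      ... | inj₁ (Fin.suc j , j≡ , vb≡ , k+≡) = gap-transport (sym (transfer {x} a b k (+ 1) k+≡))
              (subst₂ (λ p q → x p ℚ.< x q ℚ.+ 1ℚ) (sym vb≡)
                  (Finₚ.toℕ-injective (trans (Finₚ.toℕ-inject₁ j) (ℕₚ.suc-injective j≡)))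
                (ℚ-<-via (bstep j) (lemma (x (inject₁ j)) (x (Fin.suc j)) 1ℚ)))
        where
        lemma : ∀ a b u → a ℚ.+ u ≡ b ℚ.+ (a ℚ.- b ℚ.- (ℚ.- u))
        lemma = RingSolver.solve-∀ ℚ-ring

      -- The walls of the dilated alcove as steps of n + 1 between places: a simple wall joins
      -- neighbouring labels, and the affine wall closes the cycle after n steps, with k = n + 1.
      follow : ∀ a → Σ[ b ∈ Fin n ] Σ[ k ∈ ℤ ] (place w b + + n * k ≡ place w a + + suc n) ×
               (∀ {z} → InDilA m z → z b ℚ.< z a ℚ.+ ι k)
      follow a with successor? a
      ... | inj₁ (b , b≡) = b , + 0 , next a b b≡ , λ {z} z∈ → subst (z b ℚ.<_) (sym (ℚₚ.+-identityʳ (z a)))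
          (proj₂ (proj₁ z∈) a b (ℕₚ.≤-reflexive (sym b≡)))
      ... | inj₂ refl = Fin.zero , + suc n , wrap , λ z∈ → -<⇒<+ (proj₂ z∈)

      A⇒ : ∀ {x} → InDilA m (actQ m w x) → ∀ i → (∀ j → toℕ j ≡ suc (toℕ i) → x j ℚ.< x i ℚ.+ 1ℚ) ×
          (i ≡ last m → x Fin.zero ℚ.< x i ℚ.+ ι (+ 2))
      A⇒ {x} z∈ i with follow (perm w ⟨$⟩ʳ i)
      ... | b , k , eq , z< with link (perm w ⟨$⟩ʳ i) b k eq
      ... | inj₁ (j , j≡ , vb≡ , k+≡) =
              (λ j′ j′≡ → subst₂ (λ p q → x p ℚ.< x q ℚ.+ 1ℚ)
                  (trans vb≡ (Finₚ.toℕ-injective (trans j≡ (trans (cong (suc ∘ toℕ) (inverseˡ (perm w))) (sym j′≡)))))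
                  (inverseˡ (perm w))
                (gap-transport (transfer {x} (perm w ⟨$⟩ʳ i) b k (+ 1) k+≡) (z< z∈)))
            , λ i≡ → ⊥-elim (ℕₚ.<⇒≱ (Finₚ.toℕ<n j)
                (ℕₚ.≤-reflexive (sym (trans j≡
                (cong suc (trans (cong toℕ (trans (inverseˡ (perm w)) i≡)) (Finₚ.toℕ-fromℕ m)))))))
      ... | inj₂ (va≡ , vb≡ , k+≡) =
              (λ j j≡ → ⊥-elim (ℕₚ.<⇒≱ (Finₚ.toℕ<n j)
                  (ℕₚ.≤-reflexive (sym (trans j≡
                  (cong suc (trans (cong toℕ (trans (sym (inverseˡ (perm w))) va≡)) (Finₚ.toℕ-fromℕ m))))))))
            , λ _ → subst₂ (λ p q → x p ℚ.< x q ℚ.+ ι (+ 2)) vb≡ (inverseˡ (perm w))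
                (gap-transport (transfer {x} (perm w ⟨$⟩ʳ i) b k (+ 2) k+≡) (z< z∈))

    -- Steps of n + 1 between places enumerate the walls of both simplices, so w carries one system
    -- of inequalities into the other.
    place⇒IsWn1 : IsWn1 m w
    place⇒IsWn1 x x∈V = to , from
      where
      to : InB m x → InDilA m (actQ m w x)
      to x∈B = (InV-actQ w {x} x∈V , consecutive⇒decreasing {actQ m w x} λ i j j≡ → subst (actQ m w x j ℚ.<_)
          (ℚₚ.+-identityʳ _) (B⇒ {x} x∈B i j (+ 0) (next i j j≡)))
             , <+⇒-< (B⇒ {x} x∈B (last m) Fin.zero (+ suc n) wrap)
      from : InDilA m (actQ m w x) → InB m x
      from z∈ = x∈V , (λ i → +<⇒<-
          (ℚ-<-via (proj₁ (A⇒ {x} z∈ (inject₁ i)) (Fin.suc i) (cong suc (sym (Finₚ.toℕ-inject₁ i))))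
          (lemma (x (inject₁ i)) (x (Fin.suc i)) 1ℚ)))
              , <+⇒-< (proj₂ (A⇒ {x} z∈ (last m)) refl)
        where
        lemma : ∀ a b u → a ≡ b ℚ.+ (ℚ.- u) ℚ.+ (a ℚ.+ u ℚ.- b)
        lemma = RingSolver.solve-∀ ℚ-ring

-- Area vectors and gaps between their keys.

module Profiles (m : ℕ) where
  open import Data.Nat using (_+_; _*_; _≤_; _<_)
  open Paths m

  private
    n = suc m

  predecessor : ∀ (j : Fin n) {k} → toℕ j ≡ suc k → Σ[ i ∈ Fin n ] toℕ i ≡ k × toℕ j ≡ suc (toℕ i)
  predecessor j {k} eq = fromℕ< k<n , Finₚ.toℕ-fromℕ< k<n , trans eq (cong suc (sym (Finₚ.toℕ-fromℕ< k<n)))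
    where
    k<n : k < n
    k<n = ℕₚ.<-trans ℕₚ.≤-refl (subst (_< n) eq (Finₚ.toℕ<n j))

  key-<⁻ : ∀ (A : Fin n → ℕ) {i j} → key A i < key A j → A i < A j ⊎ (A i ≡ A j × toℕ i < toℕ j)
  key-<⁻ A {i} {j} lt with ℕₚ.<-cmp (A i) (A j)
  ... | tri< Ai<Aj _ _ = inj₁ Ai<Aj
  ... | tri> _ _ Aj<Ai = ⊥-elim (ℕₚ.<-asym lt (key-< j i Aj<Ai))
  ... | tri≈ _ eq _ = inj₂ (eq , ℕₚ.+-cancelˡ-< (A j * n) _ _ (subst (λ a → a * n + toℕ i < key A j) eq lt))

  lex-injective : ∀ {t t′} {i j : Fin n} → t * n + toℕ i ≡ t′ * n + toℕ j → i ≡ j × t ≡ t′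
  lex-injective {t} {t′} {i} {j} eq with ℕₚ.<-cmp t t′
  ... | tri< t<t′ _ _ = ⊥-elim (ℕₚ.<⇒≢ (key-< i j t<t′) eq)
  ... | tri> _ _ t′<t = ⊥-elim (ℕₚ.<⇒≢ (key-< j i t′<t) (sym eq))
  ... | tri≈ _ refl _ = Finₚ.toℕ-injective (ℕₚ.+-cancelˡ-≡ (t * n) _ _ eq) , refl

  record IsProfile (A : Fin n → ℕ) : Set where
    field
      zero≡ : A Fin.zero ≡ 0
      step≤ : ∀ i j → toℕ j ≡ suc (toℕ i) → A j ≤ suc (A i)

  module _ {A : Fin n → ℕ} (isProfile : IsProfile A) where
    open IsProfile isProfile

    profile-≤ : ∀ i → A i ≤ toℕ i
    profile-≤ i = go (toℕ i) i refl
      where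
      go : ∀ k i → toℕ i ≡ k → A i ≤ k
      go zero Fin.zero _ = ℕₚ.≤-reflexive zero≡
      go (suc k) j eq with predecessor j eq
      ... | i , i≡ , j≡ = ℕₚ.≤-trans (step≤ i j j≡) (s≤s (go k i i≡))

    profile-<n : ∀ i → A i < n
    profile-<n i = ℕₚ.≤-<-trans (profile-≤ i) (Finₚ.toℕ<n i)

    -- Going left from j, the first value below A j is A j - 1, because a profile rises by at most 1
    -- at each step.
    lastBelow : ∀ j → 1 ≤ A j → Σ[ i ∈ Fin n ] i Fin.< j × suc (A i) ≡ A j × (∀ l → l Fin.< j → A l < A j → l Fin.≤ i)
    lastBelow j 1≤ = go (toℕ j) j refl ℕₚ.≤-refl ℕₚ.≤-refl (λ l l<j _ j≤l → ⊥-elim (ℕₚ.<⇒≱ l<j j≤l))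
      where
      go : ∀ k (i : Fin n) → toℕ i ≡ k → i Fin.≤ j → A j ≤ A i → (∀ l → l Fin.< j → A l < A j → ¬ (i Fin.≤ l)) →
           Σ[ i ∈ Fin n ] i Fin.< j × suc (A i) ≡ A j × (∀ l → l Fin.< j → A l < A j → l Fin.≤ i)
      go zero Fin.zero eq _ Aj≤ _ = ⊥-elim (ℕₚ.<⇒≱ 1≤ (subst (A j ≤_) zero≡ Aj≤))
      go (suc k) i eq i≤j Aj≤ none with predecessor i eq
      ... | i′ , i′≡ , i≡ with A j ℕ.≤? A i′
      ...   | yes Aj≤′ = go k i′ i′≡ (ℕₚ.<⇒≤ i′<j) Aj≤′ none′
        where
        i′<j : i′ Fin.< j
        i′<j = ℕₚ.<-≤-trans (ℕₚ.≤-reflexive (sym i≡)) i≤j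
        none′ : ∀ l → l Fin.< j → A l < A j → ¬ (i′ Fin.≤ l)
        none′ l l<j Al< i′≤l with ℕₚ.m≤n⇒m<n∨m≡n i′≤l
        ... | inj₁ i′<l = none l l<j Al< (subst (_≤ toℕ l) (sym i≡) i′<l)
        ... | inj₂ i′≡l = ℕₚ.<⇒≱ Al< (subst (λ l → A j ≤ A l) (Finₚ.toℕ-injective i′≡l) Aj≤′)
      ...   | no Aj≰ = i′ , ℕₚ.<-≤-trans (ℕₚ.≤-reflexive (sym i≡)) i≤j
                     , ℕₚ.≤-antisym (ℕₚ.≰⇒> Aj≰) (ℕₚ.≤-trans Aj≤ (step≤ i′ i i≡))
                     , λ l l<j Al< → ℕₚ.≤-pred (subst (toℕ l <_) i≡ (ℕₚ.≰⇒> (none l l<j Al<)))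

    -- Splits off one step of more than n. The position found by `lastBelow` has the largest key
    -- that is more than n below that of j, hence one still at least k n above that of i.
    descend : ∀ {i j} k → suc k * n + key A i ≤ key A j →
              Σ[ j′ ∈ Fin n ] (k * n + key A i ≤ key A j′) × (n + key A j′ < key A j) × suc (A j′) ≡ A j × j′ Fin.< j
    descend {i} {j} k le with ℕₚ.≤-trans (ℕₚ.m≤m+n n (k * n + key A i))
        (subst (_≤ key A j) (ℕₚ.+-assoc n (k * n) (key A i)) le)
    ... | n≤key with lastBelow j (ℕₚ.≮⇒≥ λ Aj<1 → ℕₚ.<⇒≱ (Finₚ.toℕ<n j)
        (subst (n ≤_) (cong (λ a → a * n + toℕ j) (ℕₚ.n<1⇒n≡0 Aj<1)) n≤key))
    ...   | j′ , j′<j , Aj′≡ , lastest = j′ , le′ , far′ , Aj′≡ , j′<j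
      where
      far′ : n + key A j′ < key A j
      far′ = subst (n + key A j′ <_) (cong (λ a → a * n + toℕ j) Aj′≡)
             (subst (_< suc (A j′) * n + toℕ j) (ℕₚ.+-assoc n (A j′ * n) (toℕ j′))
                 (ℕₚ.+-monoʳ-< (suc (A j′) * n) j′<j))
      le″ : (suc k + A i) * n + toℕ i ≤ A j * n + toℕ j
      le″ = subst (_≤ key A j) (trans (sym (ℕₚ.+-assoc (suc k * n) (A i * n) (toℕ i)))
          (cong (_+ toℕ i) (sym (ℕₚ.*-distribʳ-+ n (suc k) (A i))))) le
      conclude : (k + A i) * n + toℕ i ≤ A j′ * n + toℕ j′ → k * n + key A i ≤ key A j′
      conclude = subst (_≤ key A j′) (trans (cong (_+ toℕ i) (ℕₚ.*-distribʳ-+ n k (A i)))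
          (ℕₚ.+-assoc (k * n) (A i * n) (toℕ i)))
      le′ : k * n + key A i ≤ key A j′
      le′ with ℕₚ.<-cmp (k + A i) (A j′)
      ... | tri< lt _ _ = conclude (ℕₚ.<⇒≤ (key-< i j′ lt))
      ... | tri> _ _ gt = ⊥-elim (ℕₚ.<⇒≱ (key-< j i (subst (_< suc k + A i) Aj′≡ (s≤s gt))) le″)
      -- On equal levels i is itself a position before j with a value below A j, so it does not come
      -- after the last such position.
      ... | tri≈ _ eq _ = conclude (ℕₚ.+-mono-≤ (ℕₚ.≤-reflexive (cong (_* n) eq)) (lastest i i<j Ai<Aj))
        where
        Ai<Aj : A i < A j
        Ai<Aj = subst (A i <_) (trans (cong suc eq) Aj′≡) (s≤s (ℕₚ.m≤n+m (A i) k))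
        i≤j : toℕ i ≤ toℕ j
        i≤j = ℕₚ.+-cancelˡ-≤ (A j * n) _ _ (subst (λ a → a * n + toℕ i ≤ A j * n + toℕ j) (trans (cong suc eq) Aj′≡)
            le″)
        i<j : i Fin.< j
        i<j = Finₚ.≤∧≢⇒< i≤j λ { refl → ℕₚ.<-irrefl refl Ai<Aj }

    -- Iterates `descend`: each of the k steps contributes more than 1, and what remains contributes
    -- at least 0.
    chain : ∀ {Z : Fin n → ℚ} → (∀ i j → n + key A i < key A j → Z j ℚ.+ 1ℚ ℚ.< Z i) →
        (∀ i j → key A i < key A j → Z j ℚ.< Z i) →
            ∀ k i j → k * n + key A i ≤ key A j → Z j ℚ.+ ι (+ k) ℚ.≤ Z i
    chain {Z} far near zero i j le with ℕₚ.m≤n⇒m<n∨m≡n le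
    ... | inj₁ lt = ℚₚ.<⇒≤ (subst (ℚ._< Z i) (sym (ℚₚ.+-identityʳ (Z j))) (near i j lt))
    ... | inj₂ eq = ℚₚ.≤-reflexive
        (trans (ℚₚ.+-identityʳ (Z j)) (cong Z (sym (proj₁ (lex-injective {A i} {A j} {i} {j} eq)))))
    chain {Z} far near (suc k) i j le with descend {i} {j} k le
    ... | j′ , le′ , lt , _ = ℚₚ.≤-trans (ℚ-≤-via (ℚₚ.<⇒≤ (far j′ j lt)) (trans (lemma (Z j) (Z j′) (ι (+ k)) 1ℚ)
        (cong (λ κ → Z j ℚ.+ κ ℚ.+ (Z j′ ℚ.- (Z j ℚ.+ 1ℚ))) (sym (ι-+ (+ 1) (+ k))))))
                                (chain {Z} far near k i j′ le′)
      where
      lemma : ∀ z z′ k u → z′ ℚ.+ k ≡ z ℚ.+ (u ℚ.+ k) ℚ.+ (z′ ℚ.- (z ℚ.+ u))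
      lemma = RingSolver.solve-∀ ℚ-ring

    -- By minimality i is the position that `descend` finds below j. If the profile reaches level A
    -- j right after i, the pair (i, i + 1) is already far and j is i + 1. Otherwise i + 1, unless
    -- it is j, is a later position below level A j, and the last one of these gives a competing far
    -- pair.
    minimal-adjacent : ∀ {i j} → n + key A i < key A j →
                       (∀ i′ j′ → key A i ≤ key A i′ → key A j′ ≤ key A j → n + key A i′ < key A j′ → i′ ≡ i × j′ ≡ j)
                           →
                       toℕ j ≡ suc (toℕ i) × A j ≡ suc (A i)
    minimal-adjacent {i} {j} lt minimal with descend {i} {j} 0
        (ℕₚ.<⇒≤ (subst (λ z → z + key A i < key A j) (sym (ℕₚ.+-identityʳ n)) lt))
    ... | j′ , le′ , lt′ , Aj′≡ , j′<j with minimal j′ j le′ ℕₚ.≤-refl lt′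
    ...   | refl , _ = j≡ , sym Aj′≡
      where
      si<n : suc (toℕ i) < n
      si<n = ℕₚ.≤-<-trans j′<j (Finₚ.toℕ<n j)
      s = fromℕ< si<n
      s≡ : toℕ s ≡ suc (toℕ i)
      s≡ = Finₚ.toℕ-fromℕ< si<n
      As≤Aj : A s ≤ A j
      As≤Aj = subst (A s ≤_) Aj′≡ (step≤ i s s≡)
      j≡ : toℕ j ≡ suc (toℕ i)
      j≡ with ℕₚ.<-cmp (A s) (A j)
      ... | tri> _ _ gt = ⊥-elim (ℕₚ.<⇒≱ gt As≤Aj)
      ... | tri≈ _ eq _ = trans (sym (cong toℕ (proj₂ (minimal i s ℕₚ.≤-refl
              (ℕₚ.+-mono-≤ (ℕₚ.≤-reflexive (cong (_* n) eq)) (subst (_≤ toℕ j) (sym s≡) j′<j))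
              (subst (n + key A i <_) (cong (λ a → a * n + toℕ s) (trans Aj′≡ (sym eq)))
                (subst (_< suc (A i) * n + toℕ s) (ℕₚ.+-assoc n (A i * n) (toℕ i))
                    (ℕₚ.+-monoʳ-< (suc (A i) * n) (ℕₚ.≤-reflexive (sym s≡)))))))) ) s≡
      ... | tri< lt″ _ _ with ℕₚ.m≤n⇒m<n∨m≡n j′<j
      ...   | inj₂ eq = sym eq
      ...   | inj₁ s<j with lastBelow j (ℕₚ.≤-trans (s≤s z≤n) (ℕₚ.≤-reflexive Aj′≡))
      ...     | l , l<j , Al≡ , lastest =
          ⊥-elim (ℕₚ.<⇒≱ (ℕₚ.≤-reflexive (sym s≡)) (ℕₚ.≤-trans (lastest s (subst (_< toℕ j) (sym s≡) s<j) lt″)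
          (ℕₚ.≤-reflexive (cong toℕ l≡i))))
        where
        far : n + key A l < key A j
        far = subst (n + key A l <_) (cong (λ a → a * n + toℕ j) Al≡)
             (subst (_< suc (A l) * n + toℕ j) (ℕₚ.+-assoc n (A l * n) (toℕ l)) (ℕₚ.+-monoʳ-< (suc (A l) * n) l<j))
        l≡i : l ≡ i
        l≡i = proj₁ (minimal l j (ℕₚ.+-mono-≤ (ℕₚ.≤-reflexive (cong (_* n) (ℕₚ.suc-injective (trans Aj′≡ (sym Al≡)))))
            (lastest i j′<j (ℕₚ.≤-reflexive Aj′≡))) ℕₚ.≤-refl far)

-- The dominant Shi region of an area vector and its minimal alcove.

module Regions (m : ℕ) where
  open import Data.Nat using (_+_; _*_; _≤_; _<_)
  open Paths m
  open AffinePermutations m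
  open Alcoves m
  open Profiles m

  private
    n = suc m

  root-< : (α : PosRoot m) → ri α Fin.< rj α
  root-< (root i j i<j) = recompute (i Finₚ.<? j) i<j

  module _ {A : Fin n → ℕ} (isProfile : IsProfile A) (τ : Permutation′ n)
           (τ-sorts : ∀ a b → a Fin.< b → key A (τ ⟨$⟩ʳ a) < key A (τ ⟨$⟩ʳ b)) where

    level : Fin n → ℕ
    level a = key A (τ ⟨$⟩ʳ a)

    Far : PosRoot m → Set
    Far α = n + level (ri α) < level (rj α)

    far? : ∀ α → Dec (Far α)
    far? α = n + level (ri α) ℕ.<? level (rj α)

    region : PosRoot m → Three
    region α with far? α
    ... | yes _ = pos
    ... | no _ = mid

    -- Equality is impossible: keys congruent modulo n belong to the same position, whose level
    -- cannot exceed itself by 1.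
    near : ∀ α → ¬ Far α → level (rj α) < n + level (ri α)
    near α ¬far = ℕₚ.≤∧≢⇒< (ℕₚ.≮⇒≥ ¬far) λ eq → contra (lex-injective (trans eq (sym (ℕₚ.+-assoc n (A _ * n) _))))
      where
      contra : ∀ {i j} → i ≡ j × A i ≡ suc (A j) → ⊥
      contra (refl , eq) = ℕₚ.<⇒≢ ℕₚ.≤-refl eq

    τ-reflects : ∀ {i j} → key A i < key A j → τ ⟨$⟩ˡ i Fin.< τ ⟨$⟩ˡ j
    τ-reflects {i} {j} lt with Finₚ.<-cmp (τ ⟨$⟩ˡ i) (τ ⟨$⟩ˡ j)
    ... | tri< i<j _ _ = i<j
    ... | tri≈ _ eq _ = ⊥-elim (ℕₚ.<-irrefl (cong (key A) (⟨$⟩ˡ-injective τ eq)) lt)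
    ... | tri> _ _ j<i = ⊥-elim (ℕₚ.<-asym lt (subst₂ (λ i j → key A i < key A j) (inverseʳ τ) (inverseʳ τ)
        (τ-sorts _ _ j<i)))

    -- The conclusion of `alcove-gap` for places ordered by τ. Negative k matter as well: they
    -- provide the upper bounds on z a - z b.
    Gaps : (Fin n → ℚ) → Set
    Gaps z = ∀ a b k → + level a ℤ.+ + n ℤ.* k ℤ.< + level b → z b ℚ.+ ι k ℚ.< z a

    module _ {z : Fin n → ℚ} (z∈V : InV m z) (gaps : Gaps z) where

      gaps⇒region : InRegion m region z
      gaps⇒region = z∈V , sat
        where
        sat : ∀ α → Sat m (region α) (pairQ m z α)
        sat α with far? α
        ... | yes far = +<⇒<- {z (ri α)} {z (rj α)}
            (gaps (ri α) (rj α) (+ 1)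
            (subst (ℤ._< + level (rj α)) (trans (ℤₚ.+-comm (+ n) (+ level (ri α)))
            (cong (λ c → + level (ri α) ℤ.+ c) (sym (ℤₚ.*-identityʳ (+ n))))) (ℤ.+<+ far)))
        ... | no ¬far = +<⇒<- {z (ri α)} {z (rj α)}
            (gaps (ri α) (rj α) (+ 0)
            (subst (ℤ._< + level (rj α))
            (sym (trans (cong (λ c → + level (ri α) ℤ.+ c) (ℤₚ.*-zeroʳ (+ n))) (ℤₚ.+-identityʳ _)))
            (ℤ.+<+ (τ-sorts _ _ (root-< α)))))
                      , <+⇒-< {z (ri α)} {z (rj α)}
                          (ℚ-<-via (gaps (rj α) (ri α) (ℤ.- + 1)
                          (ℤ-<-via (ℤ.+<+ (near α ¬far)) (lemmaℤ (+ level (ri α)) (+ level (rj α)) (+ n))))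
                          (lemma (z (ri α)) (z (rj α)) 1ℚ))
          where
          lemmaℤ : ∀ i j n → i ≡ j ℤ.+ n ℤ.* (ℤ.- + 1) ℤ.+ (n ℤ.+ i ℤ.- j)
          lemmaℤ = solve-∀
          lemma : ∀ zi zj u → zj ℚ.+ u ≡ zi ℚ.+ (zj ℚ.- (zi ℚ.+ ℚ.- u))
          lemma = RingSolver.solve-∀ ℚ-ring

      gaps⇒far : ∀ α → 1ℚ ℚ.< pairQ m z α → Far α
      gaps⇒far α 1< with far? α | proj₂ gaps⇒region α
      ... | yes far | _ = far
      ... | no _ | _ , <1 = ⊥-elim (ℚₚ.<-asym 1< <1)

    region-far : ∀ {z} → InRegion m region z → ∀ α → Far α → 1ℚ ℚ.< pairQ m z α
    region-far (_ , sat) α far with far? α | sat α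
    ... | yes _ | 1< = 1<
    ... | no ¬far | _ = ⊥-elim (¬far far)

    region⇒C : ∀ z → InRegion m region z → InC m z
    region⇒C z (z∈V , sat) = z∈V , decreasing
      where
      decreasing : ∀ i j → i Fin.< j → z j ℚ.< z i
      decreasing i j i<j with far? (root i j i<j) | sat (root i j i<j)
      ... | yes _ | 1< = subst (ℚ._< z i) (ℚₚ.+-identityʳ (z j))
          (<-⇒+< {z i} {z j} (ℚₚ.<-trans (ι-<-mono {+ 0} {+ 1} (ℤ.+<+ (s≤s z≤n))) 1<))
      ... | no _ | 0< , _ = subst (ℚ._< z i) (ℚₚ.+-identityʳ (z j)) (<-⇒+< {z i} {z j} 0<)

    module _ {z : Fin n → ℚ} (z∈V : InV m z) (gaps : Gaps z) where

      region-dominant : IsDomShi m region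
      region-dominant = (z , gaps⇒region {z} z∈V gaps) , region⇒C

      φ⇒far : ∀ α → φ m region α → Far α
      φ⇒far α φα = gaps⇒far {z} z∈V gaps α (φα z (gaps⇒region {z} z∈V gaps))

    far⇒φ : ∀ α → Far α → φ m region α
    far⇒φ α far z z∈ = region-far {z} z∈ α far

    dyck-IsDJ : (P : PosRoot m → Set) → (∀ α → P α → Far α) → (∀ α → Far α → P α) → IsDJ m P (dyck A)
    dyck-IsDJ P P⇒far far⇒P = dyck-isDyck A (profile-<n isProfile) τ τ-sorts , λ a b a<b →
        (λ le → far⇒P (root a b a<b) (proj₁ (hbe⇔ a b) le)) , λ p → proj₂ (hbe⇔ a b) (P⇒far (root a b a<b) p)
      where
      hbe⇔ = dyck-hbe A (profile-<n isProfile) τ τ-sorts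

    module _ (w : Aff m) (M : ℤ) (place≡ : ∀ a → place w a ≡ M ℤ.+ + level a) where

      alcove-gaps : ∀ x → InA m x → Gaps (actQ m w x)
      alcove-gaps x x∈A a b k gap = alcove-gap w x∈A a b k
          (ℤ-<-via gap (trans (place≡ b) (trans (lemma M (+ level a) (+ level b) (+ n ℤ.* k))
          (cong (λ p → p ℤ.+ + n ℤ.* k ℤ.+ (+ level b ℤ.- (+ level a ℤ.+ + n ℤ.* k))) (sym (place≡ a))))))
        where
        lemma : ∀ M a b k → M ℤ.+ b ≡ (M ℤ.+ a) ℤ.+ k ℤ.+ (b ℤ.- (a ℤ.+ k))
        lemma = solve-∀

      private
        x = proj₁ (alcovePoint)
        x∈A = proj₂ (alcovePoint)

        InV-image : ∀ {w x} → InA m x → InV m (actQ m w x)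
        InV-image {w} {x} x∈A = InV-actQ w {x} (proj₁ (proj₁ x∈A))

      -- If ⟨x, α⟩ > k on the alcove of w, the two levels are at least k n apart, and then `chain`
      -- gives ⟨x, α⟩ ≥ k on every alcove of the region.
      region-minimal : IsMinAlc m region w
      region-minimal = (λ x x∈A → gaps⇒region {actQ m w x} (InV-image {w} x∈A) (alcove-gaps x x∈A)) , minimal
        where
        minimal : ∀ w′ → AlcIn m w′ region → ∀ α k₁ k₂ → K m w α k₁ → K m w′ α k₂ → ℤ.∣ k₁ ∣ ≤ ℤ.∣ k₂ ∣
        minimal w′ w′∈ α k₁ k₂ K₁ K₂ = compare k₁ (proj₁ (K₁ x x∈A)) (proj₂ (K₁ x x∈A))
          where
          i = ri α
          j = rj α
          z z′ : Fin n → ℚ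
          z = actQ m w x
          z′ = actQ m w′ x
          z∈ : InRegion m region z
          z∈ = gaps⇒region {actQ m w x} (InV-image {w} x∈A) (alcove-gaps x x∈A)
          z′∈ : InRegion m region z′
          z′∈ = w′∈ x x∈A
          0<z : 0ℚ ℚ.< pairQ m z α
          0<z = +<⇒<- {z i} {z j} (subst (ℚ._< z i) (sym (ℚₚ.+-identityʳ (z j)))
              (proj₂ (region⇒C z z∈) i j (root-< α)))
          apart : ∀ k → ι (+ k) ℚ.< pairQ m z α → k * n + level i ≤ level j
          apart k k<z = ℕₚ.≮⇒≥ λ lt → ℚₚ.<-asym k<z
            (<+⇒-< {z i} {z j} (ℚ-<-via
                (alcove-gaps x x∈A j i (ℤ.- + k)
                (ℤ-<-via (ℤ.+<+ lt) (trans (lemmaℤ (+ level i) (+ level j) (+ k) (+ n))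
                (cong (λ c → + level j ℤ.+ + n ℤ.* ℤ.- + k ℤ.+ (c ℤ.+ + level i ℤ.- + level j))
                (sym (ℤₚ.pos-* k n))))))
              (trans (lemma (z i) (z j) (ι (+ k))) (cong (λ c → z i ℚ.+ (z j ℚ.- (z i ℚ.+ c))) (sym (ι-neg (+ k)))))))
            where
            lemmaℤ : ∀ i j k n → i ≡ j ℤ.+ n ℤ.* ℤ.- k ℤ.+ (k ℤ.* n ℤ.+ i ℤ.- j)
            lemmaℤ = solve-∀
            lemma : ∀ zi zj k → zj ℚ.+ k ≡ zi ℚ.+ (zj ℚ.- (zi ℚ.+ ℚ.- k))
            lemma = RingSolver.solve-∀ ℚ-ring
          Z : Fin n → ℚ
          Z t = z′ (τ ⟨$⟩ˡ t)
          Z-near : ∀ s t → key A s < key A t → Z t ℚ.< Z s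
          Z-near s t s<t = proj₂ (region⇒C z′ z′∈) _ _ (τ-reflects s<t)
          Z-far : ∀ s t → n + key A s < key A t → Z t ℚ.+ 1ℚ ℚ.< Z s
          Z-far s t gap = <-⇒+< {Z s} {Z t}
              (region-far {z′} z′∈ (root (τ ⟨$⟩ˡ s) (τ ⟨$⟩ˡ t) (τ-reflects (ℕₚ.≤-<-trans (ℕₚ.m≤n+m _ n) gap)))
                             (subst₂ (λ s t → n + key A s < key A t) (sym (inverseʳ τ)) (sym (inverseʳ τ)) gap))
          ≤∣∣ : ∀ {k l} → + k ℤ.≤ l → k ≤ ℤ.∣ l ∣
          ≤∣∣ (ℤ.+≤+ le) = le
          nonpos : ∀ k → -[1+ k ] ℤ.+ + 1 ℤ.≤ + 0
          nonpos zero = ℤ.+≤+ z≤n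
          nonpos (suc k) = ℤ.-≤+
          compare : ∀ k → ι k ℚ.< pairQ m z α → pairQ m z α ℚ.< ι (k ℤ.+ + 1) → ℤ.∣ k ∣ ≤ ℤ.∣ k₂ ∣
          compare -[1+ k ] _ z<k+1 = ⊥-elim (ℤₚ.<⇒≱ (ι-<-cancel {+ 0} { -[1+ k ] ℤ.+ + 1} (ℚₚ.<-trans 0<z z<k+1))
              (nonpos k))
          compare (+ k) k<z _ = ≤∣∣ (ℤ-suc-≤-via (ι-<-cancel {+ k} {k₂ ℤ.+ + 1} (ℚₚ.≤-<-trans
              (ℚ-≤-via (chain isProfile {Z} Z-far Z-near k (τ ⟨$⟩ʳ i) (τ ⟨$⟩ʳ j) (apart k k<z))
                  (trans (lemma (z′ i) (z′ j) (ι (+ k))) (cong₂ (λ p q → ι (+ k) ℚ.+ (z′ p ℚ.- (z′ q ℚ.+ ι (+ k))))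
                  (sym (inverseˡ τ)) (sym (inverseˡ τ)))))
              (proj₂ (K₂ x x∈A)))) (lemmaℤ (+ k) k₂))
            where
            lemma : ∀ zi zj k → zi ℚ.- zj ≡ k ℚ.+ (zi ℚ.- (zj ℚ.+ k))
            lemma = RingSolver.solve-∀ ℚ-ring
            lemmaℤ : ∀ k l → l ≡ k ℤ.+ (l ℤ.+ + 1 ℤ.- (+ 1 ℤ.+ k))
            lemmaℤ = solve-∀

-- Stable affine permutations as labelled area vectors.

module StableElements (m : ℕ) where
  open import Data.Integer using (_+_; _*_; -_; _-_; _<_; _≤_)
  open Paths m
  open AffinePermutations m
  open Alcoves m
  open Profiles m
  open Regions m

  private
    n = suc m

  key≡pk : ∀ A i → + key A i ≡ pk i (+ A i)
  key≡pk A i = trans (ℤₚ.pos-+ (A i ℕ.* n) (toℕ i)) (trans (cong (_+ + toℕ i) (ℤₚ.pos-* (A i) n))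
      (trans (lemma (+ A i) (+ n) (+ toℕ i)) (sym (pk-def i (+ A i)))))
    where
    lemma : ∀ a n i → a * n + i ≡ i + n * a
    lemma = solve-∀

  -- The additive constant is forced, because places and residues have equal sums.
  fromProfile : (A : Fin n → ℕ) (g : Permutation′ n) → Σ[ w ∈ Aff m ] ∀ a → place w a ≡ - sumℤ m (λ i → + A i) + + key
      A (g ⟨$⟩ʳ a)
  fromProfile A g = fromPlaces p p-inj Σp
    where
    open ≡-Reasoning
    M = - sumℤ m (λ i → + A i)
    p : Fin n → ℤ
    p a = M + + key A (g ⟨$⟩ʳ a)
    p-inj : ∀ {a b k} → p a ≡ p b + + n * k → a ≡ b
    p-inj {a} {b} {k} eq = ⟨$⟩ʳ-injective g (proj₁ (pk-inj (begin
      pk (g ⟨$⟩ʳ a) _ ≡⟨ key≡pk A _ ⟨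
      + key A (g ⟨$⟩ʳ a) ≡⟨ lemma M _ ⟩
      p a - M ≡⟨ cong (_- M) eq ⟩
      p b + + n * k - M ≡⟨ lemma′ M (+ key A (g ⟨$⟩ʳ b)) (+ n * k) ⟩
      + key A (g ⟨$⟩ʳ b) + + n * k ≡⟨ cong (_+ + n * k) (key≡pk A _) ⟩
      pk (g ⟨$⟩ʳ b) _ + + n * k ≡⟨ pk-+ _ _ k ⟩
      pk (g ⟨$⟩ʳ b) (+ A (g ⟨$⟩ʳ b) + k)          ∎)))
      where
      lemma : ∀ M a → a ≡ M + a - M
      lemma = solve-∀
      lemma′ : ∀ M b k → (M + b) + k - M ≡ b + k
      lemma′ = solve-∀
    Σp : sumℤ m p ≡ sumℤ m (λ i → + toℕ i)
    Σp = begin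
      sumℤ m p ≡⟨ sumℤ-+ (λ _ → M) (λ a → + key A (g ⟨$⟩ʳ a)) ⟩
      sumℤ m (λ _ → M) + sumℤ m (λ a → + key A (g ⟨$⟩ʳ a))
          ≡⟨ cong₂ _+_ (sumℤ-const M) (sumℤ-permute g (λ i → + key A i)) ⟩
      + n * M + sumℤ m (λ i → + key A i)
          ≡⟨ cong (λ s → + n * M + s) (sumℤ-cong (λ i → trans (key≡pk A i) (pk-def i (+ A i)))) ⟩
      + n * M + sumℤ m (λ i → + toℕ i + + n * + A i)
          ≡⟨ cong (λ s → + n * M + s) (sumℤ-+ (λ i → + toℕ i) (λ i → + n * + A i)) ⟩
      + n * M + (sumℤ m (λ i → + toℕ i) + sumℤ m (λ i → + n * + A i))
          ≡⟨ cong (λ s → + n * M + (sumℤ m (λ i → + toℕ i) + s)) (sumℤ-* (+ n) (λ i → + A i)) ⟩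
      + n * M + (sumℤ m (λ i → + toℕ i) + + n * sumℤ m (λ i → + A i))
          ≡⟨ lemma (+ n) (sumℤ m (λ i → + A i)) (sumℤ m (λ i → + toℕ i)) ⟩
      sumℤ m (λ i → + toℕ i)                                                            ∎
      where
      lemma : ∀ n s t → n * - s + (t + n * s) ≡ t
      lemma = solve-∀

  -- Stability at 1 + `place w a`: moving n + 1 further leads to 1 + `place w b` + n (1 - k), with
  -- image b + 1 + n (1 - k), which exceeds a + 1 exactly in the two cases listed.
  Stable : Aff m → Set
  Stable w = ∀ a b k → place w b ≡ place w a + + 1 + + n * k → k < + 1 ⊎ (k ≡ + 1 × a Fin.< b)

  InSn1⇒stable : ∀ w → InSn1 m w → Stable w
  InSn1⇒stable w w∈ a b k eq with pk-<⁻ {a} {b} {+ 0} {+ 1 - k} (ℤ-<-via (w∈ (+ 1 + (place w a + + n * + 0)))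
      (trans (pk-def b (+ 1 - k)) (trans (lemma (+ toℕ b) (+ toℕ a) (+ n * (+ 1 - k)) (+ n))
        (trans (cong₂ (λ c d → c + (d - (+ suc (toℕ a) + + n * + 0))) (sym (pk-def a (+ 0))) (sym affb))
          (cong (λ d → pk a (+ 0) + (aff m w (+ 1 + (place w a + + n * + 0) + + suc n) - d))
              (sym (aff-place w a (+ 0))))))))
    where
    lemma : ∀ b a l n → b + l ≡ (a + n * + 0) + ((+ 1 + b) + l - ((+ 1 + a) + n * + 0))
    lemma = solve-∀
    lemma′ : ∀ p n k → + 1 + (p + n * + 0) + (+ 1 + n) ≡ + 1 + (p + + 1 + n * k + n * (+ 1 - k))
    lemma′ = solve-∀
    affb : aff m w (+ 1 + (place w a + + n * + 0) + + suc n) ≡ + suc (toℕ b) + + n * (+ 1 - k)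
    affb = trans (cong (aff m w) (trans (lemma′ (place w a) (+ n) k) (cong (λ p → + 1 + (p + + n * (+ 1 - k)))
        (sym eq)))) (aff-place w b (+ 1 - k))
  ... | inj₁ 0<1-k = inj₁ (ℤ-<-via 0<1-k (lemma k))
    where
    lemma : ∀ k → + 1 ≡ k + (+ 1 - k - + 0)
    lemma = solve-∀
  ... | inj₂ (0≡1-k , a<b) = inj₂ (trans (lemma k) (trans (cong (λ c → + 1 - c) (sym 0≡1-k)) refl) , a<b)
    where
    lemma : ∀ k → k ≡ + 1 - (+ 1 - k)
    lemma = solve-∀

  stable⇒InSn1 : ∀ w → Stable w → InSn1 m w
  stable⇒InSn1 w stable z with place-surjective w (z - + 1)
  ... | a , l , z≡ with place-surjective w (place w a + + 1)
  ...   | b , k , a+1≡ = subst₂ _<_ (sym affz) (sym affz′)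
      (goal (stable a b (- k) (trans (lemma₀ (place w b) (+ n) k) (cong (_+ + n * - k) (sym a+1≡)))))
    where
    lemma₀ : ∀ p n k → p ≡ p + n * k + n * - k
    lemma₀ = solve-∀
    lemma₁ : ∀ z → z ≡ + 1 + (z - + 1)
    lemma₁ = solve-∀
    lemma₂ : ∀ p n l → + 1 + (p + n * l) + (+ 1 + n) ≡ + 1 + (p + + 1 + n * (+ 1 + l))
    lemma₂ = solve-∀
    lemma₃ : ∀ p n k l → + 1 + (p + n * k + n * (+ 1 + l)) ≡ + 1 + (p + n * (k + (+ 1 + l)))
    lemma₃ = solve-∀
    z≡′ : z ≡ + 1 + (place w a + + n * l)
    z≡′ = trans (lemma₁ z) (cong (λ z → + 1 + z) z≡)
    affz : aff m w z ≡ + suc (toℕ a) + + n * l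
    affz = trans (cong (aff m w) z≡′) (aff-place w a l)
    affz′ : aff m w (z + + suc n) ≡ + suc (toℕ b) + + n * (k + (+ 1 + l))
    affz′ = trans (cong (aff m w)
        (trans (cong (_+ + suc n) z≡′) (trans (lemma₂ (place w a) (+ n) l)
        (trans (cong (λ p → + 1 + (p + + n * (+ 1 + l))) a+1≡) (lemma₃ (place w b) (+ n) k l)))))
        (aff-place w b (k + (+ 1 + l)))
    raise : ∀ {i j T S} → pk i T < pk j S → + suc (toℕ i) + + n * T < + suc (toℕ j) + + n * S
    raise {i} {j} {T} {S} lt = ℤ-<-via lt (trans (lemma (+ toℕ i) (+ toℕ j) (+ n * T) (+ n * S))
        (cong₂ (λ c d → + suc (toℕ i) + + n * T + (c - d)) (sym (pk-def j S)) (sym (pk-def i T))))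
      where
      lemma : ∀ i j t s → + 1 + j + s ≡ + 1 + i + t + (j + s - (i + t))
      lemma = solve-∀
    goal : - k < + 1 ⊎ (- k ≡ + 1 × a Fin.< b) → + suc (toℕ a) + + n * l < + suc (toℕ b) + + n * (k + (+ 1 + l))
    goal (inj₁ -k<1) = raise {a} {b} {l} {k + (+ 1 + l)} (pk-< a b (ℤ-<-via -k<1 (lemma k l)))
      where
      lemma : ∀ k l → k + (+ 1 + l) ≡ l + (+ 1 - - k)
      lemma = solve-∀
    goal (inj₂ (-k≡1 , a<b)) = raise {a} {b} {l} {k + (+ 1 + l)}
        (subst (λ c → pk a l < pk b c)
        (trans (lemma l) (trans (cong (λ c → - c + (+ 1 + l)) (sym -k≡1))
        (cong (_+ (+ 1 + l)) (ℤₚ.neg-involutive k)))) (pk-<ˡ l a<b))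
      where
      lemma : ∀ l → l ≡ - + 1 + (+ 1 + l)
      lemma = solve-∀

  -- The column condition on labelled Dyck paths: where the area rises by 1, two North steps follow
  -- each other in one column.
  IsTieBreaking : (Fin n → ℕ) → (Fin n → Fin n) → Set
  IsTieBreaking A ρ = ∀ i j → toℕ j ≡ suc (toℕ i) → A j ≡ suc (A i) → ρ i Fin.< ρ j

  record Config (w : Aff m) (M : ℤ) : Set where
    field
      A         : Fin n → ℕ
      profile   : IsProfile A
      ρ         : Permutation′ n
      place-ρ   : ∀ i → place w (ρ ⟨$⟩ʳ i) ≡ M + + key A i
      tie       : IsTieBreaking A (ρ ⟨$⟩ʳ_)

  increment-≤ : ∀ {a b : ℕ} {P : Set} → + b - + a < + 1 ⊎ (+ b - + a ≡ + 1 × P) → b ℕ.≤ suc a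
  increment-≤ {a} {b} (inj₁ lt) = ℤₚ.drop‿+≤+ (ℤ-≤-via (ℤₚ.<⇒≤ lt) (lemma (+ a) (+ b)))
    where
    lemma : ∀ a b → + 1 + a ≡ b + (+ 1 - (b - a))
    lemma = solve-∀
  increment-≤ {a} {b} (inj₂ (eq , _)) = ℤₚ.drop‿+≤+ (ℤₚ.≤-reflexive (trans (lemma (+ a) (+ b)) (cong (_+ + a) eq)))
    where
    lemma : ∀ a b → b ≡ b - a + a
    lemma = solve-∀

  increment-≡ : ∀ {a b : ℕ} {P : Set} → b ≡ suc a → + b - + a < + 1 ⊎ (+ b - + a ≡ + 1 × P) → P
  increment-≡ refl (inj₂ (_ , p)) = p
  increment-≡ {a} refl (inj₁ lt) = ⊥-elim (ℤₚ.<-irrefl (lemma (+ a)) lt)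
    where
    lemma : ∀ a → + 1 + a - a ≡ + 1
    lemma = solve-∀

  -- Labels are indexed by the residue of their place relative to the least one, and the quotients
  -- form A. Stability applied to successive residues bounds the rise of A and orders the labels
  -- where the rise is 1.
  config : ∀ w a₀ → Stable w → (∀ a → place w a₀ ≤ place w a) → Config w (place w a₀)
  config w a₀ stable least = record
    { A = A
    ; profile = record { zero≡ = A-zero ; step≤ = A-step }
    ; ρ = proj₁ ρ,eq
    ; place-ρ = λ i → trans (cong (place w) (proj₂ ρ,eq i)) (place-r i)
    ; tie = λ i j eq eq′ → subst₂ Fin._<_ (sym (proj₂ ρ,eq i)) (sym (proj₂ ρ,eq j)) (r-tie i j eq eq′)
    }
    where
    open ≡-Reasoning
    M = place w a₀
    r : Fin n → Fin n
    r i = proj₁ (place-surjective w (M + + toℕ i))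
    k : Fin n → ℤ
    k i = proj₁ (proj₂ (place-surjective w (M + + toℕ i)))
    rk≡ : ∀ i → M + + toℕ i ≡ place w (r i) + + n * k i
    rk≡ i = proj₂ (proj₂ (place-surjective w (M + + toℕ i)))
    place-r′ : ∀ i → place w (r i) ≡ M + pk i (- k i)
    place-r′ i = begin
      place w (r i) ≡⟨ lemma (place w (r i)) (+ n) (k i) ⟩
      place w (r i) + + n * k i + + n * - k i ≡⟨ cong (_+ + n * - k i) (rk≡ i) ⟨
      M + + toℕ i + + n * - k i ≡⟨ ℤₚ.+-assoc M (+ toℕ i) (+ n * - k i) ⟩
      M + (+ toℕ i + + n * - k i) ≡⟨ cong (λ p → M + p) (pk-def i (- k i)) ⟨
      M + pk i (- k i)                                    ∎
      where
      lemma : ∀ p n k → p ≡ p + n * k + n * - k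
      lemma = solve-∀
    A : Fin n → ℕ
    -- The absolute value changes nothing: no place is below M, so - k i is not negative.
    A i = ℤ.∣ - k i ∣
    A≡ : ∀ i → + A i ≡ - k i
    A≡ i = ℤₚ.0≤i⇒+∣i∣≡i (pk-≤⁻ {Fin.zero} {i}
        (ℤ-≤-via (least (r i)) (trans (lemma M (pk i (- k i))) (cong₂ (λ c d → c + (d - M)) (sym pk0≡0)
        (sym (place-r′ i))))))
      where
      lemma : ∀ M p → p ≡ + 0 + (M + p - M)
      lemma = solve-∀
      pk0≡0 : pk Fin.zero (+ 0) ≡ + 0
      pk0≡0 = trans (pk-def Fin.zero (+ 0)) (trans (cong (λ z → + 0 + z) (ℤₚ.*-zeroʳ (+ n))) refl)
    place-r : ∀ i → place w (r i) ≡ M + + key A i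
    place-r i = trans (place-r′ i) (cong (λ p → M + p) (trans (cong (pk i) (sym (A≡ i))) (sym (key≡pk A i))))
    r-injective : ∀ {i j} → r i ≡ r j → i ≡ j
    r-injective {i} {j} eq = proj₁
        (lex-injective {A i} {A j}
        (ℤₚ.+-injective (cancel M (trans (sym (place-r i)) (trans (cong (place w) eq) (place-r j))))))
      where
      cancel : ∀ M {a b} → M + a ≡ M + b → a ≡ b
      cancel M {a} {b} eq = trans (lemma M a) (trans (cong (_- M) eq) (sym (lemma M b)))
        where
        lemma : ∀ M a → a ≡ M + a - M
        lemma = solve-∀
    ρ,eq = injective⇒permutation r r-injective
    A-zero : A Fin.zero ≡ 0
    A-zero = ℤₚ.+-injective (trans (A≡ Fin.zero)
        (cong -_ (sym (proj₂ (place-injective w {a₀} {r Fin.zero} {+ 0} (trans (cong (λ z → M + z) (ℤₚ.*-zeroʳ (+ n)))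
        (rk≡ Fin.zero)))))))
    successive : ∀ i j → toℕ j ≡ suc (toℕ i) → place w (r j) ≡ place w (r i) + + 1 + + n * (+ A j - + A i)
    successive i j eq = begin
      place w (r j) ≡⟨ place-r j ⟩
      M + + key A j ≡⟨ cong (λ p → M + p) (trans (key≡pk A j) (pk-def j _)) ⟩
      M + (+ toℕ j + + n * + A j) ≡⟨ cong (λ c → M + (+ c + + n * + A j)) eq ⟩
      M + (+ suc (toℕ i) + + n * + A j) ≡⟨ lemma M (+ toℕ i) (+ n) (+ A i) (+ A j) ⟩
      M + (+ toℕ i + + n * + A i) + + 1 + + n * (+ A j - + A i)
          ≡⟨ cong (λ p → M + p + + 1 + + n * (+ A j - + A i)) (trans (key≡pk A i) (pk-def i _)) ⟨
      M + + key A i + + 1 + + n * (+ A j - + A i) ≡⟨ cong (λ p → p + + 1 + + n * (+ A j - + A i)) (place-r i) ⟨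
      place w (r i) + + 1 + + n * (+ A j - + A i)              ∎
      where
      lemma : ∀ M i n a b → M + (+ 1 + i + n * b) ≡ M + (i + n * a) + + 1 + n * (b - a)
      lemma = solve-∀
    A-step : ∀ i j → toℕ j ≡ suc (toℕ i) → A j ℕ.≤ suc (A i)
    A-step i j eq = increment-≤ (stable (r i) (r j) (+ A j - + A i) (successive i j eq))
    r-tie : ∀ i j → toℕ j ≡ suc (toℕ i) → A j ≡ suc (A i) → r i Fin.< r j
    r-tie i j eq eq′ = increment-≡ eq′ (stable (r i) (r j) (+ A j - + A i) (successive i j eq))

  profile⇒stable : ∀ w M {A} (ρ : Permutation′ n) → IsProfile A → (∀ i → place w (ρ ⟨$⟩ʳ i) ≡ M + + key A i) →
      IsTieBreaking A (ρ ⟨$⟩ʳ_) → Stable w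
  profile⇒stable w M {A} ρ isProfile place-ρ tie a b k eq = by-successor (successor? i)
    where
    open ≡-Reasoning
    i = ρ ⟨$⟩ˡ a
    j = ρ ⟨$⟩ˡ b
    place≡ : ∀ a → place w a ≡ M + pk (ρ ⟨$⟩ˡ a) (+ A (ρ ⟨$⟩ˡ a))
    place≡ a = trans (cong (place w) (sym (inverseʳ ρ)))
        (trans (place-ρ (ρ ⟨$⟩ˡ a)) (cong (λ p → M + p) (key≡pk A _)))
    pkj≡ : pk j (+ A j) ≡ + toℕ i + + n * + A i + + 1 + + n * k
    pkj≡ = begin
      pk j (+ A j) ≡⟨ lemma M (pk j (+ A j)) ⟩
      M + pk j (+ A j) - M ≡⟨ cong (_- M) (place≡ b) ⟨
      place w b - M ≡⟨ cong (_- M) eq ⟩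
      place w a + + 1 + + n * k - M ≡⟨ cong (λ p → p + + 1 + + n * k - M) (place≡ a) ⟩
      M + pk i (+ A i) + + 1 + + n * k - M ≡⟨ cong (λ p → M + p + + 1 + + n * k - M) (pk-def i _) ⟩
      M + (+ toℕ i + + n * + A i) + + 1 + + n * k - M ≡⟨ lemma′ M (+ toℕ i + + n * + A i) (+ n * k) ⟩
      + toℕ i + + n * + A i + + 1 + + n * k                 ∎
      where
      lemma : ∀ M a → a ≡ M + a - M
      lemma = solve-∀
      lemma′ : ∀ M a b → M + a + + 1 + b - M ≡ a + + 1 + b
      lemma′ = solve-∀
    by-successor : (Σ[ j ∈ Fin n ] toℕ j ≡ suc (toℕ i)) ⊎ i ≡ last m → k < + 1 ⊎ (k ≡ + 1 × a Fin.< b)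
    by-successor (inj₁ (j′ , j′≡)) with pk-inj {j} {j′} {+ A j} {+ A i + k}
        (trans pkj≡ (trans (lemma (+ toℕ i) (+ A i) k (+ n)) (trans (cong (λ c → + c + + n * (+ A i + k)) (sym j′≡))
        (sym (pk-def j′ _)))))
      where
      lemma : ∀ i a k n → i + n * a + + 1 + n * k ≡ + 1 + i + n * (a + k)
      lemma = solve-∀
    ... | refl , Aj≡ with ℕₚ.m≤n⇒m<n∨m≡n (IsProfile.step≤ isProfile i j j′≡)
    ...   | inj₁ Aj< = inj₁ (ℤ-<-via (ℤ.+<+ Aj<)
        (trans (lemma (+ A i) k) (cong (λ c → k + (+ suc (A i) - c)) (sym Aj≡))))
      where
      lemma : ∀ a k → + 1 ≡ k + (+ 1 + a - (a + k))
      lemma = solve-∀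
    ...   | inj₂ Aj≡′ = inj₂ (trans (lemma (+ A i) k)
        (trans (cong (_- + A i) (sym Aj≡)) (trans (cong (λ c → + c - + A i) Aj≡′) (lemma′ (+ A i))))
                            , subst₂ Fin._<_ (inverseʳ ρ) (inverseʳ ρ) (tie i j j′≡ Aj≡′))
      where
      lemma : ∀ a k → k ≡ a + k - a
      lemma = solve-∀
      lemma′ : ∀ a → + 1 + a - a ≡ + 1
      lemma′ = solve-∀
    -- After the last residue comes residue 0 with a carry, and A is 0 there, so k = - A i - 1.
    by-successor (inj₂ i≡last) with pk-inj {j} {Fin.zero} {+ A j} {+ A i + k + + 1}
        (trans pkj≡ (trans (cong (λ c → + c + + n * + A i + + 1 + + n * k)
        (trans (cong toℕ i≡last) (Finₚ.toℕ-fromℕ m))) (trans (lemma (+ m) (+ A i) k) (sym (pk-def Fin.zero _)))))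
      where
      lemma : ∀ m a k → m + (+ 1 + m) * a + + 1 + (+ 1 + m) * k ≡ + 0 + (+ 1 + m) * (a + k + + 1)
      lemma = solve-∀
    ... | j≡0 , Aj≡ = inj₁ (ℤ-<-via (ℤ.+<+ (s≤s (z≤n {suc (A i)})))
        (trans (cong (λ c → + 1 + c) (trans (sym (cong +_ (trans (cong A j≡0) (IsProfile.zero≡ isProfile)))) Aj≡))
        (lemma (+ A i) k)))
      where
      lemma : ∀ a k → + 1 + (a + k + + 1) ≡ k + (+ 2 + a - + 0)
      lemma = solve-∀

-- Minimal alcoves of dominant regions are stable.

module MinimalAlcoves (m : ℕ) where
  open import Data.Integer using (_+_; _*_; -_; _-_; _<_; _≤_)
  open AffinePermutations m
  open Alcoves m
  open Profiles m
  open Regions m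
  open StableElements m

  private
    n = suc m

  place-≢ : ∀ w {a b} k → a ≢ b → place w a + + n * k ≢ place w b
  place-≢ w {a} {b} k a≢b eq = a≢b (proj₁ (place-injective w {a} {b} {k} {+ 0} (trans eq (lemma (place w b) (+ n)))))
    where
    lemma : ∀ p n → p ≡ p + n * + 0
    lemma = solve-∀

  module _ (w : Aff m) {x : Fin n → ℚ} (x∈A : InA m x) where
    private
      z = actQ m w x

    pair-> : ∀ α k → place w (ri α) + + n * k < place w (rj α) → ι k ℚ.< pairQ m z α
    pair-> α k gap = +<⇒<- {z (ri α)} {z (rj α)} (alcove-gap w {x} x∈A (ri α) (rj α) k gap)

    pair-< : ∀ α k → place w (rj α) < place w (ri α) + + n * k → pairQ m z α ℚ.< ι k
    pair-< α k gap = <+⇒-< {z (ri α)} {z (rj α)}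
        (ℚ-<-via (alcove-gap w {x} x∈A (rj α) (ri α) (- k)
        (ℤ-<-via gap (lemmaℤ (place w (ri α)) (place w (rj α)) (+ n) k)))
        (trans (lemma (z (ri α)) (z (rj α)) (ι k)) (cong (λ c → z (ri α) ℚ.+ (z (rj α) ℚ.- (z (ri α) ℚ.+ c)))
            (sym (ι-neg k)))))
      where
      lemmaℤ : ∀ i j n k → i ≡ j + n * - k + (i + n * k - j)
      lemmaℤ = solve-∀
      lemma : ∀ zi zj k → zj ℚ.+ k ≡ zi ℚ.+ (zj ℚ.- (zi ℚ.+ ℚ.- k))
      lemma = RingSolver.solve-∀ ℚ-ring

    root-distinct : ∀ α → ri α ≢ rj α
    root-distinct α eq = ℕₚ.<⇒≢ (root-< α) (cong toℕ eq)

    -- One sample point of the alcove is enough: places of different labels are never congruent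
    -- modulo n, so one of two strict inequalities holds, and the wrong one contradicts the sample.
    pair->⁻ : ∀ α k → ι k ℚ.< pairQ m z α → place w (ri α) + + n * k < place w (rj α)
    pair->⁻ α k k< = ℤₚ.≤∧≢⇒< (ℤₚ.≮⇒≥ λ lt → ℚₚ.<-asym k< (pair-< α k lt)) (place-≢ w k (root-distinct α))

    pair-<⁻ : ∀ α k → pairQ m z α ℚ.< ι k → place w (rj α) < place w (ri α) + + n * k
    pair-<⁻ α k <k = ℤₚ.≤∧≢⇒< (ℤₚ.≮⇒≥ λ lt → ℚₚ.<-asym <k (pair-> α k lt)) (λ eq → place-≢ w k (root-distinct α)
        (sym eq))

  module _ (s : PosRoot m → Three) (s-dominant : IsDomShi m s) (w : Aff m) (w-minimal : IsMinAlc m s w) where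

    private
      x = proj₁ (alcovePoint)
      x∈A = proj₂ (alcovePoint)

    dominant⇒increasing : ∀ a b → a Fin.< b → place w a < place w b
    dominant⇒increasing a b a<b = subst (_< place w b) (lemma (place w a) (+ n)) (pair->⁻ w x∈A (root a b a<b) (+ 0)
        (+<⇒<- {actQ m w x a} {actQ m w x b} (subst (ℚ._< actQ m w x a) (sym (ℚₚ.+-identityʳ _))
            (proj₂ (proj₂ s-dominant (actQ m w x) (proj₁ w-minimal x x∈A)) a b a<b))))
      where
      lemma : ∀ p n → p + n * + 0 ≡ p
      lemma = solve-∀

    increasing⁻ : ∀ a b → place w a < place w b → a Fin.< b
    increasing⁻ a b lt with Finₚ.<-cmp a b
    ... | tri< a<b _ _ = a<b
    ... | tri≈ _ refl _ = ⊥-elim (ℤₚ.<-irrefl refl lt)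
    ... | tri> _ _ b<a = ⊥-elim (ℤₚ.<-asym lt (dominant⇒increasing b a b<a))

    -- Exchanging the residues of the places of a and b crosses the hyperplane ⟨x, e_a - e_b⟩ = k and no other one. For k > 1
    -- this is not a Shi hyperplane, so that the alcove was not minimal.
    module _ (a b : Fin n) (k : ℤ) (b≡ : place w b ≡ place w a + + 1 + + n * k) (1<k : + 1 < k) where

      private
        a<b : a Fin.< b
        a<b = increasing⁻ a b (ℤ-<-via
            (ℤₚ.<-≤-trans (ℤ.+<+ (s≤s z≤n))
            (ℤₚ.≤-trans (ℤₚ.≤-trans (ℤₚ.<⇒≤ 1<k) (≤-n* k (ℤₚ.≤-trans (ℤ.+≤+ z≤n) (ℤₚ.<⇒≤ 1<k))))
            (ℤₚ.i≤j+i (+ n * k) (+ 1)) ))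
            (trans b≡ (lemma (place w a) (+ n * k))))
          where
          ≤-n* : ∀ k → + 0 ≤ k → k ≤ + n * k
          ≤-n* k 0≤k = subst (_≤ + n * k) (ℤₚ.*-identityˡ k) (ℤₚ.*-monoʳ-≤-nonNeg k {{ℤ.nonNegative 0≤k}} {+ 1} {+ n}
              (ℤ.+≤+ (s≤s z≤n)))
          lemma : ∀ p q → p + + 1 + q ≡ p + (+ 1 + q - + 0)
          lemma = solve-∀

        a≢b : a ≢ b
        a≢b eq = ℕₚ.<⇒≢ a<b (cong toℕ eq)

        e : Fin n → ℤ
        e c = ind a c - ind b c

        e-a : e a ≡ + 1
        e-a = cong₂ _-_ (ind-≡ a) (ind-≢ a≢b)

        e-b : e b ≡ - + 1
        e-b = cong₂ _-_ (ind-≢ (a≢b ∘ sym)) (ind-≡ b)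

        e-other : ∀ {c} → c ≢ a → c ≢ b → e c ≡ + 0
        e-other c≢a c≢b = cong₂ _-_ (ind-≢ c≢a) (ind-≢ c≢b)

        -- The place of a moves up by 1 and that of b down by 1. Since the residue of b follows that
        -- of a, this exchanges the two residues modulo n.
        p : Fin n → ℤ
        p c = place w c + e c

        data Exchange (c d : Fin n) : Set where
          at-a  : c ≡ a → d ≡ b → Exchange c d
          at-b  : c ≡ b → d ≡ a → Exchange c d
          fixed : c ≢ a → c ≢ b → c ≡ d → Exchange c d

        exchange-injective : ∀ {c c′ d} → Exchange c d → Exchange c′ d → c ≡ c′
        exchange-injective (at-a c≡ _) (at-a c′≡ _) = trans c≡ (sym c′≡)
        exchange-injective (at-a _ d≡b) (at-b _ d≡a) = ⊥-elim (a≢b (trans (sym d≡a) d≡b))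
        exchange-injective (at-a _ d≡b) (fixed _ c′≢b c′≡d) = ⊥-elim (c′≢b (trans c′≡d d≡b))
        exchange-injective (at-b _ d≡a) (at-a _ d≡b) = ⊥-elim (a≢b (trans (sym d≡a) d≡b))
        exchange-injective (at-b c≡ _) (at-b c′≡ _) = trans c≡ (sym c′≡)
        exchange-injective (at-b _ d≡a) (fixed c′≢a _ c′≡d) = ⊥-elim (c′≢a (trans c′≡d d≡a))
        exchange-injective (fixed _ c≢b c≡d) (at-a _ d≡b) = ⊥-elim (c≢b (trans c≡d d≡b))
        exchange-injective (fixed c≢a _ c≡d) (at-b _ d≡a) = ⊥-elim (c≢a (trans c≡d d≡a))
        exchange-injective (fixed _ _ c≡d) (fixed _ _ c′≡d) = trans c≡d (sym c′≡d)

        exchange : ∀ c → Σ[ d ∈ Fin n ] Exchange c d × p c ≡ place w d + + n * (- k * e c)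
        exchange c = by-cases (c Fin.≟ a) (c Fin.≟ b)
          where
          lemma-a : ∀ p n k → p + + 1 ≡ p + + 1 + n * k + n * (- k * + 1)
          lemma-a = solve-∀
          lemma-b : ∀ p n k → p + + 1 + n * k + - + 1 ≡ p + n * (- k * - + 1)
          lemma-b = solve-∀
          lemma-c : ∀ p n k → p + + 0 ≡ p + n * (- k * + 0)
          lemma-c = solve-∀
          by-cases : Dec (c ≡ a) → Dec (c ≡ b) → Σ[ d ∈ Fin n ] Exchange c d × p c ≡ place w d + + n * (- k * e c)
          by-cases (yes refl) _ = b , at-a refl refl , trans (cong (λ e → place w a + e) e-a)
              (trans (lemma-a (place w a) (+ n) k) (cong₂ (λ q e → q + + n * (- k * e)) (sym b≡) (sym e-a)))
          by-cases (no _) (yes refl) = a , at-b refl refl , trans (cong (λ e → place w b + e) e-b)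
              (trans (cong (_+ - + 1) b≡) (trans (lemma-b (place w a) (+ n) k)
              (cong (λ e → place w a + + n * (- k * e)) (sym e-b))))
          by-cases (no c≢a) (no c≢b) = c , fixed c≢a c≢b refl , trans (cong (λ e → place w c + e) (e-other c≢a c≢b))
              (trans (lemma-c (place w c) (+ n) k) (cong (λ e → place w c + + n * (- k * e)) (sym (e-other c≢a c≢b))))

        p-injective : ∀ {c d l} → p c ≡ p d + + n * l → c ≡ d
        p-injective {c} {d} {l} eq = conclude (exchange c) (exchange d)
          where
          lemma : ∀ p n a b → p + n * a + n * b ≡ p + n * (a + b)
          lemma = solve-∀
          conclude : Σ[ c′ ∈ Fin n ] Exchange c c′ × p c ≡ place w c′ + + n * (- k * e c) →
                     Σ[ d′ ∈ Fin n ] Exchange d d′ × p d ≡ place w d′ + + n * (- k * e d) → c ≡ d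
          conclude (c′ , c↔c′ , pc≡) (d′ , d↔d′ , pd≡) = exchange-injective c↔c′
              (subst (Exchange d) (sym (proj₁ (place-injective w {c′} {d′} { - k * e c} { - k * e d + l}
            (trans (sym pc≡) (trans eq (trans (cong (_+ + n * l) pd≡) (lemma (place w d′) (+ n) (- k * e d) l)))))))
                d↔d′)

        Σp : sumℤ m p ≡ sumℤ m (λ i → + toℕ i)
        Σp = begin
          sumℤ m p ≡⟨ sumℤ-+ (place w) e ⟩
          sumℤ m (place w) + sumℤ m e ≡⟨ cong₂ _+_ (sumℤ-place w) Σe ⟩
          sumℤ m (λ i → + toℕ i) + + 0 ≡⟨ ℤₚ.+-identityʳ _ ⟩
          sumℤ m (λ i → + toℕ i)                                                ∎
          where
          open ≡-Reasoning
          Σind : ∀ a → sumℤ m (ind a) ≡ + 1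
          Σind a = trans (sumℤ-cong (λ c → sym (ℤₚ.*-identityˡ (ind a c)))) (sumℤ-ind a (λ _ → + 1))
          Σe : sumℤ m e ≡ + 0
          Σe = trans (sumℤ-+ (ind a) (λ c → - ind b c))
              (cong₂ _+_ (Σind a) (trans (sumℤ-neg (ind b)) (cong -_ (Σind b))))

        w′ : Aff m
        w′ = proj₁ (fromPlaces p p-injective Σp)

        place′≡ : ∀ c → place w′ c ≡ place w c + e c
        place′≡ = proj₂ (fromPlaces p p-injective Σp)

        -- Only for the pair (a, b) does the difference of places change by 2; every other change is
        -- too small to cross a hyperplane.
        data Shift (i j : Fin n) : Set where
          both  : i ≡ a → j ≡ b → Shift i j
          small : - + 1 ≤ e j - e i → e j - e i ≤ + 1 → Shift i j

        shift : ∀ i j → i Fin.< j → Shift i j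
        shift i j i<j = by-cases (i Fin.≟ a) (i Fin.≟ b) (j Fin.≟ a) (j Fin.≟ b)
          where
          small-≡ : ∀ {ei ej} → e i ≡ ei → e j ≡ ej → - + 1 ≤ ej - ei → ej - ei ≤ + 1 → Shift i j
          small-≡ refl refl = small
          by-cases : Dec (i ≡ a) → Dec (i ≡ b) → Dec (j ≡ a) → Dec (j ≡ b) → Shift i j
          by-cases (yes i≡a) _ _ (yes j≡b) = both i≡a j≡b
          by-cases (yes refl) _ _ (no j≢b) = small-≡ e-a (e-other (λ { refl → ℕₚ.<-irrefl refl i<j }) j≢b) ℤₚ.≤-refl
              ℤ.-≤+
          by-cases (no i≢a) (yes refl) (yes refl) _ = ⊥-elim (ℕₚ.<-asym a<b i<j)
          by-cases (no i≢a) (yes refl) (no j≢a) _ = small-≡ e-b (e-other j≢a (λ { refl → ℕₚ.<-irrefl refl i<j }))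
              ℤ.-≤+ ℤₚ.≤-refl
          by-cases (no i≢a) (no i≢b) (yes refl) _ = small-≡ (e-other i≢a i≢b) e-a ℤ.-≤+ ℤₚ.≤-refl
          by-cases (no i≢a) (no i≢b) (no j≢a) (yes refl) = small-≡ (e-other i≢a i≢b) e-b ℤₚ.≤-refl ℤ.-≤+
          by-cases (no i≢a) (no i≢b) (no j≢a) (no j≢b) = small-≡ (e-other i≢a i≢b) (e-other j≢a j≢b) ℤ.-≤+ (ℤ.+≤+ z≤n)

        -- A loss of at most 1 turns a strict inequality of integers into a weak one, and equality
        -- is excluded since the new places of different labels are not congruent modulo n.
        up : ∀ α c → - + 1 ≤ e (rj α) - e (ri α) → place w (ri α) + + n * c < place w (rj α) → place w′ (ri α) + + n *
            c < place w′ (rj α)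
        up α c δ≥ gap = ℤₚ.≤∧≢⇒< (ℤ-≤-via (ℤₚ.+-mono-≤ (ℤₚ.i<j⇒suc[i]≤j gap) δ≥)
            (trans (place′≡ (rj α)) (trans (lemma (place w (ri α)) (place w (rj α)) (e (ri α)) (e (rj α)) (+ n * c))
                (cong (λ q → q + + n * c + (place w (rj α) + (e (rj α) - e (ri α)) -
                (+ 1 + (place w (ri α) + + n * c) + - + 1))) (sym (place′≡ (ri α)))))))
            (place-≢ w′ c (λ eq → ℕₚ.<⇒≢ (root-< α) (cong toℕ eq)))
          where
          lemma : ∀ i j ei ej c → j + ej ≡ i + ei + c + (j + (ej - ei) - (+ 1 + (i + c) + - + 1))
          lemma = solve-∀

        down : ∀ α c → e (rj α) - e (ri α) ≤ + 1 → place w (rj α) < place w (ri α) + + n * c → place w′ (rj α) < place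
            w′ (ri α) + + n * c
        down α c δ≤ gap = ℤₚ.≤∧≢⇒< (ℤ-≤-via (ℤₚ.+-mono-≤ (ℤₚ.i<j⇒suc[i]≤j gap) δ≤)
            (trans (cong (_+ + n * c) (place′≡ (ri α)))
                (trans (lemma (place w (ri α)) (place w (rj α)) (e (ri α)) (e (rj α)) (+ n * c))
                (cong (λ q → q + (place w (ri α) + + n * c + + 1 -
                (+ 1 + place w (rj α) + (e (rj α) - e (ri α))))) (sym (place′≡ (rj α)))))))
            (λ eq → place-≢ w′ c (λ eq → ℕₚ.<⇒≢ (root-< α) (cong toℕ eq)) (sym eq))
          where
          lemma : ∀ i j ei ej c → i + ei + c ≡ j + ej + (i + c + + 1 - (+ 1 + j + (ej - ei)))
          lemma = solve-∀

        d′≡ : place w′ b ≡ place w′ a + (+ n * k - + 1)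
        d′≡ = trans (place′≡ b) (trans (cong₂ _+_ b≡ e-b) (trans (lemma (place w a) (+ n * k))
            (cong (_+ (+ n * k - + 1)) (sym (trans (place′≡ a) (cong (λ e → place w a + e) e-a))))))
          where
          lemma : ∀ p q → p + + 1 + q + - + 1 ≡ p + + 1 + (q - + 1)
          lemma = solve-∀

        below-k′ : place w′ a + + n * (k - + 1) < place w′ b
        below-k′ = ℤₚ.≤∧≢⇒< (ℤ-≤-via (ℤ.+≤+ {1} {n} (s≤s z≤n)) (trans d′≡ (lemma (place w′ a) (+ n) k)))
            (place-≢ w′ (k - + 1) a≢b)
          where
          lemma : ∀ p n k → p + (n * k - + 1) ≡ p + n * (k - + 1) + (n - + 1)
          lemma = solve-∀

        above-k′ : place w′ b < place w′ a + + n * (k - + 1 + + 1)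
        above-k′ = ℤ-<-via (ℤ.+<+ {0} {1} (s≤s z≤n)) (trans (lemma (place w′ a) (+ n) k)
            (cong (_+ (+ 1 - + 0)) (sym d′≡)))
          where
          lemma : ∀ p n k → p + n * (k - + 1 + + 1) ≡ p + (n * k - + 1) + (+ 1 - + 0)
          lemma = solve-∀

        below-k : place w a + + n * k < place w b
        below-k = ℤ-<-via (ℤ.+<+ {0} {1} (s≤s z≤n)) (trans b≡ (lemma (place w a) (+ n * k)))
          where
          lemma : ∀ p q → p + + 1 + q ≡ p + q + (+ 1 - + 0)
          lemma = solve-∀

        above-k : place w b < place w a + + n * (k + + 1)
        above-k = ℤₚ.≤∧≢⇒< (ℤ-≤-via (ℤ.+≤+ {1} {n} (s≤s z≤n))
            (trans (lemma (place w a) (+ n) k) (cong (_+ (+ n - + 1)) (sym b≡))))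
            (λ eq → place-≢ w (k + + 1) a≢b (sym eq))
          where
          lemma : ∀ p n k → p + n * (k + + 1) ≡ p + + 1 + n * k + (n - + 1)
          lemma = solve-∀

        1<-place : ∀ w → place w a + + n * (k - + 1) < place w b → place w a + + n * + 1 < place w b
        1<-place w lt = ℤₚ.≤-<-trans
            (ℤₚ.+-monoʳ-≤ (place w a) (ℤₚ.*-monoˡ-≤-nonNeg (+ n) {+ 1} {k - + 1} (ℤ-suc-≤-via 1<k (lemma k)))) lt
          where
          lemma : ∀ k → k - + 1 ≡ + 1 + (k - (+ 1 + + 1))
          lemma = solve-∀

        α₀ : PosRoot m
        α₀ = root a b a<b

        w′∈s : AlcIn m w′ s
        w′∈s y y∈A = InV-actQ w′ {y} (proj₁ (proj₁ y∈A)) , sat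
          where
          z = actQ m w y
          z′ = actQ m w′ y
          z∈ : InRegion m s z
          z∈ = proj₁ w-minimal y y∈A
          0<z : ∀ α → 0ℚ ℚ.< pairQ m z α
          0<z α = +<⇒<- {z (ri α)} {z (rj α)} (subst (ℚ._< z (ri α)) (sym (ℚₚ.+-identityʳ _))
              (proj₂ (proj₂ s-dominant z z∈) (ri α) (rj α) (root-< α)))
          -- For the pair (a, b) the value of ⟨x, α⟩ is above k before the exchange and above k - 1
          -- ≥ 1 after it, so its position is `pos` both times.
          transport : ∀ t α → Shift (ri α) (rj α) → Sat m t (pairQ m z α) → Sat m t (pairQ m z′ α)
          transport neg α _ <0 = ⊥-elim (ℚₚ.<-asym <0 (0<z α))
          transport mid (root i j i<j) (both refl refl) (_ , <1) =
              ⊥-elim (ℚₚ.<-asym <1 (pair-> w y∈A α₀ (+ 1)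
              (1<-place w (ℤₚ.<-trans (ℤ-<-via (ℤ.+<+ {0} {n} (s≤s z≤n)) (lemma (place w a) (+ n) k)) below-k))))
            where
            lemma : ∀ p n k → p + n * k ≡ p + n * (k - + 1) + (n - + 0)
            lemma = solve-∀
          transport mid α (small δ≥ δ≤) (0< , <1) = pair-> w′ y∈A α (+ 0) (up α (+ 0) δ≥ (pair->⁻ w y∈A α (+ 0) 0<))
                                                  , pair-< w′ y∈A α (+ 1) (down α (+ 1) δ≤ (pair-<⁻ w y∈A α (+ 1) <1))
          transport pos (root i j i<j) (both refl refl) _ = pair-> w′ y∈A α₀ (+ 1) (1<-place w′ below-k′)
          transport pos α (small δ≥ _) 1< = pair-> w′ y∈A α (+ 1) (up α (+ 1) δ≥ (pair->⁻ w y∈A α (+ 1) 1<))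
          sat : ∀ α → Sat m (s α) (pairQ m z′ α)
          sat α = transport (s α) α (shift (ri α) (rj α) (root-< α)) (proj₂ z∈ α)

        |k|≤|k-1| : ℤ.∣ k ∣ ℕ.≤ ℤ.∣ k - + 1 ∣
        |k|≤|k-1| = proj₂ w-minimal w′ w′∈s α₀ k (k - + 1)
          (λ y y∈A → pair-> w y∈A α₀ k below-k , pair-< w y∈A α₀ (k + + 1) above-k)
          (λ y y∈A → pair-> w′ y∈A α₀ (k - + 1) below-k′ , pair-< w′ y∈A α₀ (k - + 1 + + 1) above-k′)

      large-jump-impossible : ⊥
      large-jump-impossible = contra k 1<k |k|≤|k-1|
        where
        contra : ∀ k → + 1 < k → ℤ.∣ k ∣ ℕ.≤ ℤ.∣ k - + 1 ∣ → ⊥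
        contra (+ suc k) _ le = ℕₚ.<-irrefl refl le
        contra (+ zero) (ℤ.+<+ ()) _

    -- For k = 1 the exchange would cross a Shi hyperplane and proves nothing; there the order of
    -- the labels comes from dominance, as the place of b exceeds that of a.
    minimal⇒stable : Stable w
    minimal⇒stable a b k b≡ with ℤₚ.<-cmp k (+ 1)
    ... | tri< k<1 _ _ = inj₁ k<1
    ... | tri> _ _ 1<k = ⊥-elim (large-jump-impossible a b k b≡ 1<k)
    ... | tri≈ _ k≡1 _ = inj₂
        (k≡1 , increasing⁻ a b (ℤ-<-via (ℤ.+<+ {0} {suc n} (s≤s z≤n))
        (trans b≡ (trans (cong (λ k → place w a + + 1 + + n * k) k≡1) (lemma (place w a) (+ n))))))
      where
      lemma : ∀ p n → p + + 1 + n * + 1 ≡ p + (+ 1 + n - + 0)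
      lemma = solve-∀

-- Sorting by adjacent exchanges of equal values.

module BubbleSort where
  open import Data.Integer using (_+_; _*_; -_; _-_)

  module _ {n : ℕ} where

    transpose-i : ∀ (i j : Fin n) → PermC.transpose i j i ≡ j
    transpose-i i j rewrite dec-true (i Fin.≟ i) refl = refl

    transpose-j : ∀ (i j : Fin n) → PermC.transpose i j j ≡ i
    transpose-j i j with j Fin.≟ i
    ... | yes j≡i = j≡i
    ... | no _ rewrite dec-true (j Fin.≟ j) refl = refl

    transpose-k : ∀ (i j : Fin n) {k} → k ≢ i → k ≢ j → PermC.transpose i j k ≡ k
    transpose-k i j {k} k≢i k≢j rewrite dec-false (k Fin.≟ i) k≢i | dec-false (k Fin.≟ j) k≢j = refl

    module _ (P : Fin n → ℕ) (P-mono : ∀ i j → i Fin.≤ j → P i ℕ.≤ P j)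
             (Q : (Fin n → Fin n) → Set) (Q-resp : ∀ {g h} → (∀ i → g i ≡ h i) → Q g → Q h)
             (Q-swap : ∀ g i j → toℕ j ≡ suc (toℕ i) → P i ≡ P j → Q g → Q (g ∘ PermC.transpose i j)) where

      private
        Fixes : ℕ → Permutation′ n → Set
        Fixes k π = ∀ i → toℕ i ℕ.< k → π ⟨$⟩ʳ i ≡ i

        PreservesP : Permutation′ n → Set
        PreservesP π = ∀ i → P (π ⟨$⟩ʳ i) ≡ P i

        -- The value k stands d positions too far to the right. P is monotone and agrees at k and l,
        -- hence is constant in between, and every adjacent exchange on the way is allowed.
        moveDown : ∀ d k l π → toℕ l ≡ d ℕ.+ toℕ k → Fixes (toℕ k) π → PreservesP π → π ⟨$⟩ʳ l ≡ k → Q (π ⟨$⟩ʳ_) →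
                   Σ[ π′ ∈ Permutation′ n ] Fixes (suc (toℕ k)) π′ × PreservesP π′ × Q (π′ ⟨$⟩ʳ_)
        moveDown zero k l π l≡ fixes pres πl≡k q = π , fixes′ , pres , q
          where
          fixes′ : Fixes (suc (toℕ k)) π
          fixes′ i i< with ℕₚ.m≤n⇒m<n∨m≡n (ℕₚ.≤-pred i<)
          ... | inj₁ i<k = fixes i i<k
          ... | inj₂ i≡k = trans (cong (π ⟨$⟩ʳ_) (Finₚ.toℕ-injective (trans i≡k (sym l≡))))
              (trans πl≡k (Finₚ.toℕ-injective (sym i≡k)))
        moveDown (suc d) k l π l≡ fixes pres πl≡k q = moveDown d k l′ (Perm.transpose l′ l Perm.∘ₚ π) l′≡ fixes′ pres′
            (trans (cong (π ⟨$⟩ʳ_) (transpose-i l′ l)) πl≡k) (Q-swap (π ⟨$⟩ʳ_) l′ l adj Pl′≡Pl q)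
          where
          l′<n : d ℕ.+ toℕ k ℕ.< n
          l′<n = ℕₚ.<-trans ℕₚ.≤-refl (subst (ℕ._< n) l≡ (Finₚ.toℕ<n l))
          l′ = fromℕ< l′<n
          l′≡ : toℕ l′ ≡ d ℕ.+ toℕ k
          l′≡ = Finₚ.toℕ-fromℕ< l′<n
          adj : toℕ l ≡ suc (toℕ l′)
          adj = trans l≡ (cong suc (sym l′≡))
          k≤l′ : k Fin.≤ l′
          k≤l′ = subst (toℕ k ℕ.≤_) (sym l′≡) (ℕₚ.m≤n+m (toℕ k) d)
          l′≤l : l′ Fin.≤ l
          l′≤l = subst (toℕ l′ ℕ.≤_) (sym adj) (ℕₚ.n≤1+n _)
          Pl≡Pk : P l ≡ P k
          Pl≡Pk = trans (sym (pres l)) (cong P πl≡k)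
          Pl′≡Pl : P l′ ≡ P l
          Pl′≡Pl = ℕₚ.≤-antisym (P-mono l′ l l′≤l) (ℕₚ.≤-trans (ℕₚ.≤-reflexive Pl≡Pk) (P-mono k l′ k≤l′))
          fixes′ : Fixes (toℕ k) (Perm.transpose l′ l Perm.∘ₚ π)
          fixes′ i i<k = trans (cong (π ⟨$⟩ʳ_) (transpose-k l′ l (λ { refl → ℕₚ.<⇒≱ i<k k≤l′ })
              (λ { refl → ℕₚ.<⇒≱ i<k (ℕₚ.≤-trans k≤l′ l′≤l) }))) (fixes i i<k)
          pres′ : PreservesP (Perm.transpose l′ l Perm.∘ₚ π)
          pres′ i = trans (pres (PermC.transpose l′ l i)) (by-cases (i Fin.≟ l′) (i Fin.≟ l))
            where
            by-cases : Dec (i ≡ l′) → Dec (i ≡ l) → P (PermC.transpose l′ l i) ≡ P i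
            by-cases (yes refl) _ = trans (cong P (transpose-i l′ l)) (sym Pl′≡Pl)
            by-cases (no _) (yes refl) = trans (cong P (transpose-j l′ l)) Pl′≡Pl
            by-cases (no i≢l′) (no i≢l) = cong P (transpose-k l′ l i≢l′ i≢l)

        fixPrefix : ∀ k π → k ℕ.≤ n → PreservesP π → Q (π ⟨$⟩ʳ_) → Σ[ π′ ∈ Permutation′ n ] Fixes k π′ ×
            PreservesP π′ × Q (π′ ⟨$⟩ʳ_)
        fixPrefix zero π _ pres q = π , (λ _ ()) , pres , q
        fixPrefix (suc k) π k<n pres q with fixPrefix k π (ℕₚ.<⇒≤ k<n) pres q
        ... | π′ , fixes , pres′ , q′ = subst (λ k → Σ[ π′ ∈ Permutation′ n ] Fixes (suc k) π′ × PreservesP π′ ×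
            Q (π′ ⟨$⟩ʳ_)) k̂≡
                (moveDown (toℕ l ℕ.∸ toℕ k̂) k̂ l π′ (sym (ℕₚ.m∸n+n≡m k̂≤l))
                    (λ i i< → fixes i (subst (toℕ i ℕ.<_) k̂≡ i<)) pres′ (inverseʳ π′) q′)
          where
          k̂ = fromℕ< k<n
          k̂≡ : toℕ k̂ ≡ k
          k̂≡ = Finₚ.toℕ-fromℕ< k<n
          l = π′ ⟨$⟩ˡ k̂
          k̂≤l : k̂ Fin.≤ l
          k̂≤l = ℕₚ.≮⇒≥ λ l<k̂ → ℕₚ.<⇒≢ l<k̂
              (cong toℕ (trans (sym (fixes l (subst (toℕ l ℕ.<_) k̂≡ l<k̂))) (inverseʳ π′)))

      -- Writes a permutation that preserves P as a product of adjacent transpositions of equal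
      -- values, the form in which the generators of W_J will appear. Q stands for what has been
      -- reached so far.
      bubbleSort : ∀ π → (∀ i → P (π ⟨$⟩ʳ i) ≡ P i) → Q (π ⟨$⟩ʳ_) → Q (λ i → i)
      bubbleSort π pres q with fixPrefix n π ℕₚ.≤-refl pres q
      ... | π′ , fixes , _ , q′ = Q-resp (λ i → fixes i (Finₚ.toℕ<n i)) q′

open BubbleSort

-- The root poset, order filters and their minimal elements.

module RootPoset (m : ℕ) where
  open import Data.Integer using (_+_; _*_; -_; _-_)
  open Paths m
  open AffinePermutations m
  open Profiles m
  open Regions m
  open MinimalAlcoves m

  private
    n = suc m

  swap-i : ∀ α → swap m α (ri α) ≡ rj α
  swap-i α rewrite dec-true (ri α Fin.≟ ri α) refl = refl

  swap-j : ∀ α → swap m α (rj α) ≡ ri α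
  swap-j α rewrite dec-false (rj α Fin.≟ ri α) (λ eq → ℕₚ.<⇒≢ (root-< α) (cong toℕ (sym eq))) | dec-true
      (rj α Fin.≟ rj α) refl = refl

  swap-k : ∀ α {k} → k ≢ ri α → k ≢ rj α → swap m α k ≡ k
  swap-k α {k} k≢i k≢j rewrite dec-false (k Fin.≟ ri α) k≢i | dec-false (k Fin.≟ rj α) k≢j = refl

  swap-conjugate : (ρ : Permutation′ n) (α : PosRoot m) (i j : Fin n) → ri α ≡ ρ ⟨$⟩ʳ i → rj α ≡ ρ ⟨$⟩ʳ j →
                   ∀ k → ρ ⟨$⟩ʳ PermC.transpose i j k ≡ swap m α (ρ ⟨$⟩ʳ k)
  swap-conjugate ρ α i j ri≡ rj≡ k = by-cases (k Fin.≟ i) (k Fin.≟ j)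
    where
    by-cases : Dec (k ≡ i) → Dec (k ≡ j) → ρ ⟨$⟩ʳ PermC.transpose i j k ≡ swap m α (ρ ⟨$⟩ʳ k)
    by-cases (yes refl) _ = trans (cong (ρ ⟨$⟩ʳ_) (transpose-i k j))
        (trans (sym rj≡) (trans (sym (swap-i α)) (cong (swap m α) ri≡)))
    by-cases (no _) (yes refl) = trans (cong (ρ ⟨$⟩ʳ_) (transpose-j i k))
        (trans (sym ri≡) (trans (sym (swap-j α)) (cong (swap m α) rj≡)))
    by-cases (no k≢i) (no k≢j) = trans (cong (ρ ⟨$⟩ʳ_) (transpose-k i j k≢i k≢j))
      (sym (swap-k α (λ eq → k≢i (⟨$⟩ʳ-injective ρ (trans eq ri≡))) (λ eq → k≢j (⟨$⟩ʳ-injective ρ (trans eq rj≡)))))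

  applyRefls-++ : ∀ L L′ k → applyRefls m (L ++ L′) k ≡ applyRefls m L (applyRefls m L′ k)
  applyRefls-++ [] L′ k = refl
  applyRefls-++ (α ∷ L) L′ k = cong (swap m α) (applyRefls-++ L L′ k)

  private
    below : ℕ → Fin n → ℤ
    below t k with toℕ k ℕ.<? t
    ... | yes _ = + 1
    ... | no _ = + 0

    below-yes : ∀ {t k} → toℕ k ℕ.< t → below t k ≡ + 1
    below-yes {t} {k} lt with toℕ k ℕ.<? t
    ... | yes _ = refl
    ... | no ≮ = ⊥-elim (≮ lt)

    below-no : ∀ {t k} → t ℕ.≤ toℕ k → below t k ≡ + 0
    below-no {t} {k} le with toℕ k ℕ.<? t
    ... | yes lt = ⊥-elim (ℕₚ.<⇒≱ lt le)
    ... | no _ = refl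

    below-≥0 : ∀ t k → + 0 ℤ.≤ below t k
    below-≥0 t k with toℕ k ℕ.<? t
    ... | yes _ = ℤ.+≤+ z≤n
    ... | no _ = ℤₚ.≤-refl

    below-mono : ∀ t {i j} → i Fin.< j → below t j ℤ.≤ below t i
    below-mono t {i} {j} i<j with toℕ j ℕ.<? t
    ... | yes j<t = ℤₚ.≤-reflexive (sym (below-yes (ℕₚ.<-trans i<j j<t)))
    ... | no _ = below-≥0 t i

    -- The sum of the first t coordinates: up to a multiple of the total sum, the pairing with a
    -- fundamental coweight, hence not negative on positive roots.
    prefix : ℕ → (Fin n → ℤ) → ℤ
    prefix t v = sumℤ m (λ k → below t k * v k)

    prefix-root : ∀ t α → prefix t (rootVec m α) ≡ below t (ri α) - below t (rj α)
    prefix-root t α = begin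
      prefix t (rootVec m α) ≡⟨ sumℤ-cong (λ k → lemma (below t k) (ind (ri α) k) (ind (rj α) k)) ⟩
      sumℤ m (λ k → below t k * ind (ri α) k + - (below t k * ind (rj α) k))
          ≡⟨ sumℤ-+ (λ k → below t k * ind (ri α) k) (λ k → - (below t k * ind (rj α) k)) ⟩
      sumℤ m (λ k → below t k * ind (ri α) k) + sumℤ m (λ k → - (below t k * ind (rj α) k))
          ≡⟨ cong₂ _+_ (sumℤ-ind (ri α) (below t)) (trans (sumℤ-neg (λ k → below t k * ind (rj α) k))
          (cong -_ (sumℤ-ind (rj α) (below t)))) ⟩
      below t (ri α) - below t (rj α)                                                                            ∎
      where
      open ≡-Reasoning
      lemma : ∀ b x y → b * (x - y) ≡ b * x + - (b * y)
      lemma = solve-∀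

    prefix-rootSum : ∀ t L → + 0 ℤ.≤ prefix t (rootSum m L)
    prefix-rootSum t [] = ℤₚ.≤-reflexive
        (sym (trans (sumℤ-cong (λ k → ℤₚ.*-zeroʳ (below t k))) (trans (sumℤ-const (+ 0)) (ℤₚ.*-zeroʳ (+ n)))))
    prefix-rootSum t (α ∷ L) = subst (+ 0 ℤ.≤_) (sym eq) (ℤₚ.+-mono-≤ root≥0 (prefix-rootSum t L))
      where
      eq : prefix t (rootSum m (α ∷ L)) ≡ (below t (ri α) - below t (rj α)) + prefix t (rootSum m L)
      eq = trans (sumℤ-cong (λ k → ℤₚ.*-distribˡ-+ (below t k) (rootVec m α k) (rootSum m L k)))
             (trans (sumℤ-+ (λ k → below t k * rootVec m α k) (λ k → below t k * rootSum m L k))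
                 (cong (_+ prefix t (rootSum m L)) (prefix-root t α)))
      root≥0 : + 0 ℤ.≤ below t (ri α) - below t (rj α)
      root≥0 = ℤₚ.i≤j⇒0≤j-i (below-mono t (root-< α))

    RootLe⇒prefix : ∀ {α β} → RootLe m α β → ∀ t → below t (ri α) - below t (rj α) ℤ.≤ below t (ri β) - below t (rj β)
    RootLe⇒prefix {α} {β} (L , eq) t = ℤₚ.0≤i-j⇒j≤i (subst (+ 0 ℤ.≤_) eq′ (prefix-rootSum t L))
      where
      lemma : ∀ b x y → b * (x - y) ≡ b * x + - (b * y)
      lemma = solve-∀
      eq′ : prefix t (rootSum m L) ≡ (below t (ri β) - below t (rj β)) - (below t (ri α) - below t (rj α))
      eq′ = trans (sumℤ-cong (λ k → trans (cong (λ v → below t k * v) (eq k))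
          (lemma (below t k) (rootVec m β k) (rootVec m α k))))
              (trans (sumℤ-+ (λ k → below t k * rootVec m β k) (λ k → - (below t k * rootVec m α k)))
                (cong₂ _+_ (prefix-root t β) (trans (sumℤ-neg (λ k → below t k * rootVec m α k))
                    (cong -_ (prefix-root t α)))))

  -- Prefix sums are monotone in the root order, and that of e_i - e_j is 1 exactly for i < t ≤ j.
  -- The cuts t = i + 1 and t = j of the smaller root force the two containments.
  RootLe⇒nested : ∀ {α β} → RootLe m α β → ri β Fin.≤ ri α × rj α Fin.≤ rj β
  RootLe⇒nested {α} {β} le = ℕₚ.≮⇒≥ left , ℕₚ.≮⇒≥ right
    where
    i<j = root-< α
    1≰0 : ¬ (+ 1 ℤ.≤ + 0)
    1≰0 (ℤ.+≤+ ())
    left : ¬ (ri α Fin.< ri β)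
    left lt = 1≰0 (subst₂ ℤ._≤_ (cong₂ _-_ (below-yes {t} {ri α} ℕₚ.≤-refl) (below-no {t} {rj α} i<j))
                               (cong₂ _-_ (below-no {t} {ri β} lt)
                                   (below-no {t} {rj β} (ℕₚ.<⇒≤ (ℕₚ.≤-<-trans lt (root-< β)))))
                               (RootLe⇒prefix {α} {β} le t))
      where
      t = suc (toℕ (ri α))
    right : ¬ (rj β Fin.< rj α)
    right lt = 1≰0 (subst₂ ℤ._≤_ (cong₂ _-_ (below-yes {t} {ri α} i<j) (below-no {t} {rj α} ℕₚ.≤-refl))
                                (cong₂ _-_ (below-yes {t} {ri β} (ℕₚ.<-trans (root-< β) lt))
                                    (below-yes {t} {rj β} lt))
                                (RootLe⇒prefix {α} {β} le t))
      where
      t = toℕ (rj α)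

  private
    segment : ∀ i j → i Fin.≤ j → Σ[ L ∈ List (PosRoot m) ] ∀ k → rootSum m L k ≡ ind i k - ind j k
    segment i j i≤j with ℕₚ.m≤n⇒m<n∨m≡n i≤j
    ... | inj₁ i<j = root i j i<j ∷ [] , λ k → ℤₚ.+-identityʳ _
    ... | inj₂ eq = [] , λ k → sym (trans (cong (λ j → ind i k - ind j k) (Finₚ.toℕ-injective (sym eq)))
        (ℤₚ.+-inverseʳ (ind i k)))

    rootSum-++ : ∀ L L′ k → rootSum m (L ++ L′) k ≡ rootSum m L k + rootSum m L′ k
    rootSum-++ [] L′ k = sym (ℤₚ.+-identityˡ _)
    rootSum-++ (α ∷ L) L′ k = trans (cong (λ s → rootVec m α k + s) (rootSum-++ L L′ k))
        (sym (ℤₚ.+-assoc (rootVec m α k) (rootSum m L k) (rootSum m L′ k)))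

  -- The difference of the roots splits into one part at the left ends and one at the right ends,
  -- each a positive root or 0.
  nested⇒RootLe : ∀ {α β} → ri β Fin.≤ ri α → rj α Fin.≤ rj β → RootLe m α β
  nested⇒RootLe {α} {β} i≤ ≤j with segment (ri β) (ri α) i≤ | segment (rj α) (rj β) ≤j
  ... | L , eq | L′ , eq′ = L ++ L′ , λ k → trans (rootSum-++ L L′ k)
      (trans (cong₂ _+_ (eq k) (eq′ k)) (lemma (ind (ri α) k) (ind (rj α) k) (ind (ri β) k) (ind (rj β) k)))
    where
    lemma : ∀ ia ja ib jb → (ib - ia) + (ja - jb) ≡ (ib - jb) - (ia - ja)
    lemma = solve-∀

  module _ {A : Fin n → ℕ} (isProfile : IsProfile A) (τ : Permutation′ n)
           (τ-sorts : ∀ a b → a Fin.< b → key A (τ ⟨$⟩ʳ a) ℕ.< key A (τ ⟨$⟩ʳ b)) where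

    private
      lvl = level isProfile τ τ-sorts
      FarRoot = Far isProfile τ τ-sorts

    level-mono : ∀ {a b} → a Fin.≤ b → lvl a ℕ.≤ lvl b
    level-mono {a} {b} a≤b with ℕₚ.m≤n⇒m<n∨m≡n a≤b
    ... | inj₁ a<b = ℕₚ.<⇒≤ (τ-sorts a b a<b)
    ... | inj₂ eq = ℕₚ.≤-reflexive (cong lvl (Finₚ.toℕ-injective eq))

    level-mono⁻ : ∀ {a b} → lvl a ℕ.≤ lvl b → a Fin.≤ b
    level-mono⁻ {a} {b} le = ℕₚ.≮⇒≥ λ b<a → ℕₚ.<⇒≱ (τ-sorts b a b<a) le

    far-upward : ∀ {α β} → FarRoot α → RootLe m α β → FarRoot β
    far-upward {α} {β} far le = far-nested (RootLe⇒nested {α} {β} le)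
      where
      far-nested : ri β Fin.≤ ri α × rj α Fin.≤ rj β → FarRoot β
      far-nested (i≤ , ≤j) = ℕₚ.≤-<-trans (ℕₚ.+-monoʳ-≤ n (level-mono i≤)) (ℕₚ.<-≤-trans far (level-mono ≤j))

    module _ (J : PosRoot m → Bool) (J⇒far : ∀ α → J α ≡ true → FarRoot α) (far⇒J : ∀ α → FarRoot α → J α ≡ true) where

      far-isFilter : IsFilter m J
      far-isFilter α β Jα le = far⇒J β (far-upward {α} {β} (J⇒far α Jα) le)

      -- Levels of a far pair differ by at least n + 1, so no smaller far pair fits inside one where
      -- they differ by exactly n + 1.
      adjacent⇒ind : ∀ α → lvl (rj α) ≡ suc (n ℕ.+ lvl (ri α)) → IsInd m J α
      adjacent⇒ind α eq = far⇒J α (ℕₚ.≤-reflexive (sym eq)) , minimal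
        where
        minimal : ∀ β → J β ≡ true → RootLe m β α → ri β ≡ ri α × rj β ≡ rj α
        minimal β Jβ le = from-nested (RootLe⇒nested {β} {α} le)
          where
          far : FarRoot β
          far = J⇒far β Jβ
          from-nested : ri α Fin.≤ ri β × rj β Fin.≤ rj α → ri β ≡ ri α × rj β ≡ rj α
          from-nested (i≤ , ≤j) = Finₚ.≤-antisym
              (level-mono⁻ (ℕₚ.+-cancelˡ-≤ n _ _
              (ℕₚ.≤-pred (ℕₚ.≤-trans far (ℕₚ.≤-trans (level-mono ≤j) (ℕₚ.≤-reflexive eq)))))) i≤
                      , Finₚ.≤-antisym ≤j (level-mono⁻
                          (ℕₚ.≤-trans (ℕₚ.≤-reflexive eq) (ℕₚ.≤-trans (s≤s (ℕₚ.+-monoʳ-≤ n (level-mono i≤))) far)))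

      ind⇒adjacent : ∀ α → IsInd m J α → toℕ (τ ⟨$⟩ʳ rj α) ≡ suc (toℕ (τ ⟨$⟩ʳ ri α)) × A (τ ⟨$⟩ʳ rj α) ≡ suc
          (A (τ ⟨$⟩ʳ ri α))
      ind⇒adjacent α (Jα , minimal) = minimal-adjacent isProfile (J⇒far α Jα) minimal′
        where
        minimal′ : ∀ i′ j′ → lvl (ri α) ℕ.≤ key A i′ → key A j′ ℕ.≤ lvl (rj α) → n ℕ.+ key A i′ ℕ.< key A j′ →
            i′ ≡ τ ⟨$⟩ʳ ri α × j′ ≡ τ ⟨$⟩ʳ rj α
        minimal′ i′ j′ i≤ ≤j far = trans (sym (inverseʳ τ)) (cong (τ ⟨$⟩ʳ_) (proj₁ eqs)) , trans (sym (inverseʳ τ))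
            (cong (τ ⟨$⟩ʳ_) (proj₂ eqs))
          where
          key≡ : ∀ i → key A i ≡ lvl (τ ⟨$⟩ˡ i)
          key≡ i = cong (key A) (sym (inverseʳ τ))
          β : PosRoot m
          β = root (τ ⟨$⟩ˡ i′) (τ ⟨$⟩ˡ j′) (τ-reflects isProfile τ τ-sorts (ℕₚ.≤-<-trans (ℕₚ.m≤n+m _ n) far))
          eqs : ri β ≡ ri α × rj β ≡ rj α
          eqs = minimal β (far⇒J β (subst₂ (λ p q → n ℕ.+ p ℕ.< q) (key≡ i′) (key≡ j′) far))
                  (nested⇒RootLe {β} {α} (level-mono⁻ (subst (lvl (ri α) ℕ.≤_) (key≡ i′) i≤))
                      (level-mono⁻ (subst (ℕ._≤ lvl (rj α)) (key≡ j′) ≤j)))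

-- Parking functions, stable sorting and area vectors.

module ParkingFunctions (m : ℕ) where
  open import Data.Nat using (_+_; _*_; _≤_; _<_; _∸_)
  open Paths m
  open AffinePermutations m
  open Profiles m
  open StableElements m
  open MinimalAlcoves m

  private
    n = suc m

  consecutive⇒increasing : ∀ {g : Fin n → ℕ} → (∀ i j → toℕ j ≡ suc (toℕ i) → g i < g j) → ∀ i j → i Fin.< j →
      g i < g j
  consecutive⇒increasing {g} step i j i<j = go (toℕ j) i j refl i<j
    where
    go : ∀ k i j → toℕ j ≡ k → i Fin.< j → g i < g j
    go zero i j eq i<j with subst (toℕ i <_) eq i<j
    ... | ()
    go (suc k) i j eq i<j with predecessor j eq
    ... | j′ , j′≡ , j≡ with ℕₚ.m≤n⇒m<n∨m≡n (ℕₚ.≤-pred (subst (toℕ i <_) j≡ i<j))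
    ...   | inj₁ i<j′ = ℕₚ.<-trans (go k i j′ j′≡ i<j′) (step j′ j j≡)
    ...   | inj₂ i≡j′ = step i j (trans j≡ (cong suc (sym i≡j′)))

  module _ (f : Vec ℕ n) where

    -- Turns sorting by value, with ties broken by label, into strict sorting by an injective key.
    labelKey : Fin n → ℕ
    labelKey j = lookup f j * n + toℕ j

    IsStableSort : (Fin n → Fin n) → Set
    IsStableSort σ = ∀ i j → i Fin.< j → labelKey (σ i) < labelKey (σ j)

    stableSort : Σ[ σ ∈ Permutation′ n ] IsStableSort (σ ⟨$⟩ʳ_)
    stableSort = sortingPermutation labelKey
        (λ {i} {j} eq → proj₁ (lex-injective {lookup f i} {lookup f j} {i} {j} eq))

    -- The composite of ρ with the inverse of σ is strictly increasing, hence the identity.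
    stableSort-unique : ∀ (σ : Permutation′ n) (ρ : Fin n → Fin n) → IsStableSort (σ ⟨$⟩ʳ_) → IsStableSort ρ → ∀ i →
        ρ i ≡ σ ⟨$⟩ʳ i
    stableSort-unique σ ρ σ-sorts ρ-sorts i = trans (sym (inverseʳ σ))
        (cong (σ ⟨$⟩ʳ_) (increasing⇒id (λ i → σ ⟨$⟩ˡ ρ i) mono i))
      where
      mono : StrictlyIncreasing (λ i → σ ⟨$⟩ˡ ρ i)
      mono i j i<j with Finₚ.<-cmp (σ ⟨$⟩ˡ ρ i) (σ ⟨$⟩ˡ ρ j)
      ... | tri< lt _ _ = lt
      ... | tri≈ _ eq _ = ⊥-elim (ℕₚ.<⇒≢ (ρ-sorts i j i<j) (cong labelKey (⟨$⟩ˡ-injective σ eq)))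
      ... | tri> _ _ gt = ⊥-elim (ℕₚ.<-asym (ρ-sorts i j i<j) (subst₂ (λ a b → labelKey a < labelKey b) (inverseʳ σ)
          (inverseʳ σ) (σ-sorts _ _ gt)))

    Sorts Stable≡ : Permutation′ n → Set
    Sorts σ = ∀ k k′ → k Fin.< k′ → Pv m f σ k ≤ Pv m f σ k′
    Stable≡ σ = ∀ k k′ → k Fin.< k′ → Pv m f σ k ≡ Pv m f σ k′ → (σ ⟨$⟩ʳ k) Fin.< (σ ⟨$⟩ʳ k′)

    Sorts⇒mono : ∀ σ → Sorts σ → ∀ {i j} → i Fin.≤ j → Pv m f σ i ≤ Pv m f σ j
    Sorts⇒mono σ sorts {i} {j} i≤j with ℕₚ.m≤n⇒m<n∨m≡n i≤j
    ... | inj₁ i<j = sorts i j i<j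
    ... | inj₂ eq = ℕₚ.≤-reflexive (cong (Pv m f σ) (Finₚ.toℕ-injective eq))

    isStableSort⁺ : ∀ σ → Sorts σ → Stable≡ σ → IsStableSort (σ ⟨$⟩ʳ_)
    isStableSort⁺ σ sorts stable i j i<j with ℕₚ.m≤n⇒m<n∨m≡n (sorts i j i<j)
    ... | inj₁ lt = key-< (σ ⟨$⟩ʳ i) (σ ⟨$⟩ʳ j) lt
    ... | inj₂ eq = ℕₚ.+-mono-≤-< (ℕₚ.≤-reflexive (cong (_* n) eq)) (stable i j i<j eq)

    isStableSort⁻ : ∀ σ → IsStableSort (σ ⟨$⟩ʳ_) → Sorts σ × Stable≡ σ
    isStableSort⁻ σ σ-sorts = sorts , stable
      where
      sorts : Sorts σ
      sorts i j i<j with key-<⁻ (lookup f) {σ ⟨$⟩ʳ i} {σ ⟨$⟩ʳ j} (σ-sorts i j i<j)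
      ... | inj₁ lt = ℕₚ.<⇒≤ lt
      ... | inj₂ (eq , _) = ℕₚ.≤-reflexive eq
      stable : Stable≡ σ
      stable i j i<j eq with key-<⁻ (lookup f) {σ ⟨$⟩ʳ i} {σ ⟨$⟩ʳ j} (σ-sorts i j i<j)
      ... | inj₁ lt = ⊥-elim (ℕₚ.<⇒≢ lt eq)
      ... | inj₂ (_ , lt) = lt

    drw≡ : ∀ σ (τ : Permutation′ n) → word (area m f σ) ≡ tabulate (τ ⟨$⟩ʳ_) → drw m f σ ≡ permList m (τ Perm.∘ₚ σ)
    drw≡ σ τ eq = trans (sym (Listₚ.map-concatMap (σ ⟨$⟩ʳ_) (λ t → filter (λ k → area m f σ k ℕ.≟ t) (allFin n))
        (upTo n)))
                    (trans (cong (List.map (σ ⟨$⟩ʳ_)) eq) (Listₚ.map-tabulate (τ ⟨$⟩ʳ_) (σ ⟨$⟩ʳ_)))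

    module _ (f∈PF : IsPF m f) where

      -- The rational slope reduces to the classical condition: l - 1 labels below l are too few,
      -- because (n + 1) (l - 1) < n l for 1 ≤ l ≤ n.
      cnt-≥ : ∀ l → l ≤ n → l ≤ cnt< m f l
      cnt-≥ zero _ = z≤n
      cnt-≥ (suc l) l<n = ℕₚ.≮⇒≥ λ cnt<sl → ℕₚ.<⇒≱ (ℕₚ.≤-<-trans (ℕₚ.*-monoʳ-≤ (suc n) (ℕₚ.≤-pred cnt<sl)) lemma)
          (f∈PF (suc l) (s≤s z≤n) (ℕₚ.m≤n⇒m≤1+n l<n))
        where
        lemma : suc n * l < n * suc l
        lemma = subst (suc n * l <_) (sym (ℕₚ.*-suc n l)) (ℕₚ.+-monoˡ-< (n * l) l<n)

      module _ (σ : Permutation′ n) (sorts : Sorts σ) where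

        cnt-≤ : ∀ k → k < n → (∀ i → k ≤ toℕ i → k < Pv m f σ i) → cnt< m f (suc k) ≤ k
        cnt-≤ k k<n large = go (filter (λ i → lookup f i ℕ.<? suc k) (allFin n)) unique small
          where
          unique : AllPairs _≢_ (filter (λ i → lookup f i ℕ.<? suc k) (allFin n))
          unique = AllPairsₚ.filter⁺ (λ i → lookup f i ℕ.<? suc k) (AllPairsₚ.tabulate⁺ λ i≢j → i≢j)
          small : ∀ {j} → j ∈ filter (λ i → lookup f i ℕ.<? suc k) (allFin n) → toℕ (σ ⟨$⟩ˡ j) < k
          small {j} j∈ = ℕₚ.≰⇒> λ k≤ → ℕₚ.<⇒≱ (subst (λ j → k < lookup f j) (inverseʳ σ) (large (σ ⟨$⟩ˡ j) k≤))
              (ℕₚ.≤-pred (proj₂ (∈ₚ.∈-filter⁻ (λ i → lookup f i ℕ.<? suc k) {xs = allFin n} j∈)))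
          go : ∀ xs → AllPairs _≢_ xs → (∀ {j} → j ∈ xs → toℕ (σ ⟨$⟩ˡ j) < k) → length xs ≤ k
          go xs xs! small = Finₚ.injective⇒≤ {f = h} h-injective
            where
            h : Fin (length xs) → Fin k
            h i = fromℕ< (small (∈ₚ.∈-lookup i))
            lookup-injective : ∀ {xs : List (Fin n)} → AllPairs _≢_ xs → ∀ i j → List.lookup xs i ≡ List.lookup xs j →
                i ≡ j
            lookup-injective (x∉ ∷ xs!) Fin.zero Fin.zero _ = refl
            lookup-injective (x∉ ∷ xs!) Fin.zero (Fin.suc j) eq = ⊥-elim (All.lookup x∉ (∈ₚ.∈-lookup j) eq)
            lookup-injective (x∉ ∷ xs!) (Fin.suc i) Fin.zero eq = ⊥-elim (All.lookup x∉ (∈ₚ.∈-lookup i) (sym eq))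
            lookup-injective (x∉ ∷ xs!) (Fin.suc i) (Fin.suc j) eq = cong Fin.suc (lookup-injective xs! i j eq)
            h-injective : ∀ {i j} → h i ≡ h j → i ≡ j
            h-injective {i} {j} eq = lookup-injective xs! i j
                (⟨$⟩ˡ-injective σ (Finₚ.toℕ-injective (Finₚ.fromℕ<-injective _ _ (small (∈ₚ.∈-lookup i))
                (small (∈ₚ.∈-lookup j)) eq)))

        -- Otherwise all sorted values from position k on exceed k, which leaves at most k labels
        -- with value below k + 1. The bound makes the truncated subtraction in `area` exact.
        Pv-≤ : ∀ k → Pv m f σ k ≤ toℕ k
        Pv-≤ k = ℕₚ.≮⇒≥ λ k<P → ℕₚ.<⇒≱ ℕₚ.≤-refl (ℕₚ.≤-trans (cnt-≥ (suc (toℕ k)) (Finₚ.toℕ<n k))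
            (cnt-≤ (toℕ k) (Finₚ.toℕ<n k) λ i k≤i → ℕₚ.<-≤-trans k<P (Sorts⇒mono σ sorts k≤i)))

        Pv+area : ∀ k → Pv m f σ k + area m f σ k ≡ toℕ k
        Pv+area k = ℕₚ.m+[n∸m]≡n (Pv-≤ k)

        area-profile : IsProfile (area m f σ)
        area-profile = record
          { zero≡ = ℕₚ.0∸n≡0 (Pv m f σ Fin.zero)
          ; step≤ = λ i j eq → ℕₚ.≤-trans (ℕₚ.≤-reflexive (cong (_∸ Pv m f σ j) eq))
              (ℕₚ.≤-trans (ℕₚ.∸-monoʳ-≤ (suc (toℕ i)) (sorts i j (ℕₚ.≤-reflexive (sym eq))))
                  (ℕₚ.≤-reflexive (ℕₚ.+-∸-assoc 1 (Pv-≤ i))))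
          }

        lookup-<n : ∀ j → lookup f j < n
        lookup-<n j = subst (λ j → lookup f j < n) (inverseʳ σ) (ℕₚ.≤-<-trans (Pv-≤ (σ ⟨$⟩ˡ j)) (Finₚ.toℕ<n _))

        level-step⇒Pv≡ : ∀ i j → toℕ j ≡ suc (toℕ i) → area m f σ j ≡ suc (area m f σ i) → Pv m f σ i ≡ Pv m f σ j
        level-step⇒Pv≡ i j eq eq′ = ℕₚ.+-cancelʳ-≡ (suc (area m f σ i)) _ _
            (trans (ℕₚ.+-suc _ _) (trans (cong suc (Pv+area i))
            (trans (sym eq) (trans (sym (Pv+area j)) (cong (λ a → Pv m f σ j + a) eq′)))))

        Pv≡⇒level-step : ∀ i j → toℕ j ≡ suc (toℕ i) → Pv m f σ i ≡ Pv m f σ j → area m f σ j ≡ suc (area m f σ i)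
        Pv≡⇒level-step i j eq eq′ = ℕₚ.+-cancelˡ-≡ (Pv m f σ i) _ _ (trans (cong (_+ area m f σ j) eq′)
            (trans (Pv+area j) (trans eq (trans (cong suc (sym (Pv+area i))) (sym (ℕₚ.+-suc _ _))))))

        -- For a shift r ≠ 0 there would be at least r labels with f < r and at least n + 1 - r labels with f ≥ r.
        coset-unique : ∀ {A} → IsProfile A → (ρ : Permutation′ n) (d : ℤ) →
                       (∀ i → Σ[ t ∈ ℤ ] + lookup f (ρ ⟨$⟩ʳ i) ≡ (+ (toℕ i ∸ A i) ℤ.+ d) ℤ.+ + suc n ℤ.* t) →
                       ∀ i → lookup f (ρ ⟨$⟩ʳ i) ≡ toℕ i ∸ A i
        coset-unique {A} isProfile ρ d congruent = λ i →
            trans (match i (ℕₚ.≤-<-trans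
            (ℕₚ.≤-reflexive (trans (cong (λ r → toℕ i ∸ A i + r) r≡0) (ℕₚ.+-identityʳ _)))
            (ℕₚ.≤-<-trans (ℕₚ.m∸n≤m (toℕ i) (A i)) (ℕₚ.m≤n⇒m≤1+n (Finₚ.toℕ<n i)))))
                                                          (trans (cong (λ r → toℕ i ∸ A i + r) r≡0)
                                                              (ℕₚ.+-identityʳ _))
          where
          -- Division with remainder again, now modulo n + 1.
          module Residue = AffinePermutations (suc m)
          r : ℕ
          r = d ℤ.%ℕ suc n
          r<1+n : r < suc n
          r<1+n = n%ℕd<d d (suc n)
          residue-unique : ∀ {a b t} → a < suc n → b < suc n → + a ≡ + b ℤ.+ + suc n ℤ.* t → a ≡ b
          residue-unique {a} {b} {t} a< b< eq = trans (sym (Finₚ.toℕ-fromℕ< a<))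
              (trans (cong toℕ (proj₁ (Residue.pk-inj {fromℕ< a<} {fromℕ< b<} {+ 0} {t}
              (trans (Residue.pk-def _ _) (trans (cong₂ ℤ._+_ (cong +_ (Finₚ.toℕ-fromℕ< a<)) (ℤₚ.*-zeroʳ (+ suc n)))
                  (trans (ℤₚ.+-identityʳ _)
                  (trans eq (trans (cong (λ b → + b ℤ.+ + suc n ℤ.* t) (sym (Finₚ.toℕ-fromℕ< b<)))
                  (sym (Residue.pk-def _ _)))))))))) (Finₚ.toℕ-fromℕ< b<))
          -- While the shift by r does not wrap around, both sides are reduced residues modulo n +
          -- 1, and congruence becomes equality.
          match : ∀ i → toℕ i ∸ A i + r < suc n → lookup f (ρ ⟨$⟩ʳ i) ≡ toℕ i ∸ A i + r
          match i bound = residue-unique {t = (d ℤ./ℕ suc n) ℤ.+ proj₁ (congruent i)}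
              (ℕₚ.m≤n⇒m≤1+n (lookup-<n (ρ ⟨$⟩ʳ i))) bound
              (trans (proj₂ (congruent i))
                  (trans (cong (λ d → (+ (toℕ i ∸ A i) ℤ.+ d) ℤ.+ + suc n ℤ.* proj₁ (congruent i)) d≡)
                (trans (lemma (+ (toℕ i ∸ A i)) (+ r) (+ suc n) (d ℤ./ℕ suc n) (proj₁ (congruent i)))
                    (cong (λ c → c ℤ.+ + suc n ℤ.* ((d ℤ./ℕ suc n) ℤ.+ proj₁ (congruent i)))
                    (sym (ℤₚ.pos-+ (toℕ i ∸ A i) r))))))
            where
            d≡ : d ≡ + r ℤ.+ + suc n ℤ.* (d ℤ./ℕ suc n)
            d≡ = trans (Residue.divMod d) (trans (Residue.pk-def _ _) (cong (λ c → + c ℤ.+ + suc n ℤ.* (d ℤ./ℕ suc n))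
                (Finₚ.toℕ-fromℕ< (n%ℕd<d d (suc n)))))
            lemma : ∀ p r N q t → (p ℤ.+ (r ℤ.+ N ℤ.* q)) ℤ.+ N ℤ.* t ≡ (p ℤ.+ r) ℤ.+ N ℤ.* (q ℤ.+ t)
            lemma = solve-∀
          collision : 1 ≤ r → ⊥
          collision 1≤r = ℕₚ.1+n≰n (Finₚ.injective⇒≤ {f = h} h-injective)
            where
            shift-< : ∀ (k : Fin (suc n)) → r ≤ toℕ k → toℕ k ∸ r < n
            shift-< k r≤k = ℕₚ.<-≤-trans (ℕₚ.∸-monoʳ-< 1≤r r≤k) (ℕₚ.≤-pred (Finₚ.toℕ<n k))
            image : (k : Fin (suc n)) → (toℕ k < r) ⊎ (r ≤ toℕ k) → Fin n
            image k (inj₁ k<r) = σ ⟨$⟩ʳ fromℕ< (ℕₚ.<-≤-trans k<r (ℕₚ.≤-pred r<1+n))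
            image k (inj₂ r≤k) = ρ ⟨$⟩ʳ fromℕ< (shift-< k r≤k)
            image-low : ∀ k k<r → lookup f (image k (inj₁ k<r)) < r
            image-low k k<r = ℕₚ.≤-<-trans
                (ℕₚ.≤-trans (Pv-≤ (fromℕ< _)) (ℕₚ.≤-reflexive (Finₚ.toℕ-fromℕ< (ℕₚ.<-≤-trans k<r (ℕₚ.≤-pred r<1+n)))))
                k<r
            image-high : ∀ k r≤k → r ≤ lookup f (image k (inj₂ r≤k))
            image-high k r≤k = subst (r ≤_) (sym (match i bound)) (ℕₚ.m≤n+m r (toℕ i ∸ A i))
              where
              i = fromℕ< (shift-< k r≤k)
              bound : toℕ i ∸ A i + r < suc n
              bound = ℕₚ.≤-<-trans (ℕₚ.+-monoˡ-≤ r (ℕₚ.≤-trans (ℕₚ.m∸n≤m (toℕ i) (A i))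
                  (ℕₚ.≤-reflexive (Finₚ.toℕ-fromℕ< (shift-< k r≤k)))))
                        (subst (_< suc n) (sym (ℕₚ.m∸n+n≡m r≤k)) (Finₚ.toℕ<n k))
            h : Fin (suc n) → Fin n
            h k = image k (ℕₚ.<-≤-connex (toℕ k) r)
            image-injective : ∀ k l c c′ → image k c ≡ image l c′ → k ≡ l
            image-injective k l (inj₁ k<r) (inj₁ l<r) eq = Finₚ.toℕ-injective
                (Finₚ.fromℕ<-injective _ _ _ _ (⟨$⟩ʳ-injective σ eq))
            image-injective k l (inj₁ k<r) (inj₂ r≤l) eq =
                ⊥-elim (ℕₚ.<⇒≱ (image-low k k<r) (subst (λ j → r ≤ lookup f j) (sym eq) (image-high l r≤l)))
            image-injective k l (inj₂ r≤k) (inj₁ l<r) eq =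
                ⊥-elim (ℕₚ.<⇒≱ (image-low l l<r) (subst (λ j → r ≤ lookup f j) eq (image-high k r≤k)))
            image-injective k l (inj₂ r≤k) (inj₂ r≤l) eq = Finₚ.toℕ-injective
                (ℕₚ.∸-cancelʳ-≡ r≤k r≤l (Finₚ.fromℕ<-injective _ _ (shift-< k r≤k) (shift-< l r≤l)
                (⟨$⟩ʳ-injective ρ eq)))
            h-injective : ∀ {k l} → h k ≡ h l → k ≡ l
            h-injective {k} {l} = image-injective k l (ℕₚ.<-≤-connex (toℕ k) r) (ℕₚ.<-≤-connex (toℕ l) r)
          r≡0 : r ≡ 0
          r≡0 = ℕₚ.n<1⇒n≡0 (ℕₚ.≰⇒> collision)

      -- Where A rises by 1 the value i - A i repeats and the tie condition orders the labels;
      -- everywhere else the value increases.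
      profile⇒stableSort : ∀ {A} → IsProfile A → (ρ : Fin n → Fin n) → (∀ i → lookup f (ρ i) ≡ toℕ i ∸ A i) →
          IsTieBreaking A ρ → IsStableSort ρ
      profile⇒stableSort {A} isProfile ρ f≡ tie = consecutive⇒increasing {labelKey ∘ ρ} step
        where
        P≡ : ∀ i → lookup f (ρ i) + A i ≡ toℕ i
        P≡ i = trans (cong (_+ A i) (f≡ i)) (ℕₚ.m∸n+n≡m (profile-≤ isProfile i))
        step : ∀ i j → toℕ j ≡ suc (toℕ i) → labelKey (ρ i) < labelKey (ρ j)
        step i j j≡ with ℕₚ.m≤n⇒m<n∨m≡n (IsProfile.step≤ isProfile i j j≡)
        ... | inj₁ lt = key-< (ρ i) (ρ j) (ℕₚ.+-cancelʳ-< (A i) _ _ (subst (_< lookup f (ρ j) + A i) (sym (P≡ i))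
                (ℕₚ.≤-trans (ℕₚ.≤-reflexive (trans (sym j≡) (sym (P≡ j))))
                    (ℕₚ.+-monoʳ-≤ (lookup f (ρ j)) (ℕₚ.≤-pred lt)))))
        ... | inj₂ eq = ℕₚ.+-mono-≤-< (ℕₚ.≤-reflexive (cong (_* n) P≡′)) (tie i j j≡ eq)
          where
          P≡′ : lookup f (ρ i) ≡ lookup f (ρ j)
          P≡′ = ℕₚ.+-cancelʳ-≡ (suc (A i)) _ _
              (trans (ℕₚ.+-suc _ _) (trans (cong suc (P≡ i))
              (trans (sym j≡) (trans (sym (P≡ j)) (cong (λ a → lookup f (ρ j) + a) eq)))))

-- The map A_GMV and the equality with δ.

module AffineParking (m : ℕ) where
  open import Data.Integer using (_+_; _*_; -_; _-_; _<_; _≤_)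
  open import Data.Nat using (_∸_)
  open Paths m
  open AffinePermutations m
  open Alcoves m
  open Profiles m
  open Regions m
  open StableElements m
  open MinimalAlcoves m
  open ParkingFunctions m

  private
    n = suc m

  aff-positive⁻ : ∀ {a : Fin n} {k} → + 0 < + suc (toℕ a) + + n * k → + 0 ≤ k
  aff-positive⁻ {a} {k} lt = pk-≤⁻ {Fin.zero} {a}
      (ℤ-suc-≤-via lt (trans (pk-def a k)
      (trans (lemma (+ toℕ a) (+ n) k) (cong (λ c → c + (+ suc (toℕ a) + + n * k - (+ 1 + + 0)))
      (sym (pk-def Fin.zero (+ 0)))))))
    where
    lemma : ∀ a n k → a + n * k ≡ (+ 0 + n * + 0) + (+ 1 + a + n * k - (+ 1 + + 0))
    lemma = solve-∀

  aff-positive⁺ : ∀ {a : Fin n} {k} → + 0 ≤ k → + 0 < + suc (toℕ a) + + n * k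
  aff-positive⁺ {a} {+ k} _ = ℤₚ.<-≤-trans (ℤ.+<+ (s≤s z≤n))
      (ℤ-≤-via (ℤₚ.*-monoˡ-≤-nonNeg (+ n) {+ 0} {+ k} (ℤ.+≤+ z≤n)) (lemma (+ suc (toℕ a)) (+ n) (+ k)))
    where
    lemma : ∀ a n k → a + n * k ≡ a + (n * k - n * + 0)
    lemma = solve-∀

  -- The integers with positive image are 1 + `place w a` + n k with k ≥ 0, so their minimum belongs
  -- to the least place.
  minΔ⇒least : ∀ w M′ → IsMinΔ m w M′ → Σ[ a₀ ∈ Fin n ] M′ ≡ + 1 + place w a₀ × (∀ a → place w a₀ ≤ place w a)
  minΔ⇒least w M′ (M′>0 , least) = a₀ , M′≡ , λ a → ℤ-≤-via (least≤ a) (trans (lemma₂ (place w a) (place w a₀))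
      (cong (λ c → place w a₀ + (+ 1 + place w a - c)) (sym M′≡)))
    where
    sur = place-surjective w (M′ - + 1)
    a₀ = proj₁ sur
    k = proj₁ (proj₂ sur)
    lemma₀ : ∀ M → M ≡ + 1 + (M - + 1)
    lemma₀ = solve-∀
    lemma₁ : ∀ p n → + 1 + p ≡ + 1 + (p + n * + 0)
    lemma₁ = solve-∀
    lemma₂ : ∀ p q → p ≡ q + (+ 1 + p - (+ 1 + q))
    lemma₂ = solve-∀
    M′≡′ : M′ ≡ + 1 + (place w a₀ + + n * k)
    M′≡′ = trans (lemma₀ M′) (cong (λ z → + 1 + z) (proj₂ (proj₂ sur)))
    k≥0 : + 0 ≤ k
    k≥0 = aff-positive⁻ {a₀} (subst (+ 0 <_) (trans (cong (aff m w) M′≡′) (aff-place w a₀ k)) M′>0)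
    least≤ : ∀ a → M′ ≤ + 1 + place w a
    least≤ a = least (+ 1 + place w a)
        (subst (+ 0 <_) (sym (trans (cong (aff m w) (lemma₁ (place w a) (+ n))) (aff-place w a (+ 0))))
        (aff-positive⁺ {a} ℤₚ.≤-refl))
    k≤0 : k ≤ + 0
    k≤0 = ℤₚ.*-cancelˡ-≤-pos k (+ 0) (+ n)
        (ℤ-≤-via (least≤ a₀) (trans (lemma₃ (place w a₀) (+ n) k) (cong (λ M → + n * k + (+ 1 + place w a₀ - M))
        (sym M′≡′))))
      where
      lemma₃ : ∀ p n k → n * + 0 ≡ n * k + (+ 1 + p - (+ 1 + (p + n * k)))
      lemma₃ = solve-∀
    M′≡ : M′ ≡ + 1 + place w a₀
    M′≡ = trans M′≡′ (trans (cong (λ k → + 1 + (place w a₀ + + n * k)) (ℤₚ.≤-antisym k≤0 k≥0))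
        (sym (lemma₁ (place w a₀) (+ n))))

  module _ (w : Aff m) (M : ℤ) {A : Fin n → ℕ} (isProfile : IsProfile A) (ρ : Permutation′ n)
           (place-ρ : ∀ i → place w (ρ ⟨$⟩ʳ i) ≡ M + + key A i) where

    private
      P : Fin n → ℕ
      P i = toℕ i ∸ A i

      P+A : ∀ i → + P i + + A i ≡ + toℕ i
      P+A i = trans (sym (ℤₚ.pos-+ (P i) (A i))) (cong +_ (ℕₚ.m∸n+n≡m (profile-≤ isProfile i)))

      -- Substituting P i + A i for i completes the key of i and leaves a multiple of n. Row i thus
      -- consists of periodic shifts of the place of label ρ i, by P i - 1 - x periods, and the sign
      -- of the image changes at x = P i.
      cell : ∀ i x → aff m w (lfun m x (+ toℕ i) + (+ 1 + M)) ≡ + suc (toℕ (ρ ⟨$⟩ʳ i)) + + n * (+ P i - + 1 - x)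
      cell i x = trans (cong (aff m w) (begin
        lfun m x (+ toℕ i) + (+ 1 + M) ≡⟨ cong (λ c → - + n - + n * x + + suc n * c + (+ 1 + M)) (P+A i) ⟨
        - + n - + n * x + + suc n * (+ P i + + A i) + (+ 1 + M) ≡⟨ lemma (+ n) x (+ P i) (+ A i) M ⟩
        + 1 + (M + ((+ P i + + A i) + + n * + A i) + + n * (+ P i - + 1 - x))
            ≡⟨ cong (λ c → + 1 + (M + (c + + n * + A i) + + n * (+ P i - + 1 - x))) (P+A i) ⟩
        + 1 + (M + (+ toℕ i + + n * + A i) + + n * (+ P i - + 1 - x))
            ≡⟨ cong (λ c → + 1 + (c + + n * (+ P i - + 1 - x)))
            (trans (place-ρ i) (cong (λ p → M + p) (trans (key≡pk A i) (pk-def i (+ A i))))) ⟨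
        + 1 + (place w (ρ ⟨$⟩ʳ i) + + n * (+ P i - + 1 - x))                                                ∎))
        (aff-place w (ρ ⟨$⟩ʳ i) (+ P i - + 1 - x))
        where
        open ≡-Reasoning
        lemma : ∀ n x p a M → - n - n * x + (+ 1 + n) * (p + a) + (+ 1 + M) ≡ + 1 +
            (M + ((p + a) + n * a) + n * (p - + 1 - x))
        lemma = solve-∀

    profile-minΔ : IsMinΔ m w (+ 1 + M)
    profile-minΔ = subst (+ 0 <_) (sym aff≡) (aff-positive⁺ {ρ ⟨$⟩ʳ Fin.zero} ℤₚ.≤-refl) , least
      where
      aff≡ : aff m w (+ 1 + M) ≡ + suc (toℕ (ρ ⟨$⟩ʳ Fin.zero)) + + n * + 0
      aff≡ = trans (cong (aff m w)
          (trans (lemma M (+ n)) (cong (λ p → + 1 + (p + + n * + 0))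
          (sym (trans (place-ρ Fin.zero) (cong (λ a → M + + (a ℕ.* n ℕ.+ 0)) (IsProfile.zero≡ isProfile)))))))
          (aff-place w (ρ ⟨$⟩ʳ Fin.zero) (+ 0))
        where
        lemma : ∀ M n → + 1 + M ≡ + 1 + (M + + 0 + n * + 0)
        lemma = solve-∀
      least : ∀ z → + 0 < aff m w z → + 1 + M ≤ z
      least z 0<z = ℤ-≤-via (ℤₚ.+-mono-≤ (ℤ.+≤+ {0} {key A i} z≤n) (ℤₚ.*-monoˡ-≤-nonNeg (+ n) k≥0))
          (trans z≡ (trans (cong (λ p → + 1 + (p + + n * k)) place≡) (lemma₁ M (+ key A i) (+ n) k)))
        where
        sur = place-surjective w (z - + 1)
        a = proj₁ sur
        k = proj₁ (proj₂ sur)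
        i = ρ ⟨$⟩ˡ a
        lemma₀ : ∀ M → M ≡ + 1 + (M - + 1)
        lemma₀ = solve-∀
        lemma₁ : ∀ M q n k → + 1 + (M + q + n * k) ≡ + 1 + M + (q + n * k - (+ 0 + n * + 0))
        lemma₁ = solve-∀
        z≡ : z ≡ + 1 + (place w a + + n * k)
        z≡ = trans (lemma₀ z) (cong (λ z → + 1 + z) (proj₂ (proj₂ sur)))
        place≡ : place w a ≡ M + + key A i
        place≡ = trans (cong (place w) (sym (inverseʳ ρ))) (place-ρ i)
        k≥0 : + 0 ≤ k
        k≥0 = aff-positive⁻ {a} (subst (+ 0 <_) (trans (cong (aff m w) z≡) (aff-place w a k)) 0<z)

    profile-Pg : ∀ i → Pg m w (+ 1 + M) i ≡ toℕ i ∸ A i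
    profile-Pg i = length-filter-upTo (λ x → + 0 ℤ.<? aff m w (lfun m (+ x) (+ toℕ i) + (+ 1 + M))) (suc n)
        (ℕₚ.≤-trans (ℕₚ.m∸n≤m (toℕ i) (A i)) (ℕₚ.m≤n⇒m≤1+n (ℕₚ.<⇒≤ (Finₚ.toℕ<n i))))
        (λ x _ pos → ℤₚ.drop‿+<+ (ℤ-<-via
            (ℤₚ.≤-<-trans (aff-positive⁻ {ρ ⟨$⟩ʳ i} {+ P i - + 1 - + x} (subst (+ 0 <_) (cell i (+ x)) pos))
            (ℤ-<-via (ℤ.+<+ {0} {1} (s≤s z≤n)) (lemma₁ (+ P i - + 1 - + x)))) (lemma₂ (+ P i) (+ x))))
        (λ x x<P → subst (+ 0 <_) (sym (cell i (+ x)))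
            (aff-positive⁺ {ρ ⟨$⟩ʳ i} (ℤ-suc-≤-via (ℤ.+<+ x<P) (lemma₃ (+ P i) (+ x)))))
      where
      lemma₁ : ∀ a → a + + 1 ≡ a + (+ 1 - + 0)
      lemma₁ = solve-∀
      lemma₂ : ∀ p x → p ≡ x + (p - + 1 - x + + 1 - + 0)
      lemma₂ = solve-∀
      lemma₃ : ∀ p x → p - + 1 - x ≡ + 0 + (p - (+ 1 + x))
      lemma₃ = solve-∀

    -- In the last positive cell, x = P i - 1, the number of periods is 0 and the bare label
    -- appears.
    profile-σg : ∀ i → σg m w (+ 1 + M) i ≡ + suc (toℕ (ρ ⟨$⟩ʳ i))
    profile-σg i = trans (cong (λ p → aff m w (lfun m (+ p - + 1) (+ toℕ i) + (+ 1 + M))) (profile-Pg i))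
      (trans (cell i (+ P i - + 1)) (lemma (+ suc (toℕ (ρ ⟨$⟩ʳ i))) (+ n) (+ P i)))
      where
      lemma : ∀ a n p → a + n * (p - + 1 - (p - + 1)) ≡ a
      lemma = solve-∀

  module _ (f : Vec ℕ n) (f∈PF : IsPF m f) (σ : Permutation′ n) (sorts : Sorts f σ) (stable≡ : Stable≡ f σ) where

    private
      A = area m f σ
      isProfile : IsProfile A
      isProfile = area-profile f f∈PF σ sorts
      A<n : ∀ i → A i ℕ.< n
      A<n = profile-<n isProfile

    area-tie : IsTieBreaking A (σ ⟨$⟩ʳ_)
    area-tie i j eq eq′ = stable≡ i j (ℕₚ.≤-reflexive (sym eq)) (level-step⇒Pv≡ f f∈PF σ sorts i j eq eq′)

    readingOrder : Σ[ τ ∈ Permutation′ n ] ∀ a b → a Fin.< b → key A (τ ⟨$⟩ʳ a) ℕ.< key A (τ ⟨$⟩ʳ b)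
    readingOrder = sortingPermutation (key A) (λ {i} {j} eq → proj₁ (lex-injective {A i} {A j} {i} {j} eq))

    drw-readingOrder : ∀ τ → (∀ a b → a Fin.< b → key A (τ ⟨$⟩ʳ a) ℕ.< key A (τ ⟨$⟩ʳ b)) → (drw m f σ , zetaH m f σ) ≡
        (permList m (τ Perm.∘ₚ σ) , dyck A)
    drw-readingOrder τ τ-sorts = cong (_, dyck A) (drw≡ f σ τ (word≡tabulate A A<n τ τ-sorts))

    -- The labelled path is itself the preimage: label σ i is put at the place given by the key of
    -- i.
    AGMV-surjective : Σ[ w ∈ Aff m ] InSn1 m w × AGMV m w f
    AGMV-surjective = w , stable⇒InSn1 w (profile⇒stable w M σ isProfile place-σ area-tie) , + 1 + M ,
        profile-minΔ w M isProfile σ place-σ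
      , λ i → σ ⟨$⟩ʳ i , profile-σg w M isProfile σ place-σ i
            , sym (trans (profile-Pg w M isProfile σ place-σ i) (ℕₚ.m∸[m∸n]≡n (Pv-≤ f f∈PF σ sorts i)))
      where
      w,eq = fromProfile A (Perm.flip σ)
      w = proj₁ w,eq
      M = - sumℤ m (λ i → + A i)
      place-σ : ∀ i → place w (σ ⟨$⟩ʳ i) ≡ M + + key A i
      place-σ i = trans (proj₂ w,eq (σ ⟨$⟩ʳ i)) (cong (λ i → M + + key A i) (inverseˡ σ))

    -- By stability w has a profile and labels of its own. Its cell counts are the values of f at
    -- these labels, so the labels form a stable sort of f, which is unique, and the values return
    -- the profile.
    AGMV⇒place : ∀ w → InSn1 m w → AGMV m w f → Σ[ M ∈ ℤ ] ∀ i → place w (σ ⟨$⟩ʳ i) ≡ M + + key A i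
    AGMV⇒place w w∈ (M′ , minΔ , labels) = from-least (minΔ⇒least w M′ minΔ)
      where
      from-least : Σ[ a₀ ∈ Fin n ] M′ ≡ + 1 + place w a₀ × (∀ a → place w a₀ ≤ place w a) → Σ[ M ∈ ℤ ] ∀ i →
          place w (σ ⟨$⟩ʳ i) ≡ M + + key A i
      from-least (a₀ , refl , least) = M , λ i → trans (cong (place w) (sym (ρ≡σ i)))
          (trans (C.place-ρ i) (cong (λ a → M + + (a ℕ.* n ℕ.+ toℕ i)) (A≡ i)))
        where
        M = place w a₀
        module C = Config (config w a₀ (InSn1⇒stable w w∈) least)
        label : ∀ i → lookup f (C.ρ ⟨$⟩ʳ i) ≡ toℕ i ∸ C.A i
        label i with labels i
        ... | j , σg≡ , f≡ = trans
            (cong (lookup f) (Finₚ.toℕ-injective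
            (ℕₚ.suc-injective (ℤₚ.+-injective (trans (sym (profile-σg w M C.profile C.ρ C.place-ρ i)) σg≡)))))
                               (trans f≡ (profile-Pg w M C.profile C.ρ C.place-ρ i))
        ρ≡σ : ∀ i → C.ρ ⟨$⟩ʳ i ≡ σ ⟨$⟩ʳ i
        ρ≡σ = stableSort-unique f σ (C.ρ ⟨$⟩ʳ_) (isStableSort⁺ f σ sorts stable≡) (profile⇒stableSort f f∈PF C.profile
            (C.ρ ⟨$⟩ʳ_) label C.tie)
        A≡ : ∀ i → C.A i ≡ A i
        A≡ i = sym (trans (cong (λ p → toℕ i ∸ p) (trans (cong (lookup f) (sym (ρ≡σ i))) (label i)))
            (ℕₚ.m∸[m∸n]≡n (profile-≤ C.profile i)))

    -- The permutation u lists the labels by increasing place, so its inverse moves the alcove into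
    -- the dominant chamber. There the gaps between keys put it in `region`, whose far pairs are the
    -- boxes above the zeta path.
    AGMV⇒Delta : ∀ w → InSn1 m w → AGMV m w f → Delta m w (drw m f σ , zetaH m f σ)
    AGMV⇒Delta w w∈ agmv = u , (λ x x∈A → region⇒C isProfile τ τ-sorts _ (image∈ x x∈A))
      , region isProfile τ τ-sorts , region-dominant isProfile τ τ-sorts {permInvQ m u (actQ m w x₀)}
          (image∈V x₀ x₀∈A) (image-gaps x₀ x₀∈A) , image∈
      , dyck A , dyck-IsDJ isProfile τ τ-sorts _ (φ⇒far isProfile τ τ-sorts {permInvQ m u (actQ m w x₀)}
          (image∈V x₀ x₀∈A) (image-gaps x₀ x₀∈A)) (far⇒φ isProfile τ τ-sorts)
      , drw-readingOrder τ τ-sorts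
      where
      τ = proj₁ readingOrder
      τ-sorts = proj₂ readingOrder
      u = τ Perm.∘ₚ σ
      x₀ = proj₁ (alcovePoint)
      x₀∈A = proj₂ (alcovePoint)
      M = proj₁ (AGMV⇒place w w∈ agmv)
      place-u : ∀ a → place w (u ⟨$⟩ʳ a) ≡ M + + level isProfile τ τ-sorts a
      place-u a = proj₂ (AGMV⇒place w w∈ agmv) (τ ⟨$⟩ʳ a)
      image∈V : ∀ x → InA m x → InV m (permInvQ m u (actQ m w x))
      image∈V x x∈A = InV-permute u {actQ m w x} (InV-actQ w {x} (proj₁ (proj₁ x∈A)))
      image-gaps : ∀ x → InA m x → Gaps isProfile τ τ-sorts (permInvQ m u (actQ m w x))
      image-gaps x x∈A a b k gap = alcove-gap w {x} x∈A (u ⟨$⟩ʳ a) (u ⟨$⟩ʳ b) k (ℤ-<-via gap (trans (place-u b)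
          (trans (lemma M (+ level isProfile τ τ-sorts a) (+ level isProfile τ τ-sorts b) (+ n * k))
              (cong (λ p → p + + n * k + (+ level isProfile τ τ-sorts b - (+ level isProfile τ τ-sorts a + + n * k)))
              (sym (place-u a))))))
        where
        lemma : ∀ M a b k → M + b ≡ (M + a) + k + (b - (a + k))
        lemma = solve-∀
      image∈ : ∀ x → InA m x → InRegion m (region isProfile τ τ-sorts) (permInvQ m u (actQ m w x))
      image∈ x x∈A = gaps⇒region isProfile τ τ-sorts {permInvQ m u (actQ m w x)} (image∈V x x∈A) (image-gaps x x∈A)

-- Divisibility by an explicit multiple.

module Divisibility where
  open import Data.Integer using (_+_; _*_; -_; _-_; _<_; _≤_)
  open import Data.Nat using (_∸_)

  ∣⇒multiple : ∀ d x → d ℤD.∣ x → Σ[ t ∈ ℤ ] x ≡ d * t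
  ∣⇒multiple d x d∣x with Signed.∣ᵤ⇒∣ {d} {x} d∣x
  ... | Signed.divides q eq = q , trans eq (ℤₚ.*-comm q d)

  multiple⇒∣ : ∀ d x t → x ≡ d * t → d ℤD.∣ x
  multiple⇒∣ d x t eq = Signed.∣⇒∣ᵤ {d} {x} (Signed.divides t (trans eq (ℤₚ.*-comm d t)))

open Divisibility

-- The finite torus, the map Γ and the equality with ε.

module FiniteTorus (m : ℕ) where
  open import Data.Integer using (_+_; _*_; -_; _-_; _<_; _≤_)
  open import Data.Nat using (_∸_)
  open Paths m
  open AffinePermutations m
  open Alcoves m
  open Profiles m
  open Regions m
  open StableElements m
  open MinimalAlcoves m
  open RootPoset m
  open ParkingFunctions m
  open AffineParking m

  private
    n = suc m

  actInvZ-origin-sum : ∀ wN → sumℤ m (actInvZ m wN (λ _ → + 0)) ≡ + 0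
  actInvZ-origin-sum wN = begin
    sumℤ m (actInvZ m wN (λ _ → + 0)) ≡⟨ sumℤ-cong (λ i → ℤₚ.+-identityˡ (- tr wN (perm wN ⟨$⟩ʳ i))) ⟩
    sumℤ m (λ i → - tr wN (perm wN ⟨$⟩ʳ i)) ≡⟨ sumℤ-permute (perm wN) (λ a → - tr wN a) ⟩
    sumℤ m (λ a → - tr wN a) ≡⟨ sumℤ-neg (tr wN) ⟩
    - sumℤ m (tr wN) ≡⟨ cong -_ (trSum wN) ⟩
    + 0                                                   ∎
    where open ≡-Reasoning

  actZ-sum : ∀ w y → sumℤ m (actZ m w y) ≡ sumℤ m y
  actZ-sum w y = begin
    sumℤ m (actZ m w y) ≡⟨ sumℤ-+ (λ a → y (perm w ⟨$⟩ˡ a)) (tr w) ⟩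
    sumℤ m (λ a → y (perm w ⟨$⟩ˡ a)) + sumℤ m (tr w) ≡⟨ cong₂ _+_ (sumℤ-permute (Perm.flip (perm w)) y) (trSum w) ⟩
    sumℤ m y + + 0 ≡⟨ ℤₚ.+-identityʳ _ ⟩
    sumℤ m y                                              ∎
    where open ≡-Reasoning

  -- Since - n ≡ 1 modulo n + 1, the place v - n λ and the coordinate v + λ are congruent.
  actZ-place : ∀ wR wN → IsWn1 m wN → ∀ b → Σ[ t ∈ ℤ ]
               actZ m wR (actInvZ m wN (λ _ → + 0)) b ≡ actInvZ m wN (λ _ → + 0) Fin.zero + place wR b + + suc n * t
  actZ-place wR wN wN∈ b with IsWn1⇒actInvZ wN wN∈ (perm wR ⟨$⟩ˡ b)
  ... | k , y≡ = k + tr wR b , trans (cong (_+ tr wR b) y≡)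
      (trans (lemma (actInvZ m wN (λ _ → + 0) Fin.zero) (+ toℕ (perm wR ⟨$⟩ˡ b)) (+ n) k (tr wR b))
      (cong (λ p → actInvZ m wN (λ _ → + 0) Fin.zero + p + + suc n * (k + tr wR b))
          (sym (pk-def (perm wR ⟨$⟩ˡ b) (- tr wR b)))))
    where
    lemma : ∀ y i n k t → y + i + (+ 1 + n) * k + t ≡ y + (i + n * - t) + (+ 1 + n) * (k + t)
    lemma = solve-∀

  key-mod : ∀ {A} → IsProfile A → ∀ i → + key A i ≡ + (toℕ i ∸ A i) + + suc n * + A i
  key-mod {A} isProfile i = trans (trans (key≡pk A i) (pk-def i (+ A i)))
      (trans (cong (_+ + n * + A i) (trans (cong +_ (sym (ℕₚ.m∸n+n≡m (profile-≤ isProfile i))))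
      (ℤₚ.pos-+ (toℕ i ∸ A i) (A i))))
      (lemma (+ (toℕ i ∸ A i)) (+ A i) (+ n)))
    where
    lemma : ∀ p a n → (p + a) + n * a ≡ p + (+ 1 + n) * a
    lemma = solve-∀

  -- If g had a smaller value than h at position i, then the i + 1 labels that g lists up to i would
  -- all stand among the i labels that h lists before i.
  sortedValues-unique : ∀ (f : Vec ℕ n) (g h : Permutation′ n) → Sorts f g → Sorts f h → ∀ i → Pv m f g i ≡ Pv m f h i
  sortedValues-unique f g h g-sorts h-sorts i = ℕₚ.≤-antisym (ℕₚ.≮⇒≥ (impossible h g h-sorts g-sorts i))
      (ℕₚ.≮⇒≥ (impossible g h g-sorts h-sorts i))
    where
    impossible : ∀ g h → Sorts f g → Sorts f h → ∀ i → ¬ (Pv m f g i ℕ.< Pv m f h i)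
    impossible g h g-sorts h-sorts i lt = ℕₚ.1+n≰n (Finₚ.injective⇒≤ {f = H} H-injective)
      where
      inject : Fin (suc (toℕ i)) → Fin n
      inject k = fromℕ< (ℕₚ.<-≤-trans (Finₚ.toℕ<n k) (Finₚ.toℕ<n i))
      inject-≤ : ∀ k → inject k Fin.≤ i
      inject-≤ k = ℕₚ.≤-trans (ℕₚ.≤-reflexive (Finₚ.toℕ-fromℕ< _)) (ℕₚ.≤-pred (Finₚ.toℕ<n k))
      before : ∀ k → toℕ (h ⟨$⟩ˡ (g ⟨$⟩ʳ inject k)) ℕ.< toℕ i
      before k = ℕₚ.≰⇒> λ i≤ → ℕₚ.<⇒≱ lt (ℕₚ.≤-trans (Sorts⇒mono f h h-sorts i≤)
          (ℕₚ.≤-trans (ℕₚ.≤-reflexive (cong (lookup f) (inverseʳ h))) (Sorts⇒mono f g g-sorts (inject-≤ k))))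
      H : Fin (suc (toℕ i)) → Fin (toℕ i)
      H k = fromℕ< (before k)
      H-injective : ∀ {k l} → H k ≡ H l → k ≡ l
      H-injective {k} {l} eq = Finₚ.toℕ-injective (Finₚ.fromℕ<-injective (toℕ k) (toℕ l) _ _
        (⟨$⟩ʳ-injective g (⟨$⟩ˡ-injective h
            (Finₚ.toℕ-injective (Finₚ.fromℕ<-injective _ _ (before k) (before l) eq)))))

  -- Adding the sum S of f to each of the n coordinates raises the total to (n + 1) S, which is then
  -- removed from coordinate 0 without changing residues modulo n + 1.
  ChiRel-surjective : ∀ (f : Vec ℕ n) → IsPF m f → Σ[ c ∈ (Fin n → ℤ) ] ChiRel m c f
  ChiRel-surjective f f∈PF = c , Σc , f∈PF , - S , λ i → multiple⇒∣ (+ suc n) (+ lookup f i - (c i + - S))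
      (S * ind Fin.zero i) (lemma (+ lookup f i) S (+ suc n) (ind Fin.zero i))
    where
    open ≡-Reasoning
    S = sumℤ m (λ i → + lookup f i)
    c : Fin n → ℤ
    c i = + lookup f i + (S - + suc n * (S * ind Fin.zero i))
    lemma : ∀ f S N δ → f - (f + (S - N * (S * δ)) + - S) ≡ N * (S * δ)
    lemma = solve-∀
    Σc : InQ m c
    Σc = begin
      sumℤ m c ≡⟨ sumℤ-+ (λ i → + lookup f i) (λ i → S - + suc n * (S * ind Fin.zero i)) ⟩
      S + sumℤ m (λ i → S - + suc n * (S * ind Fin.zero i))
          ≡⟨ cong (λ s → S + s) (sumℤ-+ (λ _ → S) (λ i → - (+ suc n * (S * ind Fin.zero i)))) ⟩
      S + (sumℤ m (λ _ → S) + sumℤ m (λ i → - (+ suc n * (S * ind Fin.zero i))))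
          ≡⟨ cong₂ (λ s s′ → S + (s + s′)) (sumℤ-const S)
          (trans (sumℤ-neg (λ i → + suc n * (S * ind Fin.zero i)))
              (cong -_ (trans (sumℤ-* (+ suc n) (λ i → S * ind Fin.zero i))
              (cong (λ s → + suc n * s) (sumℤ-ind Fin.zero (λ _ → S)))))) ⟩
      S + (+ n * S + - (+ suc n * S)) ≡⟨ lemma′ S (+ n) ⟩
      + 0                                                                               ∎
      where
      lemma′ : ∀ S n → S + (n * S + - ((+ 1 + n) * S)) ≡ + 0
      lemma′ = solve-∀

  module _ (f : Vec ℕ n) (f∈PF : IsPF m f) (σ : Permutation′ n) (sorts : Sorts f σ) (stable≡ : Stable≡ f σ) where

    private
      A = area m f σ
      isProfile : IsProfile A
      isProfile = area-profile f f∈PF σ sorts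

    module _ (c : Fin n → ℤ) (c∈ : ChiRel m c f) where

      private
        k = proj₁ (proj₂ (proj₂ c∈))

        f≡ : ∀ a → Σ[ t ∈ ℤ ] + lookup f a - (c a + k) ≡ + suc n * t
        f≡ a = ∣⇒multiple (+ suc n) (+ lookup f a - (c a + k)) (proj₂ (proj₂ (proj₂ c∈)) a)

      Γ-surjective : Σ[ w ∈ Permutation′ n ] Σ[ J ∈ (PosRoot m → Bool) ] IsFilter m J × GammaRel m w J c
      Γ-surjective = u , J , far-isFilter isProfile τ τ-sorts J J⇒far far⇒J
        , region isProfile τ τ-sorts , region-dominant isProfile τ τ-sorts {actQ m wR x₀} z∈V gaps
        , (λ α → (λ Jα → far⇒φ isProfile τ τ-sorts α (J⇒far α Jα)) , λ φα →
            far⇒J α (φ⇒far isProfile τ τ-sorts {actQ m wR x₀} z∈V gaps α φα))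
        , wR , region-minimal isProfile τ τ-sorts wR M place-R
        , wN , wN∈ , λ a → multiple⇒∣ (+ suc n) (g a - c a) (proj₁ diff≡0 + t a)
            (trans (diff a) (trans (cong (_+ + suc n * t a) (proj₂ diff≡0))
            (sym (ℤₚ.*-distribˡ-+ (+ suc n) (proj₁ diff≡0) (t a)))))
        where
        τ = proj₁ (readingOrder f f∈PF σ sorts stable≡)
        τ-sorts = proj₂ (readingOrder f f∈PF σ sorts stable≡)
        u = τ Perm.∘ₚ σ
        J : PosRoot m → Bool
        J α = does (far? isProfile τ τ-sorts α)
        J⇒far : ∀ α → J α ≡ true → Far isProfile τ τ-sorts α
        J⇒far α = does⁻ (far? isProfile τ τ-sorts α)
        far⇒J : ∀ α → Far isProfile τ τ-sorts α → J α ≡ true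
        far⇒J α = dec-true (far? isProfile τ τ-sorts α)
        M = - sumℤ m (λ i → + A i)
        wR = proj₁ (fromProfile A τ)
        place-R : ∀ a → place wR a ≡ M + + level isProfile τ τ-sorts a
        place-R = proj₂ (fromProfile A τ)
        κ = - sumℤ m (λ i → + toℕ i)
        -- The staircase profile i ↦ i has keys (n + 1) i, the spacing required by `place⇒IsWn1`.
        wN = proj₁ (fromProfile toℕ Perm.id)
        wN∈ : IsWn1 m wN
        wN∈ = place⇒IsWn1 wN κ λ a → trans (proj₂ (fromProfile toℕ Perm.id) a)
            (cong (λ p → κ + p) (trans (trans (key≡pk toℕ a) (pk-def a (+ toℕ a))) (lemma (+ toℕ a) (+ n))))
          where
          lemma : ∀ a n → a + n * a ≡ (+ 1 + n) * a
          lemma = solve-∀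
        x₀ = proj₁ (alcovePoint)
        x₀∈A = proj₂ (alcovePoint)
        z∈V : InV m (actQ m wR x₀)
        z∈V = InV-actQ wR {x₀} (proj₁ (proj₁ x₀∈A))
        gaps : Gaps isProfile τ τ-sorts (actQ m wR x₀)
        gaps = alcove-gaps isProfile τ τ-sorts wR M place-R x₀ x₀∈A
        y = actInvZ m wN (λ _ → + 0)
        e = y Fin.zero + M + k
        g : Fin n → ℤ
        g = permZ m u (actZ m wR y)
        s : Fin n → ℤ
        s a = proj₁ (actZ-place wR wN wN∈ (u ⟨$⟩ˡ a))
        t : Fin n → ℤ
        t a = + A (σ ⟨$⟩ˡ a) + s a + proj₁ (f≡ a)
        level≡ : ∀ a → + level isProfile τ τ-sorts (u ⟨$⟩ˡ a) ≡ + lookup f a + + suc n * + A (σ ⟨$⟩ˡ a)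
        level≡ a = trans (cong (λ i → + key A i) (inverseʳ τ)) (trans (key-mod isProfile (σ ⟨$⟩ˡ a))
            (cong (λ p → + p + + suc n * + A (σ ⟨$⟩ˡ a))
          (trans (ℕₚ.m∸[m∸n]≡n (Pv-≤ f f∈PF σ sorts (σ ⟨$⟩ˡ a))) (cong (lookup f) (inverseʳ σ)))))
        diff : ∀ a → g a - c a ≡ e + + suc n * t a
        diff a = begin
          g a - c a ≡⟨ cong (_- c a) (proj₂ (actZ-place wR wN wN∈ (u ⟨$⟩ˡ a))) ⟩
          y Fin.zero + place wR (u ⟨$⟩ˡ a) + + suc n * s a - c a
              ≡⟨ cong (λ p → y Fin.zero + p + + suc n * s a - c a)
              (trans (place-R (u ⟨$⟩ˡ a)) (cong (λ l → M + l) (level≡ a))) ⟩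
          y Fin.zero + (M + (+ lookup f a + + suc n * + A (σ ⟨$⟩ˡ a))) + + suc n * s a - c a
              ≡⟨ lemma (y Fin.zero) M (+ lookup f a) (+ suc n) (+ A (σ ⟨$⟩ˡ a)) (s a) (c a) k ⟩
          y Fin.zero + M + k + + suc n * (+ A (σ ⟨$⟩ˡ a) + s a) + (+ lookup f a - (c a + k))
              ≡⟨ cong (λ p → y Fin.zero + M + k + + suc n * (+ A (σ ⟨$⟩ˡ a) + s a) + p) (proj₂ (f≡ a)) ⟩
          y Fin.zero + M + k + + suc n * (+ A (σ ⟨$⟩ˡ a) + s a) + + suc n * proj₁ (f≡ a)
              ≡⟨ lemma′ e (+ suc n) (+ A (σ ⟨$⟩ˡ a) + s a) (proj₁ (f≡ a)) ⟩
          e + + suc n * t a                                                                                ∎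
          where
          open ≡-Reasoning
          lemma : ∀ y M f N A s c k → y + (M + (f + N * A)) + N * s - c ≡ y + M + k + N * (A + s) + (f - (c + k))
          lemma = solve-∀
          lemma′ : ∀ e N a b → e + N * a + N * b ≡ e + N * (a + b)
          lemma′ = solve-∀
        -- Both g and c have coordinate sum 0, hence n e ≡ 0 modulo n + 1.
        diff≡0 : Σ[ q ∈ ℤ ] e ≡ + suc n * q
        diff≡0 = e + sumℤ m t , (begin
          e ≡⟨ lemma e (+ n) (sumℤ m t) ⟩
          + suc n * (e + sumℤ m t) - (+ n * e + + suc n * sumℤ m t)
              ≡⟨ cong (λ z → + suc n * (e + sumℤ m t) - z) sum≡0 ⟩
          + suc n * (e + sumℤ m t) - + 0 ≡⟨ ℤₚ.+-identityʳ _ ⟩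
          + suc n * (e + sumℤ m t)                                ∎)
          where
          open ≡-Reasoning
          lemma : ∀ e n s → e ≡ (+ 1 + n) * (e + s) - (n * e + (+ 1 + n) * s)
          lemma = solve-∀
          sum≡0 : + n * e + + suc n * sumℤ m t ≡ + 0
          sum≡0 = begin
            + n * e + + suc n * sumℤ m t ≡⟨ cong₂ _+_ (sumℤ-const e) (sumℤ-* (+ suc n) t) ⟨
            sumℤ m (λ _ → e) + sumℤ m (λ a → + suc n * t a) ≡⟨ sumℤ-+ (λ _ → e) (λ a → + suc n * t a) ⟨
            sumℤ m (λ a → e + + suc n * t a) ≡⟨ sumℤ-cong diff ⟨
            sumℤ m (λ a → g a - c a) ≡⟨ sumℤ-+ g (λ a → - c a) ⟩
            sumℤ m g + sumℤ m (λ a → - c a)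
                ≡⟨ cong₂ _+_ (trans (sumℤ-permute (Perm.flip u) (actZ m wR y))
                (trans (actZ-sum wR y) (actInvZ-origin-sum wN)))
                                                                     (trans (sumℤ-neg c) (cong -_ (proj₁ c∈))) ⟩
            + 0                                                    ∎

      -- The minimal alcove yields a profile and an order ρ of its places. The congruence for Γ
      -- makes w after ρ a list of labels with the values of that profile up to one constant, and
      -- `coset-unique` removes the constant.
      Γ⇒Eps : ∀ w J → IsFilter m J → GammaRel m w J c → Eps m w J (drw m f σ , zetaH m f σ)
      Γ⇒Eps w J J-filter (s , s-dominant , J⇔φ , wR , wR-minimal , wN , wN∈ , congruent) =
          u , refls , ind-increasing , dyck A , dyck-IsDJ isProfile τ τ-sorts (λ α → J α ≡ true) J⇒far far⇒J
        , drw-readingOrder f f∈PF σ sorts stable≡ τ τ-sorts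
        where
        increasing : ∀ a b → a Fin.< b → place wR a < place wR b
        increasing = dominant⇒increasing s s-dominant wR wR-minimal
        least : ∀ a → place wR Fin.zero ≤ place wR a
        least Fin.zero = ℤₚ.≤-refl
        least (Fin.suc a) = ℤₚ.<⇒≤ (increasing Fin.zero (Fin.suc a) (s≤s z≤n))
        M = place wR Fin.zero
        module C = Config (config wR Fin.zero (minimal⇒stable s s-dominant wR wR-minimal) least)
        ρ = C.ρ
        y = actInvZ m wN (λ _ → + 0)
        values : ∀ i → lookup f (w ⟨$⟩ʳ (ρ ⟨$⟩ʳ i)) ≡ toℕ i ∸ C.A i
        values = coset-unique f f∈PF σ sorts C.profile (ρ Perm.∘ₚ w) (y Fin.zero + M + k) congruence
          where
          congruence : ∀ i → Σ[ t ∈ ℤ ] + lookup f (w ⟨$⟩ʳ (ρ ⟨$⟩ʳ i)) ≡ (+ (toℕ i ∸ C.A i) + (y Fin.zero + M + k)) +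
              + suc n * t
          congruence i = + C.A i + t₁ - t₂ + t₃ , (begin
            + lookup f a ≡⟨ lemma₀ (+ lookup f a) (c a + k) ⟩
            c a + k + (+ lookup f a - (c a + k)) ≡⟨ cong (λ d → c a + k + d) (proj₂ (f≡ a)) ⟩
            c a + k + + suc n * t₃ ≡⟨ lemma₁ (c a) k (+ suc n * t₃) z ⟩
            z - (z - c a) + k + + suc n * t₃ ≡⟨ cong (λ d → z - d + k + + suc n * t₃) z-c≡ ⟩
            z - + suc n * t₂ + k + + suc n * t₃
                ≡⟨ cong (λ z → z - + suc n * t₂ + k + + suc n * t₃) (trans (proj₂ (actZ-place wR wN wN∈ (ρ ⟨$⟩ʳ i)))
                                                                                         (cong (λ p → y Fin.zero + p +
                                                                                             + suc n * t₁)
                                                                                             (trans (C.place-ρ i)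
                                                                                             (cong (λ q →
                                                                                             M + q)
                                                                                             (key-mod C.profile i))))) ⟩
            y Fin.zero + (M + (p + + suc n * + C.A i)) + + suc n * t₁ - + suc n * t₂ + k + + suc n * t₃
                ≡⟨ lemma₂ (y Fin.zero) M p (+ suc n) (+ C.A i) t₁ t₂ k t₃ ⟩
            (p + (y Fin.zero + M + k)) + + suc n * (+ C.A i + t₁ - t₂ + t₃)         ∎)
            where
            open ≡-Reasoning
            a = w ⟨$⟩ʳ (ρ ⟨$⟩ʳ i)
            p = + (toℕ i ∸ C.A i)
            z = actZ m wR y (ρ ⟨$⟩ʳ i)
            t₁ = proj₁ (actZ-place wR wN wN∈ (ρ ⟨$⟩ʳ i))
            t₂ = proj₁ (∣⇒multiple (+ suc n) (permZ m w (actZ m wR y) a - c a) (congruent a))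
            t₃ = proj₁ (f≡ a)
            z-c≡ : z - c a ≡ + suc n * t₂
            z-c≡ = trans (cong (λ b → actZ m wR y b - c a) (sym (inverseˡ w)))
                (proj₂ (∣⇒multiple (+ suc n) (permZ m w (actZ m wR y) a - c a) (congruent a)))
            lemma₀ : ∀ f c → f ≡ c + (f - c)
            lemma₀ = solve-∀
            lemma₁ : ∀ c k t z → c + k + t ≡ z - (z - c) + k + t
            lemma₁ = solve-∀
            lemma₂ : ∀ y M p N A t₁ t₂ k t₃ → y + (M + (p + N * A)) + N * t₁ - N * t₂ + k + N * t₃ ≡ (p + (y + M + k))
                + N * (A + t₁ - t₂ + t₃)
            lemma₂ = solve-∀
        wρ-sorts : Sorts f (ρ Perm.∘ₚ w)
        wρ-sorts i j i<j = subst₂ ℕ._≤_ (sym (values i)) (sym (values j)) (P-mono i j (ℕₚ.<⇒≤ i<j))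
          where
          P-step : ∀ i j → toℕ j ≡ suc (toℕ i) → toℕ i ∸ C.A i ℕ.≤ toℕ j ∸ C.A j
          P-step i j eq = subst (λ j′ → toℕ i ∸ C.A i ℕ.≤ j′ ∸ C.A j) (sym eq)
              (ℕₚ.∸-monoʳ-≤ (suc (toℕ i)) (IsProfile.step≤ C.profile i j eq))
          P-mono : ∀ i j → i Fin.≤ j → toℕ i ∸ C.A i ℕ.≤ toℕ j ∸ C.A j
          P-mono i j = go (toℕ j) j refl
            where
            go : ∀ l j → toℕ j ≡ l → toℕ i ℕ.≤ toℕ j → toℕ i ∸ C.A i ℕ.≤ toℕ j ∸ C.A j
            go l j j≡ i≤j with ℕₚ.m≤n⇒m<n∨m≡n i≤j
            ... | inj₂ eq = ℕₚ.≤-reflexive (cong (λ i → toℕ i ∸ C.A i) (Finₚ.toℕ-injective {i = i} {j} eq))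
            go zero j j≡ i≤j | inj₁ i<j = ⊥-elim (ℕₚ.n≮0 (subst (toℕ i ℕ.<_) j≡ i<j))
            go (suc l) j j≡ i≤j | inj₁ i<j with predecessor j j≡
            ... | j′ , j′≡ , sj′≡ = ℕₚ.≤-trans (go l j′ j′≡ (ℕₚ.≤-pred (subst (toℕ i ℕ.<_) sj′≡ i<j)))
                (P-step j′ j sj′≡)
        -- Here w after ρ may order labels of equal value differently from σ. Only the values are
        -- compared, and they already determine the profile.
        Pv≡ : ∀ i → lookup f (w ⟨$⟩ʳ (ρ ⟨$⟩ʳ i)) ≡ Pv m f σ i
        Pv≡ = sortedValues-unique f (ρ Perm.∘ₚ w) σ wρ-sorts sorts
        A≡ : ∀ i → C.A i ≡ A i
        A≡ i = sym (trans (cong (toℕ i ∸_) (trans (sym (Pv≡ i)) (values i))) (ℕₚ.m∸[m∸n]≡n (profile-≤ C.profile i)))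
        τ : Permutation′ n
        τ = Perm.flip ρ
        place≡ : ∀ a → place wR a ≡ M + + key A (τ ⟨$⟩ʳ a)
        place≡ a = trans (cong (place wR) (sym (inverseʳ ρ)))
            (trans (C.place-ρ (ρ ⟨$⟩ˡ a)) (cong (λ A → M + + (A ℕ.* n ℕ.+ toℕ (ρ ⟨$⟩ˡ a))) (A≡ (ρ ⟨$⟩ˡ a))))
        τ-sorts : ∀ a b → a Fin.< b → key A (τ ⟨$⟩ʳ a) ℕ.< key A (τ ⟨$⟩ʳ b)
        τ-sorts a b a<b = ℤₚ.drop‿+<+
            (ℤ-<-via (increasing a b a<b) (trans (lemma M (+ key A (τ ⟨$⟩ʳ a)) (+ key A (τ ⟨$⟩ʳ b)))
            (cong₂ (λ p q → + key A (τ ⟨$⟩ʳ a) + (p - q)) (sym (place≡ b)) (sym (place≡ a)))))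
          where
          lemma : ∀ M a b → b ≡ a + (M + b - (M + a))
          lemma = solve-∀
        u = τ Perm.∘ₚ σ
        x₀ = proj₁ (alcovePoint)
        x₀∈A = proj₂ (alcovePoint)
        z∈ : InRegion m s (actQ m wR x₀)
        z∈ = proj₁ wR-minimal x₀ x₀∈A
        J⇒far : ∀ α → J α ≡ true → Far isProfile τ τ-sorts α
        J⇒far α Jα = ℤₚ.drop‿+<+ (ℤ-<-via (pair->⁻ wR {x₀} x₀∈A α (+ 1) (proj₁ (J⇔φ α) Jα (actQ m wR x₀) z∈))
            (trans (lemma M (+ key A (τ ⟨$⟩ʳ ri α)) (+ key A (τ ⟨$⟩ʳ rj α)) (+ n))
                (cong₂ (λ p q → + n + + key A (τ ⟨$⟩ʳ ri α) + (p - (q + + n * + 1))) (sym (place≡ (rj α)))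
                (sym (place≡ (ri α))))))
          where
          lemma : ∀ M a b n → b ≡ n + a + (M + b - (M + a + n * + 1))
          lemma = solve-∀
        -- The sign vector s fixes the position of α on the whole region, so one sample point above
        -- 1 decides for all points.
        far⇒J : ∀ α → Far isProfile τ τ-sorts α → J α ≡ true
        far⇒J α far = proj₂ (J⇔φ α) λ z z∈′ → above (s α) (proj₂ z∈ α) (proj₂ z∈′ α)
          where
          1<pair : 1ℚ ℚ.< pairQ m (actQ m wR x₀) α
          1<pair = pair-> wR {x₀} x₀∈A α (+ 1)
              (ℤ-<-via (ℤ.+<+ far) (trans (place≡ (rj α))
              (trans (lemma M (+ key A (τ ⟨$⟩ʳ ri α)) (+ key A (τ ⟨$⟩ʳ rj α)) (+ n))
              (cong (λ p → p + + n * + 1 + (+ key A (τ ⟨$⟩ʳ rj α) - (+ n + + key A (τ ⟨$⟩ʳ ri α))))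
                  (sym (place≡ (ri α)))))))
            where
            lemma : ∀ M a b n → M + b ≡ M + a + n * + 1 + (b - (n + a))
            lemma = solve-∀
          above : ∀ t {v} → Sat m t (pairQ m (actQ m wR x₀) α) → Sat m t v → 1ℚ ℚ.< v
          above neg <0 _ = ⊥-elim (ℚₚ.<-asym 1<pair (ℚₚ.<-trans <0 (ι-<-mono {+ 0} {+ 1} (ℤ.+<+ (s≤s z≤n)))))
          above mid (_ , <1) _ = ⊥-elim (ℚₚ.<-asym 1<pair <1)
          above pos _ 1< = 1<
        ind-increasing : ∀ α → IsInd m J α → (u ⟨$⟩ʳ ri α) Fin.< (u ⟨$⟩ʳ rj α)
        ind-increasing α α∈ = area-tie f f∈PF σ sorts stable≡ _ _ (proj₁ adjacent) (proj₂ adjacent)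
          where
          adjacent = ind⇒adjacent isProfile τ τ-sorts J J⇒far far⇒J α α∈
        -- Here g measures how w after ρ, corrected by reflections, still differs from σ. Without
        -- reflections it is the full discrepancy; once it is the identity, the reflections carry w
        -- to u.
        Reachable : (Fin n → Fin n) → Set
        Reachable g = Σ[ L ∈ List (PosRoot m) ] All (IsInd m J) L × ∀ i → σ ⟨$⟩ʳ g i ≡ w ⟨$⟩ʳ applyRefls m L
            (ρ ⟨$⟩ʳ i)
        -- Equal values at neighbouring positions mean a rise of the area by 1, so the two keys
        -- differ by n + 1 and the exchange is the reflection in a minimal root of J.
        reachable-swap : ∀ g i j → toℕ j ≡ suc (toℕ i) → Pv m f σ i ≡ Pv m f σ j → Reachable g → Reachable
            (g ∘ PermC.transpose i j)
        reachable-swap g i j j≡ P≡ (L , L⊆ , g≡) = L ++ α ∷ [] , Allₚ.++⁺ L⊆ (α∈ ∷ [])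
          , λ k → trans (g≡ (PermC.transpose i j k))
              (cong (w ⟨$⟩ʳ_) (trans (cong (applyRefls m L) (swap-conjugate ρ α i j refl refl k))
              (sym (applyRefls-++ L (α ∷ []) (ρ ⟨$⟩ʳ k)))))
          where
          key≡ : key A j ≡ suc (n ℕ.+ key A i)
          key≡ = trans (cong₂ (λ a b → a ℕ.* n ℕ.+ b) (Pv≡⇒level-step f f∈PF σ sorts i j j≡ P≡) j≡)
              (trans (ℕₚ.+-suc (suc (A i) ℕ.* n) (toℕ i)) (cong suc (ℕₚ.+-assoc n (A i ℕ.* n) (toℕ i))))
          α : PosRoot m
          α = root (ρ ⟨$⟩ʳ i) (ρ ⟨$⟩ʳ j)
              (τ-reflects isProfile τ τ-sorts (subst (key A i ℕ.<_) (sym key≡) (s≤s (ℕₚ.m≤n+m (key A i) n))))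
          α∈ : IsInd m J α
          α∈ = adjacent⇒ind isProfile τ τ-sorts J J⇒far far⇒J α
              (trans (cong (key A) (inverseˡ ρ)) (trans key≡ (cong (λ i → suc (n ℕ.+ key A i)) (sym (inverseˡ ρ)))))
        reachable-resp : ∀ {g h} → (∀ i → g i ≡ h i) → Reachable g → Reachable h
        reachable-resp eq (L , L⊆ , g≡) = L , L⊆ , λ i → trans (cong (σ ⟨$⟩ʳ_) (sym (eq i))) (g≡ i)
        reached : Reachable (λ i → i)
        reached = bubbleSort (Pv m f σ) (λ i j → Sorts⇒mono f σ sorts {i} {j}) Reachable reachable-resp reachable-swap
            (ρ Perm.∘ₚ w Perm.∘ₚ Perm.flip σ)
          (λ i → trans (cong (lookup f) (inverseʳ σ)) (Pv≡ i)) ([] , [] , λ i → inverseʳ σ)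
        refls : Σ[ L ∈ List (PosRoot m) ] All (IsInd m J) L × (∀ a → u ⟨$⟩ʳ a ≡ w ⟨$⟩ʳ applyRefls m L a)
        refls = proj₁ reached , proj₁ (proj₂ reached) , λ a → trans (proj₂ (proj₂ reached) (ρ ⟨$⟩ˡ a))
            (cong (λ b → w ⟨$⟩ʳ applyRefls m (proj₁ reached) b) (inverseʳ ρ))

open ParkingFunctions
open AffineParking
open FiniteTorus

theorem16p3 : (m : ℕ) (f : Vec ℕ (suc m)) → IsPF m f →
    Σ (Out m) (ZHL m f) ×
    (∀ X → ZHL m f X →
    ((Σ[ c ∈ (Fin (suc m) → ℤ) ] ChiRel m c f) ×
    (∀ c → ChiRel m c f →
    (Σ[ w ∈ Permutation′ (suc m) ] Σ[ J ∈ (PosRoot m → Bool) ] IsFilter m J × GammaRel m w J c) ×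
    (∀ w J → IsFilter m J → GammaRel m w J c → Eps m w J X)))
    × ((Σ[ w ∈ Aff m ] InSn1 m w × AGMV m w f) ×
    (∀ w → InSn1 m w → AGMV m w f → Delta m w X)))
theorem16p3 m f f∈PF = (_ , proj₁ sorted , proj₁ (isStableSort⁻ m f (proj₁ sorted) (proj₂ sorted)) ,
    proj₂ (isStableSort⁻ m f (proj₁ sorted) (proj₂ sorted)) , refl)
  , λ { _ (σ , sorts , stable , refl) →
      (ChiRel-surjective m f f∈PF , λ c c∈ → Γ-surjective m f f∈PF σ sorts stable c c∈ , Γ⇒Eps m f f∈PF σ sorts stable
          c c∈)
    , AGMV-surjective m f f∈PF σ sorts stable , AGMV⇒Delta m f f∈PF σ sorts stable }
  where
  sorted = stableSort m f
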